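{- Let $S_1$ and $S_2$ be two finite $\Gamma$-labelled forests. Over the class of all finite digraphs (finite structures over the signature $\langle E\rangle$ with $E$ a binary relation symbol), if $S_1\not\preceq_e S_2$, then $\mathrm{FO}\{S_1\}\not\subseteq \mathrm{FO}\{S_2\}$.
   Context: $\Gamma=\{\exists,\forall\}$. A $\Gamma$-labelled forest is a finite disjoint union of rooted directed trees (arcs go from a father to its children), every node labelled $\exists$ or $\forall$. All first-order formulas are assumed in negation normal form (negations only directly in front of atoms). The quantifier structure $qs(\varphi)$ of a first-order formula $\varphi$ is the $\Gamma$-labelled forest defined inductively: if $\varphi$ is a literal, $qs(\varphi)$ is empty; if $\varphi$ is a conjunction or disjunction of $\theta_1,\dots,\theta_n$, $qs(\varphi)$ is the disjoint union of the $qs(\theta_i)$; if $\varphi=\exists x\,\theta$ (resp. $\forall x\,\theta$), $qs(\varphi)$ consists of a new node labelled $\exists$ (resp. $\forall$) together with $qs(\theta)$ and an arc from the new node to each root of $qs(\theta)$. For $\Gamma$-labelled forests $S,S'$, $S\preceq_e S'$ means there is a map $\iota$ (not necessarily injective) from the nodes of $S$ to the nodes of $S'$ such that $v$ and $\iota(v)$ have the same label for every node $v$, and whenever there is an arc from $x$ to $y$ in $S$ there is a directed path of length at least one from $\iota(x)$ to $\iota(y)$ in $S'$. For a $\Gamma$-labelled forest $S$, $\mathrm{FO}\{S\}$ is the set of properties (isomorphism-closed classes of structures in the class under consideration) definable, over that class, by a first-order sentence $\theta$ with $qs(\theta)\preceq_e S$. Thus "$\mathrm{FO}\{S_1\}\not\subseteq\mathrm{FO}\{S_2\}$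 over a class $\mathcal C$" means there is a property of structures in $\mathcal C$ defined on $\mathcal C$ by a first-order sentence $\theta$ with $qs(\theta)\preceq_e S_1$ that is not defined on $\mathcal C$ by any first-order sentence $\theta'$ with $qs(\theta')\preceq_e S_2$. -}

module Defs where

open import Data.Nat using (ℕ; suc)
open import Data.Fin using (Fin; zero; suc)
open import Data.List using (List; []; _∷_; _++_)
open import Data.Bool using (Bool; true)
open import Data.Product using (Σ; _×_; _,_)
open import Data.Sum using (_⊎_)
open import Data.Empty using (⊥)
open import Data.Unit using (⊤)
open import Relation.Nullary using (¬_)
open import Relation.Binary.PropositionalEquality using (_≡_)
open import Relation.Binary.Construct.Closure.Transitive using (TransClosure)

data Γ : Set where
  ∃ₗ ∀ₗ : Γ

data Tree : Set where
  node : Γ → List Tree → Tree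

Forest : Set
Forest = List Tree

mutual
  data TNode : Tree → Set where
    here  : ∀ {l ts} → TNode (node l ts)
    below : ∀ {l ts} → FNode ts → TNode (node l ts)

  data FNode : Forest → Set where
    hd : ∀ {t ts} → TNode t → FNode (t ∷ ts)
    tl : ∀ {t ts} → FNode ts → FNode (t ∷ ts)

mutual
  tlabel : ∀ {t} → TNode t → Γ
  tlabel {node l ts} here = l
  tlabel (below p) = flabel p

  flabel : ∀ {F} → FNode F → Γ
  flabel (hd p) = tlabel p
  flabel (tl p) = flabel p

data IsRoot : ∀ {F} → FNode F → Set where
  root-hd : ∀ {l ts ts'} → IsRoot {node l ts ∷ ts'} (hd here)
  root-tl : ∀ {t ts} {p : FNode ts} → IsRoot p → IsRoot {t ∷ ts} (tl p)

mutual
  data TArc : ∀ {t} → TNode t → TNode t → Set where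
    top  : ∀ {l ts} {q : FNode ts} → IsRoot q → TArc {node l ts} here (below q)
    deep : ∀ {l ts} {p q : FNode ts} → FArc p q → TArc {node l ts} (below p) (below q)

  data FArc : ∀ {F} → FNode F → FNode F → Set where
    arc-hd : ∀ {t ts} {p q : TNode t} → TArc p q → FArc {t ∷ ts} (hd p) (hd q)
    arc-tl : ∀ {t ts} {p q : FNode ts} → FArc p q → FArc {t ∷ ts} (tl p) (tl q)

Path⁺ : ∀ {F} → FNode F → FNode F → Set
Path⁺ = TransClosure FArc

_⪯e_ : Forest → Forest → Set
S ⪯e S' = Σ (FNode S → FNode S') λ ι →
            (∀ v → flabel (ι v) ≡ flabel v) ×
            (∀ x y → FArc x y → Path⁺ (ι x) (ι y))

-- First-order formulas over ⟨E⟩ (with equality) in negation normal form,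
-- de Bruijn variables: Formula n has free variables among Fin n.

data Formula (n : ℕ) : Set where
  E≈  : Fin n → Fin n → Formula n
  ¬E≈ : Fin n → Fin n → Formula n
  eq  : Fin n → Fin n → Formula n
  ¬eq : Fin n → Fin n → Formula n
  tt ff : Formula n
  _∧_ _∨_ : Formula n → Formula n → Formula n
  ∃′ ∀′ : Formula (suc n) → Formula n

Sentence : Set
Sentence = Formula 0

qs : ∀ {n} → Formula n → Forest
qs (E≈ x y)  = []
qs (¬E≈ x y) = []
qs (eq x y)  = []
qs (¬eq x y) = []
qs tt = []
qs ff = []
qs (φ ∧ ψ) = qs φ ++ qs ψ
qs (φ ∨ ψ) = qs φ ++ qs ψ
qs (∃′ φ) = node ∃ₗ (qs φ) ∷ []
qs (∀′ φ) = node ∀ₗ (qs φ) ∷ []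

-- Finite digraphs: nonempty domain Fin (suc size), E a binary relation.

record Digraph : Set where
  field
    size : ℕ
    E    : Fin (suc size) → Fin (suc size) → Bool

open Digraph public

Dom : Digraph → Set
Dom G = Fin (suc (size G))

extend : ∀ {n} {A : Set} → (Fin n → A) → A → Fin (suc n) → A
extend ρ a zero    = a
extend ρ a (suc i) = ρ i

Sat : ∀ {n} (G : Digraph) → (Fin n → Dom G) → Formula n → Set
Sat G ρ (E≈ x y)  = E G (ρ x) (ρ y) ≡ true
Sat G ρ (¬E≈ x y) = ¬ (E G (ρ x) (ρ y) ≡ true)
Sat G ρ (eq x y)  = ρ x ≡ ρ y
Sat G ρ (¬eq x y) = ¬ (ρ x ≡ ρ y)
Sat G ρ tt = ⊤
Sat G ρ ff = ⊥
Sat G ρ (φ ∧ ψ) = Sat G ρ φ × Sat G ρ ψ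
Sat G ρ (φ ∨ ψ) = Sat G ρ φ ⊎ Sat G ρ ψ
Sat G ρ (∃′ φ) = Σ (Dom G) λ a → Sat G (extend ρ a) φ
Sat G ρ (∀′ φ) = (a : Dom G) → Sat G (extend ρ a) φ

noVars : {A : Set} → Fin 0 → A
noVars ()

_⊨_ : Digraph → Sentence → Set
G ⊨ θ = Sat G noVars θ

SameProperty : Sentence → Sentence → Set
SameProperty θ θ' = ∀ G → (G ⊨ θ → G ⊨ θ') × (G ⊨ θ' → G ⊨ θ)

{-# OPTIONS --safe #-}

-- A forest S prescribes an Ehrenfeucht–Fraïssé game on two digraphs A and B: at a node labelled
-- ∃ Spoiler picks in A, at a node labelled ∀ in B, and he continues at one of its children.  The
-- characteristic sentence of A for S holds in B exactly when Duplicator wins this game, and then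
-- every sentence θ with qs θ ⪯e S that holds in A holds in B.  Some tree t of S₁ is not ⪯e S₂,
-- and t may be pruned until siblings are pairwise incomparable.  It remains to find A and B such
-- that Spoiler wins the game of t and Duplicator wins the game of S₂.
--
-- Both digraphs consist of units arranged along t.  A unit of sort c owns, for each child d of c,
-- a pool of units of sort d; it is full, or it deviates at some of the children, which alters their
-- pools.  On the side of the label of t all root units are present, on the other side the deviant
-- ones only.  Spoiler picks a full root unit; the answer deviates at some child d, and the altered
-- pool of d allows him to repeat this with d in place of t, until a leaf cannot deviate any more.
-- Duplicator's invariant is that a sort c whose pools differ does not embed into the forest S still
-- to be played: if the move in S has subforest D and a full unit of sort c is picked, then the
-- children of c do not all embed into D, and the answer deviates at one that does not.  Labels
-- attached to the units keep Duplicator from answering with a unit of another sort.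

module Submission where

open import Defs
open import Data.List using (List; []; _∷_; _++_; filter; allFin; length; lookup; deduplicate; cartesianProduct) renaming (map to lmap)
open import Data.List.Relation.Unary.All using (All; []; _∷_)
import Data.List.Relation.Unary.All as All
open import Data.List.Relation.Unary.AllPairs using (AllPairs; []; _∷_)
open import Data.List.Relation.Unary.All.Properties using (all-filter; filter⁺)
import Data.List.Relation.Unary.AllPairs.Properties as AP
open import Data.Product using (Σ; _×_; _,_; proj₁; proj₂)
open import Data.Sum using (_⊎_; inj₁; inj₂)
open import Data.Empty using (⊥; ⊥-elim)
open import Relation.Nullary using (¬_; Dec; yes; no; ¬?; does)
open import Relation.Binary.PropositionalEquality using (_≡_; refl; sym; trans; cong; cong₂; subst; _≢_)
open import Relation.Binary.Construct.Closure.Transitive using ([_]; _∷_) renaming (_++_ to _⁀_)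
open import Data.Nat using (ℕ; zero; suc; _⊔_; _+_; _≤_; _<_; z≤n; s≤s; _⊓_)
open import Data.Fin using (Fin; zero; suc; toℕ; fromℕ<)
import Data.Fin.Properties as Fin
open import Data.Bool using (Bool; true; false; not; if_then_else_) renaming (_∧_ to _&_; _∨_ to _∥_)
open import Data.Unit using (⊤; tt)
open import Data.List.Membership.Propositional using (_∈_; find; lose)
open import Data.List.Membership.Propositional.Properties using (∈-allFin; ∈-map⁺; ∈-map⁻; ∈-++⁺ˡ; ∈-++⁺ʳ; ∈-++⁻; ∈-filter⁺; ∈-filter⁻; ∈-deduplicate⁺; ∈-deduplicate⁻; ∈-cartesianProduct⁺; ∈-lookup)
open import Data.List.Relation.Unary.Any using (here; there; index; any?)
import Data.Bool.Properties as Bool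
open import Data.Bool.ListAction using (any; all)
open import Data.List.Relation.Unary.Any.Properties using (lookup-index)
open import Data.List.Relation.Unary.Unique.Propositional using (Unique)
import Data.List.Relation.Unary.Unique.DecPropositional.Properties as DUniq
import Data.Product.Properties as Prod
open import Function using (case_of_)
open import Relation.Binary.Definitions using (DecidableEquality)
import Data.Nat.Properties as Nat
open import Data.List.Properties using (length-map)
open import Relation.Nullary.Decidable using (dec-true; dec-false)
open import Function.Bundles using (mk⇔)

-- The obstacle is that one move can reach deep: Spoiler may pick a unit inside a pool of a full
-- unit that has not been picked before. Duplicator can let the outer unit deviate, but nothing
-- guarantees a child at which the inner one could deviate as well. Therefore an altered pool of the
-- same label retains one full instance, copy zero, to which such a pick can be sent. Spoiler must
-- get round this instance without losing a move, so every unit designates one instance in each pool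
-- of its own label, visible through edges: if the answer designates a deviant, he picks his
-- designated full instance, otherwise an undesignated one. For a child of the other label the
-- problem does not arise, as a full unit has only deviants there.
--
-- An answer of the wrong sort has to be refuted within the forest left below the picked unit. For
-- this purpose the labels spell out trees level by level, so that checking a tree takes no more
-- moves than that forest is high.

lab : Tree → Γ
lab (node l _) = l

kids : Tree → Forest
kids (node _ ts) = ts

_≟Γ_ : (l m : Γ) → Dec (l ≡ m)
∃ₗ ≟Γ ∃ₗ = yes refl
∃ₗ ≟Γ ∀ₗ = no λ ()
∀ₗ ≟Γ ∃ₗ = no λ ()
∀ₗ ≟Γ ∀ₗ = yes refl

-- Embeddings of forests

data _∋_ : Forest → Tree → Set where
  z : ∀ {d ds} → (d ∷ ds) ∋ d
  s : ∀ {d e ds} → ds ∋ d → (e ∷ ds) ∋ d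

-- `Sub S l D`: some node of `S` is labelled `l` and has the forest `D` below it. Read as a move of
-- the game, `D` is what remains to be played.
data Sub : Forest → Γ → Forest → Set where
  top : ∀ {l D F} → Sub (node l D ∷ F) l D
  inn : ∀ {l l₀ D D′ F} → Sub D l D′ → Sub (node l₀ D ∷ F) l D′
  nxt : ∀ {l D t F} → Sub F l D → Sub (t ∷ F) l D

-- An inductive, hence decidable, form of `_⪯e_`: once the image of a root is chosen, the paths of
-- positive length out of it lead exactly to the nodes of `D`.
data Emb : Forest → Forest → Set where
  []  : ∀ {S} → Emb [] S
  emb : ∀ {l ts F S D} → Sub S l D → Emb ts D → Emb F S → Emb (node l ts ∷ F) S

Sub-trans : ∀ {S l D m D′} → Sub S l D → Sub D m D′ → Sub S m D′
Sub-trans top     q = inn q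
Sub-trans (inn p) q = inn (Sub-trans p q)
Sub-trans (nxt p) q = nxt (Sub-trans p q)

Emb-map : ∀ {F S R} → (∀ {l D} → Sub S l D → Sub R l D) → Emb F S → Emb F R
Emb-map f []          = []
Emb-map f (emb p e q) = emb (f p) e (Emb-map f q)

Emb-below : ∀ {F S l D} → Sub S l D → Emb F D → Emb F S
Emb-below p = Emb-map (Sub-trans p)

Emb-weaken : ∀ {F S t} → Emb F S → Emb F (t ∷ S)
Emb-weaken = Emb-map nxt

Emb-++ : ∀ {F F′ S} → Emb F S → Emb F′ S → Emb (F ++ F′) S
Emb-++ []          q = q
Emb-++ (emb p e r) q = emb p e (Emb-++ r q)

Emb-refl : ∀ F → Emb F F
Emb-refl []              = []
Emb-refl (node l ts ∷ F) = emb top (Emb-refl ts) (Emb-weaken (Emb-refl F))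

Emb-Sub : ∀ {S R l D} → Emb S R → Sub S l D → Σ Forest λ D′ → Sub R l D′ × Emb D D′
Emb-Sub (emb p e _) top     = _ , p , e
Emb-Sub (emb p e _) (inn q) with Emb-Sub e q
... | D′ , r , f = D′ , Sub-trans p r , f
Emb-Sub (emb _ _ e) (nxt q) = Emb-Sub e q

Emb-trans : ∀ {F S R} → Emb F S → Emb S R → Emb F R
Emb-trans []          f = []
Emb-trans (emb p e q) f with Emb-Sub f p
... | D′ , p′ , g = emb p′ (Emb-trans e g) (Emb-trans q f)

anySub? : ∀ {P : Forest → Set} → (∀ D → Dec (P D)) → ∀ l S →
          Dec (Σ Forest λ D → Sub S l D × P D)
anySub? P? l [] = no λ { (_ , () , _) }
anySub? P? l (node m D ∷ F) with anySub? P? l F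
... | yes (D′ , p , q) = yes (D′ , nxt p , q)
... | no ¬F with anySub? P? l D
...   | yes (D′ , p , q) = yes (D′ , inn p , q)
...   | no ¬D with l ≟Γ m
...     | no l≢m = no λ { (_ , top , _) → l≢m refl
                        ; (_ , inn p , q) → ¬D (_ , p , q)
                        ; (_ , nxt p , q) → ¬F (_ , p , q) }
...     | yes refl with P? D
...       | yes q = yes (D , top , q)
...       | no ¬P = no λ { (_ , top , q) → ¬P q
                         ; (_ , inn p , q) → ¬D (_ , p , q)
                         ; (_ , nxt p , q) → ¬F (_ , p , q) }

Emb? : ∀ F S → Dec (Emb F S)
Emb? [] S = yes []
Emb? (node l ts ∷ F) S with anySub? (Emb? ts) l S
... | no ¬p = no λ { (emb p e _) → ¬p (_ , p , e) }
... | yes (D , p , e) with Emb? F S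
...   | yes q = yes (emb p e q)
...   | no ¬q = no λ { (emb _ _ q) → ¬q q }

Emb-∋ : ∀ {F S d} → Emb F S → F ∋ d → Emb (d ∷ []) S
Emb-∋ (emb p e _) z     = emb p e []
Emb-∋ (emb _ _ q) (s x) = Emb-∋ q x

∋-Emb : ∀ {F d} → F ∋ d → Emb (d ∷ []) F
∋-Emb {F} = Emb-∋ (Emb-refl F)

∀Emb : ∀ {F S} → (∀ {d} → F ∋ d → Emb (d ∷ []) S) → Emb F S
∀Emb {[]} f = []
∀Emb {node l ts ∷ F} f with f z
... | emb p e [] = emb p e (∀Emb (λ x → f (s x)))

-- Embeddings need not be injective, so the trees of a forest embed independently of each other, and
-- a failure is due to a single tree.
¬Emb-witness : ∀ F {S} → ¬ Emb F S → Σ Tree λ d → F ∋ d × ¬ Emb (d ∷ []) S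
¬Emb-witness [] ¬e = ⊥-elim (¬e [])
¬Emb-witness (d ∷ F) {S} ¬e with Emb? (d ∷ []) S
... | no ¬d = d , z , ¬d
... | yes (emb p e []) with ¬Emb-witness F (λ q → ¬e (emb p e q))
...   | d′ , x , ¬d′ = d′ , s x , ¬d′

¬Emb-kids : ∀ {c S D} → ¬ Emb (c ∷ []) S → Sub S (lab c) D → ¬ Emb (kids c) D
¬Emb-kids {node l ts} ¬e p e = ¬e (emb p e [])

¬Emb-below : ∀ {F S l D} → ¬ Emb F S → Sub S l D → ¬ Emb F D
¬Emb-below ¬e p e = ¬e (Emb-below p e)

-- Pruning a tree to pairwise incomparable siblings

data Reduced : Tree → Set where
  reduced : ∀ {l ts} → AllPairs (λ x y → ¬ Emb (x ∷ []) (y ∷ []) × ¬ Emb (y ∷ []) (x ∷ [])) ts →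
            All Reduced ts → Reduced (node l ts)

-- Positions are compared rather than trees, since this is what `AllPairs` speaks of; it spares a
-- decision of equality of trees.
data _≢∋_ : ∀ {F d e} → F ∋ d → F ∋ e → Set where
  zs : ∀ {d e F} {x : F ∋ e} → z {d} ≢∋ s x
  sz : ∀ {d e F} {x : F ∋ e} → s {e = d} x ≢∋ z
  ss : ∀ {d e a F} {x : F ∋ d} {y : F ∋ e} → x ≢∋ y → s {e = a} x ≢∋ s y

All-∋ : ∀ {P : Tree → Set} {F d} → All P F → F ∋ d → P d
All-∋ (p ∷ _)  z     = p
All-∋ (_ ∷ ps) (s x) = All-∋ ps x

AllPairs-∋ : ∀ {P : Tree → Tree → Set} {F d e} → (∀ {x y} → P x y → P y x) →
             AllPairs P F → {x : F ∋ d} {y : F ∋ e} → x ≢∋ y → P d e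
AllPairs-∋ sy (p ∷ _)  (zs {x = x}) = All-∋ p x
AllPairs-∋ sy (p ∷ _)  (sz {x = x}) = sy (All-∋ p x)
AllPairs-∋ sy (_ ∷ ps) (ss n)       = AllPairs-∋ sy ps n

Reduced-kids : ∀ {c d} → Reduced c → kids c ∋ d → Reduced d
Reduced-kids (reduced _ rs) x = All-∋ rs x

Reduced-siblings : ∀ {c d e} → Reduced c → {x : kids c ∋ d} {y : kids c ∋ e} → x ≢∋ y →
                   ¬ Emb (d ∷ []) (e ∷ []) × ¬ Emb (e ∷ []) (d ∷ [])
Reduced-siblings (reduced ap _) n = AllPairs-∋ (λ (a , b) → b , a) ap n

insert : Tree → Forest → Forest
insert x ys with Emb? (x ∷ []) ys
... | yes _ = ys
... | no  _ = x ∷ filter (λ y → ¬? (Emb? (y ∷ []) (x ∷ []))) ys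

mutual
  prune : Tree → Tree
  prune (node l ts) = node l (pruneF ts)

  pruneF : Forest → Forest
  pruneF []       = []
  pruneF (t ∷ ts) = insert (prune t) (pruneF ts)

private
  keep? : ∀ x y → Dec (¬ Emb (y ∷ []) (x ∷ []))
  keep? x y = ¬? (Emb? (y ∷ []) (x ∷ []))

filter-Emb : ∀ x ys → Emb (filter (keep? x) ys) ys
filter-Emb x [] = []
filter-Emb x (node l ts ∷ ys) with Emb? (node l ts ∷ []) (x ∷ [])
... | yes _ = Emb-weaken (filter-Emb x ys)
... | no  _ = emb top (Emb-refl ts) (Emb-weaken (filter-Emb x ys))

Emb-filter : ∀ x ys → Emb ys (x ∷ filter (keep? x) ys)
Emb-filter x [] = []
Emb-filter x (node l ts ∷ ys) with Emb? (node l ts ∷ []) (x ∷ [])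
... | yes (emb p e []) = emb (up p) e (Emb-filter x ys)
  where up : ∀ {l D R} → Sub (x ∷ []) l D → Sub (x ∷ R) l D
        up top = top
        up (inn q) = inn q
... | no  _ = emb (nxt top) (Emb-refl ts) (Emb-map up (Emb-filter x ys))
  where up : ∀ {l m D ts R} → Sub (x ∷ R) l D → Sub (x ∷ node m ts ∷ R) l D
        up top     = top
        up (inn q) = inn q
        up (nxt q) = nxt (nxt q)

Emb-cons : ∀ {x ys S} → Emb (x ∷ []) S → Emb ys S → Emb (x ∷ ys) S
Emb-cons (emb p e []) q = emb p e q

insert⊒ : ∀ x ys → Emb (x ∷ ys) (insert x ys)
insert⊒ x ys with Emb? (x ∷ []) ys
... | yes e = Emb-cons e (Emb-refl ys)
... | no  _ = Emb-cons (Emb-∋ (Emb-refl _) z) (Emb-filter x ys)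

insert⊑ : ∀ x ys → Emb (insert x ys) (x ∷ ys)
insert⊑ x ys with Emb? (x ∷ []) ys
... | yes _ = Emb-weaken (Emb-refl ys)
... | no  _ = Emb-cons (Emb-∋ (Emb-refl _) z) (Emb-weaken (filter-Emb x ys))

Emb-cong : ∀ {x y xs ys} → Emb (x ∷ []) (y ∷ []) → Emb xs ys → Emb (x ∷ xs) (y ∷ ys)
Emb-cong {y = y} e f = Emb-cons (Emb-trans e (Emb-∋ (Emb-refl _) z)) (Emb-weaken f)

mutual
  prune⊒ : ∀ t → Emb (t ∷ []) (prune t ∷ [])
  prune⊒ (node l ts) = emb top (pruneF⊒ ts) []

  pruneF⊒ : ∀ F → Emb F (pruneF F)
  pruneF⊒ []       = []
  pruneF⊒ (t ∷ ts) = Emb-trans (Emb-cong (prune⊒ t) (pruneF⊒ ts)) (insert⊒ (prune t) (pruneF ts))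

mutual
  prune⊑ : ∀ t → Emb (prune t ∷ []) (t ∷ [])
  prune⊑ (node l ts) = emb top (pruneF⊑ ts) []

  pruneF⊑ : ∀ F → Emb (pruneF F) F
  pruneF⊑ []       = []
  pruneF⊑ (t ∷ ts) = Emb-trans (insert⊑ (prune t) (pruneF ts)) (Emb-cong (prune⊑ t) (pruneF⊑ ts))

mutual
  prune-Reduced : ∀ t → Reduced (prune t)
  prune-Reduced (node l ts) = let a , r = pruneF-Reduced ts in reduced a r

  pruneF-Reduced : ∀ F → AllPairs (λ x y → ¬ Emb (x ∷ []) (y ∷ []) × ¬ Emb (y ∷ []) (x ∷ [])) (pruneF F) ×
                         All Reduced (pruneF F)
  pruneF-Reduced [] = [] , []
  pruneF-Reduced (t ∷ ts) with pruneF-Reduced ts | Emb? (prune t ∷ []) (pruneF ts)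
  ... | a , r | yes _ = a , r
  ... | a , r | no ¬e = All.zipWith (λ p → p) (filter⁺ (keep? (prune t)) (notIn ¬e) , all-filter (keep? (prune t)) (pruneF ts))
                        ∷ AP.filter⁺ (keep? (prune t)) a
                      , prune-Reduced t ∷ filter⁺ (keep? (prune t)) r
    where
    notIn : ∀ {x ys} → ¬ Emb (x ∷ []) ys → All (λ y → ¬ Emb (x ∷ []) (y ∷ [])) ys
    notIn {ys = []}     ¬e = []
    notIn {ys = y ∷ ys} ¬e = (λ e → ¬e (Emb-trans e (Emb-∋ (Emb-refl _) z))) ∷ notIn (λ e → ¬e (Emb-weaken e))

-- `Emb` agrees with `_⪯e_`

Path-map : ∀ {F S} (f : FNode F → FNode S) → (∀ {x y} → FArc x y → Path⁺ (f x) (f y)) →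
           ∀ {x y} → Path⁺ x y → Path⁺ (f x) (f y)
Path-map f g [ a ]   = g a
Path-map f g (a ∷ p) = g a ⁀ Path-map f g p

-- A path from the root into a later child is one in the tree without the first child; the root has
-- a different type there, so paths must be carried over.
sibling : ∀ {l t ts} → TNode (node l ts) → TNode (node l (t ∷ ts))
sibling here      = here
sibling (below n) = below (tl n)

sibling-arc : ∀ {l t ts} {x y : TNode (node l ts)} → TArc x y → TArc (sibling {t = t} x) (sibling y)
sibling-arc (top r)  = top (root-tl r)
sibling-arc (deep a) = deep (arc-tl a)

sibling-path : ∀ {l t ts F} {x y : TNode (node l ts)} → Path⁺ {node l ts ∷ []} (hd x) (hd y) →
               Path⁺ {node l (t ∷ ts) ∷ F} (hd (sibling x)) (hd (sibling y))
sibling-path [ arc-hd a ]   = [ arc-hd (sibling-arc a) ]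
sibling-path (arc-hd a ∷ p) = arc-hd (sibling-arc a) ∷ sibling-path p

root-below : ∀ {l ts F} (n : FNode ts) → Path⁺ {node l ts ∷ F} (hd here) (hd (below n))
root-below (hd here)      = [ arc-hd (top root-hd) ]
root-below (hd (below n)) =
  arc-hd (top root-hd) ∷ Path-map (λ x → hd (below x)) (λ a → [ arc-hd (deep a) ]) (root-below n)
root-below (tl n)         = sibling-path (root-below n)

subNode : ∀ {S l D} → Sub S l D → FNode S
subNode top     = hd here
subNode (inn p) = hd (below (subNode p))
subNode (nxt p) = tl (subNode p)

subIn : ∀ {S l D} → Sub S l D → FNode D → FNode S
subIn top     n = hd (below n)
subIn (inn p) n = hd (below (subIn p n))
subIn (nxt p) n = tl (subIn p n)

subNode-label : ∀ {S l D} (p : Sub S l D) → flabel (subNode p) ≡ l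
subNode-label top     = refl
subNode-label (inn p) = subNode-label p
subNode-label (nxt p) = subNode-label p

subIn-label : ∀ {S l D} (p : Sub S l D) n → flabel (subIn p n) ≡ flabel n
subIn-label top     n = refl
subIn-label (inn p) n = subIn-label p n
subIn-label (nxt p) n = subIn-label p n

subIn-arc : ∀ {S l D} (p : Sub S l D) {x y} → FArc x y → FArc (subIn p x) (subIn p y)
subIn-arc top     a = arc-hd (deep a)
subIn-arc (inn p) a = arc-hd (deep (subIn-arc p a))
subIn-arc (nxt p) a = arc-tl (subIn-arc p a)

subIn-below : ∀ {S l D} (p : Sub S l D) n → Path⁺ (subNode p) (subIn p n)
subIn-below top     n = root-below n
subIn-below (inn p) n = Path-map (λ x → hd (below x)) (λ a → [ arc-hd (deep a) ]) (subIn-below p n)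
subIn-below (nxt p) n = Path-map tl (λ a → [ arc-tl a ]) (subIn-below p n)

Emb-node : ∀ {F S} → Emb F S → FNode F → FNode S
Emb-node (emb p e q) (hd here)      = subNode p
Emb-node (emb p e q) (hd (below n)) = subIn p (Emb-node e n)
Emb-node (emb p e q) (tl n)         = Emb-node q n

Emb-label : ∀ {F S} (e : Emb F S) v → flabel (Emb-node e v) ≡ flabel v
Emb-label (emb p e q) (hd here)      = subNode-label p
Emb-label (emb p e q) (hd (below n)) = trans (subIn-label p _) (Emb-label e n)
Emb-label (emb p e q) (tl n)         = Emb-label q n

Emb-arc : ∀ {F S} (e : Emb F S) x y → FArc x y → Path⁺ (Emb-node e x) (Emb-node e y)
Emb-arc (emb p e q) _ _ (arc-hd (top {q = n} r)) = subIn-below p (Emb-node e n)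
Emb-arc (emb p e q) _ _ (arc-hd (deep a)) =
  Path-map (subIn p) (λ b → [ subIn-arc p b ]) (Emb-arc e _ _ a)
Emb-arc (emb p e q) _ _ (arc-tl a) = Emb-arc q _ _ a

Emb⇒⪯e : ∀ {F S} → Emb F S → F ⪯e S
Emb⇒⪯e e = Emb-node e , Emb-label e , Emb-arc e

mutual
  below-of : ∀ {S} → FNode S → Forest
  below-of (hd n) = below-ofT n
  below-of (tl n) = below-of n

  below-ofT : ∀ {t} → TNode t → Forest
  below-ofT (here {ts = ts}) = ts
  below-ofT (below n)        = below-of n

node-Sub : ∀ {S} (v : FNode S) → Sub S (flabel v) (below-of v)
node-Sub (hd here)      = top
node-Sub (hd (below n)) = inn (node-Sub n)
node-Sub (tl n)         = nxt (node-Sub n)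

subNode-node : ∀ {S} (v : FNode S) → subNode (node-Sub v) ≡ v
subNode-node (hd here)      = refl
subNode-node (hd (below n)) = cong (λ x → hd (below x)) (subNode-node n)
subNode-node (tl n)         = cong tl (subNode-node n)

subIn-injective : ∀ {S l D} (p : Sub S l D) {x y} → subIn p x ≡ subIn p y → x ≡ y
subIn-injective top     refl = refl
subIn-injective (inn p) e≡   = subIn-injective p (unb e≡)
  where unb : ∀ {l ts F} {x y : FNode ts} → hd {node l ts} {F} (below x) ≡ hd (below y) → x ≡ y
        unb refl = refl
subIn-injective (nxt p) e≡   = subIn-injective p (unt e≡)
  where unt : ∀ {t F} {x y : FNode F} → tl {t} x ≡ tl y → x ≡ y
        unt refl = refl

subNode-arc⁻¹ : ∀ {S l D} (p : Sub S l D) {w} → FArc (subNode p) w → Σ (FNode D) λ b → w ≡ subIn p b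
subNode-arc⁻¹ top (arc-hd (top r)) = _ , refl
subNode-arc⁻¹ (inn p) (arc-hd (deep a)) with subNode-arc⁻¹ p a
... | b , refl = b , refl
subNode-arc⁻¹ (nxt p) (arc-tl a) with subNode-arc⁻¹ p a
... | b , refl = b , refl

subIn-arc⁻¹ : ∀ {S l D} (p : Sub S l D) {a w} → FArc (subIn p a) w → Σ (FNode D) λ b → w ≡ subIn p b × FArc a b
subIn-arc⁻¹ top (arc-hd (deep a)) = _ , refl , a
subIn-arc⁻¹ (inn p) (arc-hd (deep a)) with subIn-arc⁻¹ p a
... | b , refl , c = b , refl , c
subIn-arc⁻¹ (nxt p) (arc-tl a) with subIn-arc⁻¹ p a
... | b , refl , c = b , refl , c

subIn-path⁻¹ : ∀ {S l D} (p : Sub S l D) {a w} → Path⁺ (subIn p a) w → Σ (FNode D) λ b → w ≡ subIn p b × Path⁺ a b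
subIn-path⁻¹ p [ x ] with subIn-arc⁻¹ p x
... | b , refl , c = b , refl , [ c ]
subIn-path⁻¹ p (x ∷ q) with subIn-arc⁻¹ p x
... | b , refl , c with subIn-path⁻¹ p q
...   | b′ , e≡ , d = b′ , e≡ , c ∷ d

subNode-path⁻¹ : ∀ {S l D} (p : Sub S l D) {w} → Path⁺ (subNode p) w → Σ (FNode D) λ b → w ≡ subIn p b
subNode-path⁻¹ p [ x ] = subNode-arc⁻¹ p x
subNode-path⁻¹ p (x ∷ q) with subNode-arc⁻¹ p x
... | b , refl with subIn-path⁻¹ p q
...   | b′ , e≡ , _ = b′ , e≡

-- `ι` turns arcs into paths, so everything below a root goes strictly below its image `v`. Paths
-- starting there never leave the forest below `v`, hence `ι` restricts to a map of the children
-- into it.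
⪯e⇒Emb : ∀ F {S} → F ⪯e S → Emb F S
⪯e⇒Emb [] _ = []
⪯e⇒Emb (node l ts ∷ F) {S} (ι , lbl , arc) =
  emb (subst (λ m → Sub S m (below-of v)) (lbl (hd here)) p)
      (⪯e⇒Emb ts (ι′ , lbl′ , arc′))
      (⪯e⇒Emb F ((λ x → ι (tl x)) , (λ x → lbl (tl x)) , (λ x y a → arc _ _ (arc-tl a))))
  where
  v = ι (hd here)
  p = node-Sub v

  dec : ∀ n → Σ (FNode (below-of v)) λ b → ι (hd (below n)) ≡ subIn p b
  dec n = subNode-path⁻¹ p (subst (λ x → Path⁺ x (ι (hd (below n)))) (sym (subNode-node v))
            (Path-map ι (arc _ _) (root-below n)))

  ι′ : FNode ts → FNode (below-of v)
  ι′ n = proj₁ (dec n)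

  lbl′ : ∀ n → flabel (ι′ n) ≡ flabel n
  lbl′ n = trans (sym (subIn-label p (ι′ n))) (trans (cong flabel (sym (proj₂ (dec n)))) (lbl (hd (below n))))

  arc′ : ∀ x y → FArc x y → Path⁺ (ι′ x) (ι′ y)
  arc′ x y a with subIn-path⁻¹ p (subst (λ u → Path⁺ u (ι (hd (below y)))) (proj₂ (dec x)) (arc _ _ (arc-hd (deep a))))
  ... | b , e≡ , q = subst (Path⁺ (ι′ x)) (subIn-injective p (trans (sym e≡) (proj₂ (dec y)))) q

fl : Γ → Γ
fl ∃ₗ = ∀ₗ
fl ∀ₗ = ∃ₗ

fl-fl : ∀ σ → fl (fl σ) ≡ σ
fl-fl ∃ₗ = refl
fl-fl ∀ₗ = refl

≢⇒fl : ∀ {l m} → l ≢ m → l ≡ fl m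
≢⇒fl {∃ₗ} {∃ₗ} p = ⊥-elim (p refl)
≢⇒fl {∃ₗ} {∀ₗ} p = refl
≢⇒fl {∀ₗ} {∃ₗ} p = refl
≢⇒fl {∀ₗ} {∀ₗ} p = ⊥-elim (p refl)

true≢false : ¬ (true ≡ false)
true≢false ()

-- The game and its characteristic sentences

bigAnd bigOr : ∀ {n} {X : Set} → List X → (X → Formula n) → Formula n
bigAnd []       f = tt
bigAnd (x ∷ xs) f = f x ∧ bigAnd xs f
bigOr []       f = ff
bigOr (x ∷ xs) f = f x ∨ bigOr xs f

bigAnd-elim : ∀ {n X G} {ρ : Fin n → Dom G} (xs : List X) f {x} → x ∈ xs → Sat G ρ (bigAnd xs f) → Sat G ρ (f x)
bigAnd-elim (x ∷ xs) f (here refl) (p , _) = p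
bigAnd-elim (x ∷ xs) f (there m)   (_ , p) = bigAnd-elim xs f m p

bigAnd-intro : ∀ {n X G} {ρ : Fin n → Dom G} (xs : List X) f → (∀ x → Sat G ρ (f x)) → Sat G ρ (bigAnd xs f)
bigAnd-intro []       f p = tt
bigAnd-intro (x ∷ xs) f p = p x , bigAnd-intro xs f p

bigOr-elim : ∀ {n X G} {ρ : Fin n → Dom G} (xs : List X) f → Sat G ρ (bigOr xs f) → Σ X λ x → Sat G ρ (f x)
bigOr-elim (x ∷ xs) f (inj₁ p) = x , p
bigOr-elim (x ∷ xs) f (inj₂ p) = bigOr-elim xs f p

bigOr-intro : ∀ {n X G} {ρ : Fin n → Dom G} (xs : List X) f {x} → x ∈ xs → Sat G ρ (f x) → Sat G ρ (bigOr xs f)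
bigOr-intro (x ∷ xs) f (here refl) p = inj₁ p
bigOr-intro (x ∷ xs) f (there m)   p = inj₂ (bigOr-intro xs f m p)

bigAnd-qs : ∀ {n X S} (xs : List X) (f : X → Formula n) → (∀ x → Emb (qs (f x)) S) → Emb (qs (bigAnd xs f)) S
bigAnd-qs []       f p = []
bigAnd-qs (x ∷ xs) f p = Emb-++ (p x) (bigAnd-qs xs f p)

bigOr-qs : ∀ {n X S} (xs : List X) (f : X → Formula n) → (∀ x → Emb (qs (f x)) S) → Emb (qs (bigOr xs f)) S
bigOr-qs []       f p = []
bigOr-qs (x ∷ xs) f p = Emb-++ (p x) (bigOr-qs xs f p)

module _ (A : Digraph) where

  edgeLit eqLit : ∀ {n} → (Fin n → Dom A) → Fin n → Fin n → Formula n
  edgeLit ρ i j with E A (ρ i) (ρ j)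
  ... | true  = E≈ i j
  ... | false = ¬E≈ i j
  eqLit ρ i j with ρ i Fin.≟ ρ j
  ... | yes _ = eq i j
  ... | no  _ = ¬eq i j

  atoms : ∀ {n} → (Fin n → Dom A) → Formula n
  atoms ρ = bigAnd (allFin _) λ i → bigAnd (allFin _) λ j → edgeLit ρ i j ∧ eqLit ρ i j

  -- The characteristic formula of (A, ρ) among the formulas of quantifier structure C.
  χ : ∀ {n} → Forest → (Fin n → Dom A) → Formula n
  χ [] ρ = atoms ρ
  χ (node ∃ₗ D ∷ F) ρ = bigAnd (allFin _) (λ a → ∃′ (χ D (extend ρ a))) ∧ χ F ρ
  χ (node ∀ₗ D ∷ F) ρ = ∀′ (bigOr (allFin _) (λ a → χ D (extend ρ a))) ∧ χ F ρ

  edgeLit-qs : ∀ {n} (ρ : Fin n → Dom A) i j → qs (edgeLit ρ i j) ≡ []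
  edgeLit-qs ρ i j with E A (ρ i) (ρ j)
  ... | true  = refl
  ... | false = refl

  eqLit-qs : ∀ {n} (ρ : Fin n → Dom A) i j → qs (eqLit ρ i j) ≡ []
  eqLit-qs ρ i j with ρ i Fin.≟ ρ j
  ... | yes _ = refl
  ... | no  _ = refl

  -- The characteristic formula repeats a quantifier, or the formula under it, once for every
  -- element of `A`. All copies go to the same node, which is allowed as embeddings may identify
  -- nodes.
  χ-qs : ∀ {n} C (ρ : Fin n → Dom A) → Emb (qs (χ C ρ)) C
  χ-qs [] ρ = bigAnd-qs (allFin _) _ λ i → bigAnd-qs (allFin _) _ λ j →
    subst (λ F → Emb F []) (sym (cong₂ _++_ (edgeLit-qs ρ i j) (eqLit-qs ρ i j))) []
  χ-qs (node ∃ₗ D ∷ F) ρ =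
    Emb-++ (bigAnd-qs (allFin _) (λ a → ∃′ (χ D (extend ρ a))) λ a → emb top (χ-qs D (extend ρ a)) []) (Emb-weaken (χ-qs F ρ))
  χ-qs (node ∀ₗ D ∷ F) ρ =
    emb top (bigOr-qs (allFin _) (λ a → χ D (extend ρ a)) λ a → χ-qs D (extend ρ a)) (Emb-weaken (χ-qs F ρ))

  χ-holds : ∀ {n} C (ρ : Fin n → Dom A) → Sat A ρ (χ C ρ)
  χ-holds [] ρ = bigAnd-intro (allFin _) _ λ i → bigAnd-intro (allFin _) _ λ j → edge i j , equal i j
    where
    edge : ∀ i j → Sat A ρ (edgeLit ρ i j)
    edge i j with E A (ρ i) (ρ j) in q
    ... | true  = q
    ... | false = λ p → true≢false (trans (sym p) q)
    equal : ∀ i j → Sat A ρ (eqLit ρ i j)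
    equal i j with ρ i Fin.≟ ρ j
    ... | yes p = p
    ... | no ¬p = ¬p
  χ-holds (node ∃ₗ D ∷ F) ρ = bigAnd-intro (allFin _) _ (λ a → a , χ-holds D (extend ρ a)) , χ-holds F ρ
  χ-holds (node ∀ₗ D ∷ F) ρ =
    (λ a → bigOr-intro (allFin _) _ (∈-allFin a) (χ-holds D (extend ρ a))) , χ-holds F ρ

-- A move labelled l is made by Spoiler in the structure G l, and answered in G (fl l).
module Game {W : Set} (e : W → W → Bool) (G : Γ → Digraph) (view : ∀ σ → Dom (G σ) → W)
            (view-E : ∀ σ i j → E (G σ) i j ≡ e (view σ i) (view σ j))
            (view-injective : ∀ σ {i j} → view σ i ≡ view σ j → i ≡ j) where

  -- Positions record elements of the common type `W`, not of the two domains, so that the sides can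
  -- be exchanged and elements compared across them.
  Env : ℕ → Set
  Env n = Γ → Fin n → W

  ext : ∀ {n} → Γ → Env n → W → W → Env (suc n)
  ext ∃ₗ ρ a b ∃ₗ = extend (ρ ∃ₗ) a
  ext ∃ₗ ρ a b ∀ₗ = extend (ρ ∀ₗ) b
  ext ∀ₗ ρ a b ∀ₗ = extend (ρ ∀ₗ) a
  ext ∀ₗ ρ a b ∃ₗ = extend (ρ ∃ₗ) b

  Atoms : ∀ {n} → Env n → Set
  Atoms ρ = (∀ σ i j → e (ρ σ i) (ρ σ j) ≡ e (ρ (fl σ) i) (ρ (fl σ) j)) ×
            (∀ σ i j → ρ σ i ≡ ρ σ j → ρ (fl σ) i ≡ ρ (fl σ) j)

  Dup : ∀ {n} → Forest → Env n → Set
  Dup []             ρ = Atoms ρ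
  Dup (node l D ∷ F) ρ =
    (∀ (a : Dom (G l)) → Σ (Dom (G (fl l))) λ b → Dup D (ext l ρ (view l a) (view (fl l) b))) × Dup F ρ

  Dup-atoms : ∀ {n} C {ρ : Env n} → Dup C ρ → Atoms ρ
  Dup-atoms []      p       = p
  Dup-atoms (node _ _ ∷ F) (_ , p) = Dup-atoms F p

  Dup-∋ : ∀ {n C d} {ρ : Env n} → Dup C ρ → C ∋ d → (a : Dom (G (lab d))) →
          Σ (Dom (G (fl (lab d)))) λ b → Dup (kids d) (ext (lab d) ρ (view _ a) (view _ b))
  Dup-∋ {C = node _ _ ∷ _} (p , _) z     = p
  Dup-∋ {C = node _ _ ∷ _} (_ , p) (s x) = Dup-∋ p x

  private
    A B : Digraph
    A = G ∃ₗ
    B = G ∀ₗ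

  χ⇒Dup : ∀ {n} C (ρ : Fin n → Dom A) (ρ′ : Fin n → Dom B) (η : Env n) →
          (∀ i → view ∃ₗ (ρ i) ≡ η ∃ₗ i) → (∀ i → view ∀ₗ (ρ′ i) ≡ η ∀ₗ i) →
          Sat B ρ′ (χ A C ρ) → Dup C η
  χ⇒Dup [] ρ ρ′ η h h′ sat = edges , equals
    where
    lits : ∀ i j → Sat B ρ′ (edgeLit A ρ i j ∧ eqLit A ρ i j)
    lits i j = bigAnd-elim (allFin _) _ (∈-allFin j) (bigAnd-elim (allFin _) _ (∈-allFin i) sat)

    edge : ∀ i j → E A (ρ i) (ρ j) ≡ E B (ρ′ i) (ρ′ j)
    edge i j with E A (ρ i) (ρ j) | proj₁ (lits i j)
    ... | true  | p = sym p
    ... | false | p with E B (ρ′ i) (ρ′ j)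
    ...   | true  = ⊥-elim (p refl)
    ...   | false = refl

    edge′ : ∀ i j → e (η ∃ₗ i) (η ∃ₗ j) ≡ e (η ∀ₗ i) (η ∀ₗ j)
    edge′ i j = trans (sym (trans (view-E ∃ₗ _ _) (cong₂ e (h i) (h j))))
               (trans (edge i j) (trans (view-E ∀ₗ _ _) (cong₂ e (h′ i) (h′ j))))

    edges : ∀ σ i j → e (η σ i) (η σ j) ≡ e (η (fl σ) i) (η (fl σ) j)
    edges ∃ₗ i j = edge′ i j
    edges ∀ₗ i j = sym (edge′ i j)

    equal : ∀ i j → (ρ i ≡ ρ j → ρ′ i ≡ ρ′ j) × (ρ′ i ≡ ρ′ j → ρ i ≡ ρ j)
    equal i j with ρ i Fin.≟ ρ j | proj₂ (lits i j)
    ... | yes p | q = (λ _ → q) , (λ _ → p)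
    ... | no ¬p | q = (λ p → ⊥-elim (¬p p)) , (λ p → ⊥-elim (q p))

    equals : ∀ σ i j → η σ i ≡ η σ j → η (fl σ) i ≡ η (fl σ) j
    equals ∃ₗ i j p = trans (sym (h′ i)) (trans (cong (view ∀ₗ) (proj₁ (equal i j)
      (view-injective ∃ₗ (trans (h i) (trans p (sym (h j))))))) (h′ j))
    equals ∀ₗ i j p = trans (sym (h i)) (trans (cong (view ∃ₗ) (proj₂ (equal i j)
      (view-injective ∀ₗ (trans (h′ i) (trans p (sym (h′ j))))))) (h j))
  χ⇒Dup (node ∃ₗ D ∷ F) ρ ρ′ η h h′ (p , q) = answer , χ⇒Dup F ρ ρ′ η h h′ q
    where
    answer : ∀ a → Σ (Dom B) λ b → Dup D (ext ∃ₗ η (view ∃ₗ a) (view ∀ₗ b))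
    answer a with bigAnd-elim (allFin _) _ (∈-allFin a) p
    ... | b , sat = b , χ⇒Dup D (extend ρ a) (extend ρ′ b) _
                            (λ { zero → refl ; (suc i) → h i }) (λ { zero → refl ; (suc i) → h′ i }) sat
  χ⇒Dup (node ∀ₗ D ∷ F) ρ ρ′ η h h′ (p , q) = answer , χ⇒Dup F ρ ρ′ η h h′ q
    where
    answer : ∀ b → Σ (Dom A) λ a → Dup D (ext ∀ₗ η (view ∀ₗ b) (view ∃ₗ a))
    answer b with bigOr-elim (allFin _) _ (p b)
    ... | a , sat = a , χ⇒Dup D (extend ρ a) (extend ρ′ b) _
                            (λ { zero → refl ; (suc i) → h i }) (λ { zero → refl ; (suc i) → h′ i }) sat

-- The two digraphs

Enum : Set → Set
Enum A = Σ (List A) λ xs → ∀ a → a ∈ xs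

_enum×_ : ∀ {A B} → Enum A → Enum B → Enum (A × B)
(xs , p) enum× (ys , q) = cartesianProduct xs ys , λ (a , b) → ∈-cartesianProduct⁺ (p a) (q b)

enumMap : ∀ {A B : Set} (f : A → B) → (∀ b → Σ A λ a → b ≡ f a) → Enum A → Enum B
enumMap f g (xs , p) = lmap f xs , λ b → case g b of λ { (a , refl) → ∈-map⁺ f (p a) }

enumBool : Enum Bool
enumBool = false ∷ true ∷ [] , λ { false → here refl ; true → there (here refl) }

enumFin : ∀ n → Enum (Fin n)
enumFin n = allFin n , ∈-allFin

enumΓ : Enum Γ
enumΓ = ∃ₗ ∷ ∀ₗ ∷ [] , λ { ∃ₗ → here refl ; ∀ₗ → there (here refl) }

enumAll : ∀ {X : Set} {P : X → Set} → (∀ x → Enum (P x)) → ∀ xs → Enum (All P xs)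
enumAll f [] = [] ∷ [] , λ { [] → here refl }
enumAll f (x ∷ xs) = enumMap (λ (p , ps) → p ∷ ps) (λ { (p ∷ ps) → (p , ps) , refl }) (f x enum× enumAll f xs)

All-≟ : ∀ {X : Set} {P : X → Set} → (∀ {x} → DecidableEquality (P x)) → ∀ {xs} → DecidableEquality (All P xs)
All-≟ d [] [] = yes refl
All-≟ d (p ∷ ps) (q ∷ qs) with d p q | All-≟ d ps qs
... | yes refl | yes refl = yes refl
... | no ¬e    | _        = no λ { refl → ¬e refl }
... | yes _    | no ¬e    = no λ { refl → ¬e refl }

lookup-injective : ∀ {A : Set} {xs : List A} → Unique xs → ∀ i j → lookup xs i ≡ lookup xs j → i ≡ j
lookup-injective (_ ∷ u) zero    zero    p = refl
lookup-injective (x ∷ u) zero    (suc j) p = ⊥-elim (All.lookup x (∈-lookup j) p)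
lookup-injective (x ∷ u) (suc i) zero    p = ⊥-elim (All.lookup x (∈-lookup i) (sym p))
lookup-injective (_ ∷ u) (suc i) (suc j) p = cong suc (lookup-injective u i j p)

heightF : Forest → ℕ
heightF []             = 0
heightF (node _ D ∷ F) = suc (heightF D) ⊔ heightF F

mutual
  subtrees : Tree → List Tree
  subtrees (node l ts) = node l ts ∷ subtreesF ts

  subtreesF : Forest → List Tree
  subtreesF []       = []
  subtreesF (t ∷ ts) = subtrees t ++ subtreesF ts

same : Γ → Γ → Bool
same l m = does (l ≟Γ m)

same-refl : ∀ l → same l l ≡ true
same-refl ∃ₗ = refl
same-refl ∀ₗ = refl

same-≢ : ∀ {l m} → l ≢ m → same l m ≡ false
same-≢ {∃ₗ} {∃ₗ} p = ⊥-elim (p refl)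
same-≢ {∃ₗ} {∀ₗ} p = refl
same-≢ {∀ₗ} {∃ₗ} p = refl
same-≢ {∀ₗ} {∀ₗ} p = ⊥-elim (p refl)

if-same : ∀ {A : Set} {l m} {a b : A} → l ≡ m → (if same l m then a else b) ≡ a
if-same {l = ∃ₗ} refl = refl
if-same {l = ∀ₗ} refl = refl

if-other : ∀ {A : Set} {l m} {a b : A} → l ≢ m → (if same l m then a else b) ≡ b
if-other {l = l} {m} l≢m rewrite same-≢ l≢m = refl

-- Deviations, pools and units

Dv : Forest → Set
Dv = All (λ _ → Bool)

isFull : ∀ {ts} → Dv ts → Bool
isFull []      = true
isFull (b ∷ τ) = not b & isFull τ

full : ∀ ts → Dv ts
full []       = []
full (_ ∷ ts) = false ∷ full ts

data Kind : Set where
  all-units deviants deviants+1 : Kind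

-- Deviating a child of the same label leaves at most one full unit in its pool;
-- deviating a child of the other label lets full units into its pool.
kind : Γ → Γ → Bool → Kind
kind l m b = if same l m then (if b then deviants+1 else all-units) else (if b then all-units else deviants)

hasRoot : Γ → Forest → Bool
hasRoot b = any (λ d → same b (lab d))

-- Equality of trees up to depth n, the children of a node being read as a set.
eqT : ℕ → Tree → Tree → Bool
eqT zero    t u = same (lab t) (lab u)
eqT (suc n) t u = same (lab t) (lab u) &
  (all (λ d → any (eqT n d) (kids u)) (kids t) & all (λ d → any (eqT n d) (kids t)) (kids u))

mem : ℕ → Tree → Forest → Bool
mem n g C = any (eqT n g) C

is∀ : Γ → Bool
is∀ ∃ₗ = false
is∀ ∀ₗ = true

module Units (n : ℕ) where

  -- Copies of each deviation vector. Whenever Duplicator needs a fresh copy, at most `n + 1` are in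
  -- use; and Spoiler always has a second full copy besides a designated one.
  K : Set
  K = Fin (suc (suc n))

  Inst : Tree → Set
  Inst d = Dv (kids d) × K

  -- The full instance retained by `deviants+1` is fixed as copy zero, so Duplicator can answer with
  -- it and Spoiler can designate it by name.
  okI : ∀ {ts} → Kind → Dv ts → K → Bool
  okI all-units  τ i       = true
  okI deviants   τ i       = not (isFull τ)
  okI deviants+1 τ zero    = true
  okI deviants+1 τ (suc i) = not (isFull τ)

  -- mk τ i (self x) is the i-th unit that deviates as τ says and designates the instance x of
  -- each child; mk τ i (below u) is a unit in the pools of the instance (τ , i), which the
  -- units with different x share.
  mutual
    data Vtx : Tree → Set where
      mk : ∀ {l ts} → Dv ts → K → Loc ts → Vtx (node l ts)

    data Loc (ts : Forest) : Set where
      self  : All Inst ts → Loc ts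
      below : Ch ts → Loc ts

    data Ch : Forest → Set where
      hd : ∀ {d ds} → Vtx d → Ch (d ∷ ds)
      tl : ∀ {d ds} → Ch ds → Ch (d ∷ ds)

  _≟D_ : ∀ {ts} → DecidableEquality (Dv ts)
  _≟D_ = All-≟ Bool._≟_

  _≟I_ : ∀ {ts} → DecidableEquality (Dv ts × K)
  _≟I_ = Prod.≡-dec _≟D_ Fin._≟_

  _≟X_ : ∀ {ts} → DecidableEquality (All Inst ts)
  _≟X_ = All-≟ _≟I_

  mutual
    _≟V_ : ∀ {c} → DecidableEquality (Vtx c)
    mk τ i p ≟V mk τ′ i′ p′ with τ ≟D τ′ | i Fin.≟ i′ | p ≟L p′
    ... | yes refl | yes refl | yes refl = yes refl
    ... | no ¬e | _ | _ = no λ { refl → ¬e refl }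
    ... | yes _ | no ¬e | _ = no λ { refl → ¬e refl }
    ... | yes _ | yes _ | no ¬e = no λ { refl → ¬e refl }

    _≟L_ : ∀ {ts} → DecidableEquality (Loc ts)
    self x ≟L self y with x ≟X y
    ... | yes refl = yes refl
    ... | no ¬e = no λ { refl → ¬e refl }
    self x ≟L below u = no λ ()
    below u ≟L self x = no λ ()
    below u ≟L below w with u ≟C w
    ... | yes refl = yes refl
    ... | no ¬e = no λ { refl → ¬e refl }

    _≟C_ : ∀ {ts} → DecidableEquality (Ch ts)
    hd v ≟C hd w with v ≟V w
    ... | yes refl = yes refl
    ... | no ¬e = no λ { refl → ¬e refl }
    hd v ≟C tl u = no λ ()
    tl u ≟C hd v = no λ ()
    tl u ≟C tl w with u ≟C w
    ... | yes refl = yes refl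
    ... | no ¬e = no λ { refl → ¬e refl }

  enumInst : ∀ d → Enum (Inst d)
  enumInst d = enumAll (λ _ → enumBool) (kids d) enum× enumFin _

  mutual
    enumVtx : ∀ c → Enum (Vtx c)
    enumVtx (node l ts) = enumMap (λ (τ , i , p) → mk τ i p) (λ { (mk τ i p) → (τ , i , p) , refl })
      (enumAll (λ _ → enumBool) ts enum× (enumFin _ enum× enumLoc ts))

    enumLoc : ∀ ts → Enum (Loc ts)
    enumLoc ts with enumAll enumInst ts | enumCh ts
    ... | xs , p | us , q = lmap self xs ++ lmap below us ,
      λ { (self x) → ∈-++⁺ˡ (∈-map⁺ self (p x)) ; (below u) → ∈-++⁺ʳ (lmap self xs) (∈-map⁺ below (q u)) }

    enumCh : ∀ ts → Enum (Ch ts)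
    enumCh [] = [] , λ ()
    enumCh (d ∷ ds) with enumVtx d | enumCh ds
    ... | vs , p | us , q = lmap hd vs ++ lmap tl us ,
      λ { (hd v) → ∈-++⁺ˡ (∈-map⁺ hd (p v)) ; (tl u) → ∈-++⁺ʳ (lmap hd vs) (∈-map⁺ tl (q u)) }

  -- Designations matter where an altered pool retains a full instance, that is at children of the
  -- unit's own label; there the designated instance must lie in the pool.
  okD : ∀ {ts} → Γ → Dv ts → All Inst ts → Bool
  okD {[]}     l []      []            = true
  okD {d ∷ ds} l (b ∷ τ) ((σ , i) ∷ x) =
    (if same l (lab d) then okI (kind l (lab d) b) σ i else true) & okD l τ x

  mutual
    ok : ∀ {c} → Kind → Vtx c → Bool
    ok κ (mk {l} τ i p) = okI κ τ i & okL l τ p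

    okL : ∀ {ts} → Γ → Dv ts → Loc ts → Bool
    okL l τ (self x)  = okD l τ x
    okL l τ (below u) = okC l τ u

    okC : ∀ {ts} → Γ → Dv ts → Ch ts → Bool
    okC {d ∷ ds} l (b ∷ τ) (hd v) = ok (kind l (lab d) b) v
    okC {d ∷ ds} l (b ∷ τ) (tl u) = okC l τ u

  isSelf : ∀ {c} → Vtx c → Bool
  isSelf (mk _ _ (self _))  = true
  isSelf (mk _ _ (below _)) = false

  inst : ∀ {d} → Vtx d → Inst d
  inst (mk τ i _) = τ , i

  -- Edges from a unit to the units in its pools; `cp` gives those back. If the labels agree, the
  -- forward edge is always present and the backward one marks the designated instance; otherwise
  -- only the backward edge is present. So the two bits reveal the label of the child and the
  -- designation.
  pc : ∀ {ts} → Γ → Ch ts → Bool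
  pc {d ∷ ds} l (hd v) = isSelf v & same l (lab d)
  pc {d ∷ ds} l (tl u) = pc l u

  cp : ∀ {ts} → Γ → Ch ts → All Inst ts → Bool
  cp {d ∷ ds} l (hd v) (I ∷ _) = isSelf v & (if same l (lab d) then does (inst v ≟I I) else true)
  cp {d ∷ ds} l (tl u) (_ ∷ x) = cp l u x

  mutual
    eV : ∀ {c} → Vtx c → Vtx c → Bool
    eV (mk {l} τ i p) (mk τ′ i′ p′) = does ((τ , i) ≟I (τ′ , i′)) & eL l p p′

    -- Units of one instance that differ in their designations are twins, joined both ways. By these
    -- edges Spoiler recognises a twin given as an answer.
    eL : ∀ {ts} → Γ → Loc ts → Loc ts → Bool
    eL l (self x)  (self y)  = not (does (x ≟X y))
    eL l (self x)  (below u) = pc l u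
    eL l (below u) (self x)  = cp l u x
    eL l (below u) (below w) = eC u w

    eC : ∀ {ts} → Ch ts → Ch ts → Bool
    eC (hd v) (hd w) = eV v w
    eC (hd v) (tl u) = false
    eC (tl u) (hd v) = false
    eC (tl u) (tl w) = eC u w

  mutual
    sort : ∀ {c} → Vtx c → Tree
    sort (mk {l} {ts} _ _ (self _)) = node l ts
    sort (mk _ _ (below u))         = sortC u

    sortC : ∀ {ts} → Ch ts → Tree
    sortC (hd v) = sort v
    sortC (tl u) = sortC u

  -- Labels, edges and carriers

  module Structure (t : Tree) where

    h : ℕ
    h = heightF (kids t)

    Ix : Set
    Ix = Fin (length (subtrees t))

    tr : Ix → Tree
    tr = lookup (subtrees t)

    -- base r d (nt g₁ (… (nt gₖ here))) names a sequence d, g₁, …, gₖ of subtrees of t: units see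
    -- whether gₖ is, up to depth suc r ∸ k, a child of the preceding one (d: of the sort of the
    -- unit).  The directed triangles tm b mark whether the last tree has a child labelled b.
    data Lb : ℕ → Set where
      here : ∀ {a} → Lb a
      tm   : Γ → Fin 3 → Lb 0
      nt   : ∀ {a} → Ix → Lb a → Lb (suc a)

    data Lab : Set where
      base : (r : Fin h) → Ix → Lb (toℕ r) → Lab

    -- `junk` is an isolated vertex without loop that keeps the domains nonempty: for a leaf `t` the
    -- deviant side has neither units nor labels.
    data W : Set where
      junk : W
      unit : Vtx t → W
      lbl  : Lab → W

    next : Fin 3 → Fin 3
    next zero             = suc zero
    next (suc zero)       = suc (suc zero)
    next (suc (suc zero)) = zero

    -- A name is read from `here` outwards: a continuation is a one-way edge away from `here`, an
    -- end mark a one-way edge towards it, so an ending name is told from a longer one. Every label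
    -- has a loop. The marks `tm b` form a cycle so that each of them has a one-way predecessor as
    -- well, which `predecessor` exploits.
    bE : ∀ {a} → Lb a → Lb a → Bool
    bE here here                 = true
    bE here (nt g here)          = true
    bE here (nt g (tm b i))      = false
    bE here (nt g (nt g′ p))     = false
    bE here (tm b i)             = false
    bE (tm b i) here             = true
    bE (tm b i) (tm b′ i′)       = same b b′ & (does (i Fin.≟ i′) ∥ does (next i Fin.≟ i′))
    bE (nt g p) here             = false
    bE (nt g p) (nt g′ p′)       = does (g Fin.≟ g′) & bE p p′

    _≟Lb_ : ∀ {a} → DecidableEquality (Lb a)
    here ≟Lb here = yes refl
    here ≟Lb tm b i = no λ ()
    here ≟Lb nt g p = no λ ()
    tm b i ≟Lb here = no λ ()
    tm b i ≟Lb tm b′ i′ with b ≟Γ b′ | i Fin.≟ i′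
    ... | yes refl | yes refl = yes refl
    ... | no ¬e | _ = no λ { refl → ¬e refl }
    ... | yes _ | no ¬e = no λ { refl → ¬e refl }
    nt g p ≟Lb here = no λ ()
    nt g p ≟Lb nt g′ p′ with g Fin.≟ g′ | p ≟Lb p′
    ... | yes refl | yes refl = yes refl
    ... | no ¬e | _ = no λ { refl → ¬e refl }
    ... | yes _ | no ¬e = no λ { refl → ¬e refl }

    lE : Lab → Lab → Bool
    lE (base r d p) (base r′ d′ p′) with r Fin.≟ r′
    ... | yes refl = does (d Fin.≟ d′) & bE p p′
    ... | no _     = false

    isHere : ∀ {a} → Lb a → Bool
    isHere here = true
    isHere _    = false

    -- The two bits by which a unit that is not a root sees a label: membership and quantifier.
    sgn : ∀ {a} → Forest → Ix → Lb a → Bool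
    sgn {a} C d here          = mem (suc a) (tr d) C
    sgn C d (tm b i)          = hasRoot b (kids (tr d))
    sgn C d (nt g p)          = sgn (kids (tr d)) g p

    bl : ∀ {a} → Ix → Lb a → Γ
    bl d here     = lab (tr d)
    bl d (tm b i) = b
    bl d (nt g p) = bl g p

    -- Root units form a clique with loops, while `eV` is irreflexive: loops set root units and
    -- labels apart from all other vertices.
    eU : Vtx t → Vtx t → Bool
    eU v w = if isSelf v then (if isSelf w then true else eV v w) else eV v w

    -- Root units receive no edge from labels and send edges exactly to the beginnings of names.
    -- Hence a root unit on the board locates these beginnings.
    e : W → W → Bool
    e junk     _        = false
    e (unit v) junk     = false
    e (unit v) (unit w) = eU v w
    e (unit v) (lbl (base r d p)) = if isSelf v then isHere p else sgn (kids (sort v)) d p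
    e (lbl _)  junk     = false
    e (lbl (base r d p)) (unit v) = if isSelf v then false else is∀ (bl d p)
    e (lbl x)  (lbl y)  = lE x y

    rootKind : Γ → Kind
    rootKind σ = if same σ (lab t) then all-units else deviants

    valid : Γ → W → Bool
    valid σ (unit v) = ok (rootKind σ) v
    valid σ _        = true

    _≟W_ : DecidableEquality W
    junk ≟W junk = yes refl
    junk ≟W unit v = no λ ()
    junk ≟W lbl x = no λ ()
    unit v ≟W junk = no λ ()
    unit v ≟W unit w with v ≟V w
    ... | yes refl = yes refl
    ... | no ¬e = no λ { refl → ¬e refl }
    unit v ≟W lbl x = no λ ()
    lbl x ≟W junk = no λ ()
    lbl x ≟W unit v = no λ ()
    lbl (base r d p) ≟W lbl (base r′ d′ p′) with r Fin.≟ r′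
    ... | no ¬e = no λ { refl → ¬e refl }
    ... | yes refl with d Fin.≟ d′ | p ≟Lb p′
    ...   | yes refl | yes refl = yes refl
    ...   | no ¬e | _ = no λ { refl → ¬e refl }
    ...   | yes _ | no ¬e = no λ { refl → ¬e refl }

    enumLb : ∀ a → Enum (Lb a)
    enumLb zero with enumΓ enum× enumFin 3
    ... | xs , p = here ∷ lmap (λ (b , i) → tm b i) xs ,
      λ { here → here refl ; (tm b i) → there (∈-map⁺ (λ (b , i) → tm b i) (p (b , i))) }
    enumLb (suc a) with enumFin (length (subtrees t)) enum× enumLb a
    ... | xs , p = here ∷ lmap (λ (g , q) → nt g q) xs ,
      λ { here → here refl ; (nt g q) → there (∈-map⁺ (λ (g , q) → nt g q) (p (g , q))) }

    labels : ∀ r → List Lab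
    labels r = lmap (λ (d , p) → base r d p) (proj₁ (enumFin (length (subtrees t)) enum× enumLb (toℕ r)))

    rows : List (Fin h) → List W
    rows []       = []
    rows (r ∷ rs) = lmap lbl (labels r) ++ rows rs

    rows-complete : ∀ r d p {rs} → r ∈ rs → lbl (base r d p) ∈ rows rs
    rows-complete r d p (here refl) = ∈-++⁺ˡ (∈-map⁺ lbl (∈-map⁺ (λ (d , p) → base r d p)
      (proj₂ (enumFin (length (subtrees t)) enum× enumLb (toℕ r)) (d , p))))
    rows-complete r d p {r′ ∷ rs} (there m) = ∈-++⁺ʳ (lmap lbl (labels r′)) (rows-complete r d p m)

    proper : List W
    proper = lmap unit (proj₁ (enumVtx t)) ++ rows (allFin h)

    proper-complete : ∀ w → ¬ (w ≡ junk) → w ∈ proper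
    proper-complete junk ¬j = ⊥-elim (¬j refl)
    proper-complete (unit v) _ = ∈-++⁺ˡ (∈-map⁺ unit (proj₂ (enumVtx t) v))
    proper-complete (lbl (base r d p)) _ = ∈-++⁺ʳ (lmap unit (proj₁ (enumVtx t))) (rows-complete r d p (∈-allFin r))

    rows-proper : ∀ rs → ¬ (junk ∈ rows rs)
    rows-proper (r ∷ rs) m with ∈-++⁻ (lmap lbl (labels r)) m
    ... | inj₁ q = case ∈-map⁻ lbl q of λ ()
    ... | inj₂ q = rows-proper rs q

    junk∉proper : ¬ (junk ∈ proper)
    junk∉proper m with ∈-++⁻ (lmap unit (proj₁ (enumVtx t))) m
    ... | inj₁ q = case ∈-map⁻ unit q of λ ()
    ... | inj₂ q = rows-proper (allFin h) q

    valid? : ∀ σ w → Dec (valid σ w ≡ true)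
    valid? σ w = valid σ w Bool.≟ true

    carrier : Γ → List W
    carrier σ = deduplicate _≟W_ (filter (valid? σ) proper)

    view : ∀ σ → Fin (suc (length (carrier σ))) → W
    view σ zero    = junk
    view σ (suc i) = lookup (carrier σ) i

    G : Γ → Digraph
    G σ = record { size = length (carrier σ) ; E = λ i j → e (view σ i) (view σ j) }

    carrier⇒ : ∀ σ {w} → w ∈ carrier σ → w ∈ proper × valid σ w ≡ true
    carrier⇒ σ m = ∈-filter⁻ (valid? σ) (∈-deduplicate⁻ _≟W_ (filter (valid? σ) proper) m)

    view-valid : ∀ σ i → valid σ (view σ i) ≡ true
    view-valid σ zero    = refl
    view-valid σ (suc i) = proj₂ (carrier⇒ σ (∈-lookup {xs = carrier σ} i))

    view-injective : ∀ σ {i j} → view σ i ≡ view σ j → i ≡ j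
    view-injective σ {zero}  {zero}  _ = refl
    view-injective σ {zero}  {suc j} p =
      ⊥-elim (junk∉proper (subst (_∈ proper) (sym p) (proj₁ (carrier⇒ σ (∈-lookup {xs = carrier σ} j)))))
    view-injective σ {suc i} {zero}  p =
      ⊥-elim (junk∉proper (subst (_∈ proper) p (proj₁ (carrier⇒ σ (∈-lookup {xs = carrier σ} i)))))
    view-injective σ {suc i} {suc j} p =
      cong suc (lookup-injective (DUniq.deduplicate-! _≟W_ (filter (valid? σ) proper)) i j p)

    view-onto : ∀ σ w → valid σ w ≡ true → Σ (Dom (G σ)) λ i → view σ i ≡ w
    view-onto σ w v with w ≟W junk
    ... | yes refl = zero , refl
    ... | no ¬j = suc (index m) , sym (lookup-index m)
      where
      m : w ∈ carrier σ
      m = ∈-deduplicate⁺ _≟W_ (∈-filter⁺ (valid? σ) (proper-complete w ¬j) v)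

&-true : ∀ {a b} → a & b ≡ true → a ≡ true × b ≡ true
&-true {true} {true} _ = refl , refl

&-intro : ∀ {a b} → a ≡ true → b ≡ true → a & b ≡ true
&-intro refl refl = refl

-- Otherwise sending each element to its index in the list would inject `Fin n` into fewer
-- positions.
fresh : ∀ {n} (xs : List (Fin n)) → length xs < n → Σ (Fin n) λ j → ¬ (j ∈ xs)
fresh {n} xs l = Fin.¬∀⟶∃¬ n (_∈ xs) (λ j → any? (j Fin.≟_) xs) λ f →
  let i , j , i<j , p = Fin.pigeonhole l (λ j → index (f j)) in
  Fin.<⇒≢ i<j (trans (lookup-index (f i)) (trans (cong (lookup xs) p) (sym (lookup-index (f j)))))

Sub-height : ∀ {S l D} → Sub S l D → suc (heightF D) ≤ heightF S
Sub-height {node _ _ ∷ F} top     = Nat.m≤m⊔n _ (heightF F)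
Sub-height {node _ _ ∷ F} (inn p) = Nat.≤-trans (Sub-height p) (Nat.≤-trans (Nat.n≤1+n _) (Nat.m≤m⊔n _ (heightF F)))
Sub-height {node _ D ∷ F} (nxt p) = Nat.≤-trans (Sub-height p) (Nat.m≤n⊔m (suc (heightF D)) _)

-- Moves made plus height of the forest to be played never grows. This bounds the number of moves,
-- and with it the length of the matches, in advance.
Sub-rounds : ∀ {S l D} k → Sub S l D → suc k + heightF D ≤ k + heightF S
Sub-rounds {D = D} k p = Nat.≤-trans (Nat.≤-reflexive (sym (Nat.+-suc k (heightF D)))) (Nat.+-monoʳ-≤ k (Sub-height p))

isFull⇒full : ∀ {ts} (τ : Dv ts) → isFull τ ≡ true → τ ≡ full ts
isFull⇒full []          p = refl
isFull⇒full (false ∷ τ) p = cong (false ∷_) (isFull⇒full τ p)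

-- Duplicator's strategy

module Duplicator (n : ℕ) where
  open Units n

  mutual
    -- ex τ i j matches the instances (τ , i) and (τ , j) identically; dv i j m matches a full
    -- instance on the side of the label with an instance that deviates only at the child given
    -- by m, whose pools are matched in turn as recorded in m.
    data Entry : Tree → Set where
      ex : ∀ {l ts} → Dv ts → K → K → Entry (node l ts)
      dv : ∀ {l ts} → K → K → Mode ts → Entry (node l ts)

    data Mode : Forest → Set where
      at   : ∀ {d ds} → List (Entry d) → Mode (d ∷ ds)
      skip : ∀ {d ds} → Mode ds → Mode (d ∷ ds)

  Match : Tree → Set
  Match c = List (Entry c)

  single : ∀ {ts} → Mode ts → Dv ts
  single {_ ∷ ds} (at _)   = true ∷ full ds
  single          (skip m) = false ∷ single m

  single-deviant : ∀ {ts} (m : Mode ts) → isFull (single m) ≡ false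
  single-deviant (at _)   = refl
  single-deviant (skip m) = single-deviant m

  ix : Γ → K → K → K
  ix ∃ₗ i j = i
  ix ∀ₗ i j = j

  state : ∀ {ts} → Γ → Γ → Mode ts → Dv ts
  state σ l m = if same σ l then full _ else single m

  instE : ∀ {c} → Γ → Entry c → Inst c
  instE σ (ex τ i j)     = τ , ix σ i j
  instE σ (dv {l} i j m) = state σ l m , ix σ i j

  mutual
    -- The graph of the partial isomorphism recorded by a match, from side `σ` to side `fl σ`. It
    -- descends through `dv` entries; inside an `ex` entry the two instances have equal pools and
    -- locations are copied.
    data RV (σ : Γ) : ∀ {c} → Match c → Vtx c → Vtx c → Set where
      rv : ∀ {l ts} {M : Match (node l ts)} {x τ i p τ′ i′ p′} → x ∈ M →
           (τ , i) ≡ instE σ x → (τ′ , i′) ≡ instE (fl σ) x → RM σ x p p′ → RV σ M (mk τ i p) (mk τ′ i′ p′)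

    data RM (σ : Γ) : ∀ {l ts} → Entry (node l ts) → Loc ts → Loc ts → Set where
      rex : ∀ {l ts τ i j p} → RM σ {l} {ts} (ex τ i j) p p
      rsf : ∀ {l ts i j m x y} → RX σ l m x y → RM σ {l} {ts} (dv i j m) (self x) (self y)
      rbl : ∀ {l ts i j m u w} → RC σ m u w → RM σ {l} {ts} (dv i j m) (below u) (below w)

    -- At the deviating child the instances are renamed by the match, so a designation has to be
    -- renamed too. A designated instance therefore needs an entry of its own, even if none of its
    -- units has been picked.
    data RX (σ l : Γ) : ∀ {ts} → Mode ts → All Inst ts → All Inst ts → Set where
      atS : ∀ {d ds I J x} {M : Match d} {xs : All Inst ds} → l ≡ lab d → x ∈ M →
            I ≡ instE σ x → J ≡ instE (fl σ) x → RX σ l (at M) (I ∷ xs) (J ∷ xs)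
      atO : ∀ {d ds I} {M : Match d} {xs : All Inst ds} → l ≢ lab d → RX σ l (at M) (I ∷ xs) (I ∷ xs)
      skX : ∀ {d ds I m} {xs ys : All Inst ds} → RX σ l m xs ys → RX σ l {d ∷ ds} (skip m) (I ∷ xs) (I ∷ ys)

    data RC (σ : Γ) : ∀ {ts} → Mode ts → Ch ts → Ch ts → Set where
      atH : ∀ {d ds v w} {M : Match d} → RV σ M v w → RC σ {d ∷ ds} (at M) (hd v) (hd w)
      atT : ∀ {d ds u} {M : Match d} → RC σ {d ∷ ds} (at M) (tl u) (tl u)
      skH : ∀ {d ds v m} → RC σ {d ∷ ds} (skip m) (hd v) (hd v)
      skT : ∀ {d ds u w m} → RC σ m u w → RC σ {d ∷ ds} (skip m) (tl u) (tl w)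

  instE-fl : ∀ {c} σ (x : Entry c) → instE (fl (fl σ)) x ≡ instE σ x
  instE-fl σ x = cong (λ τ → instE τ x) (fl-fl σ)

  mutual
    RV-sym : ∀ {σ c v w} {M : Match c} → RV σ M v w → RV (fl σ) M w v
    RV-sym {σ} (rv {x = x} m p q r) = rv m q (trans p (sym (instE-fl σ x))) (RM-sym r)

    RM-sym : ∀ {σ l ts p q} {x : Entry (node l ts)} → RM σ x p q → RM (fl σ) x q p
    RM-sym rex     = rex
    RM-sym (rsf r) = rsf (RX-sym r)
    RM-sym (rbl r) = rbl (RC-sym r)

    RX-sym : ∀ {σ l ts x y} {m : Mode ts} → RX σ l m x y → RX (fl σ) l m y x
    RX-sym {σ} (atS {x = x} l≡ m p q) = atS l≡ m q (trans p (sym (instE-fl σ x)))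
    RX-sym (atO l≢)    = atO l≢
    RX-sym (skX r)     = skX (RX-sym r)

    RC-sym : ∀ {σ ts u w} {m : Mode ts} → RC σ m u w → RC (fl σ) m w u
    RC-sym (atH r) = atH (RV-sym r)
    RC-sym atT     = atT
    RC-sym skH     = skH
    RC-sym (skT r) = skT (RC-sym r)

  -- The smaller of the two pools that a deviation makes different. It belongs to the deviating unit
  -- if the labels agree, and to the full one otherwise.
  smallKind : Γ → Γ → Kind
  smallKind l m = if same l m then deviants+1 else deviants

  -- In the pool of sort c all units occur on the side lab c; κ describes the pool on the other side.
  sideKind : Γ → Tree → Kind → Kind
  sideKind σ c κ = if same σ (lab c) then all-units else κ

  Apart : ∀ {c} → Entry c → Entry c → Set
  Apart x y = ∀ σ → instE σ x ≢ instE σ y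

  mutual
    -- `k` counts the moves made, `S` is the forest to be played and `κ` the kind of the pool on the
    -- side opposite to `lab c`. A move lengthens each list of entries by at most one, which
    -- maintains `short`.
    record GoodM (k : ℕ) (S : Forest) (κ : Kind) {c} (M : Match c) : Set where
      inductive
      constructor good
      field
        ¬emb    : ¬ Emb (c ∷ []) S
        short   : length M ≤ k
        apart   : AllPairs Apart M
        entries : All (GoodE k S κ) M

    data GoodE (k : ℕ) (S : Forest) (κ : Kind) : ∀ {c} → Entry c → Set where
      gex : ∀ {l ts τ i j} → okI κ τ (ix (fl l) i j) ≡ true → GoodE k S κ (ex {l} {ts} τ i j)
      gdv : ∀ {l ts i j m} → GoodMode k S l m → GoodE k S κ (dv {l} {ts} i j m)

    data GoodMode (k : ℕ) (S : Forest) (l : Γ) : ∀ {ts} → Mode ts → Set where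
      gat : ∀ {d ds} {M : Match d} → GoodM k S (smallKind l (lab d)) M → GoodMode k S l {d ∷ ds} (at M)
      gsk : ∀ {d ds m} → GoodMode k S l {ds} m → GoodMode k S l {d ∷ ds} (skip m)

  open GoodM

  mutual
    GoodM-weaken : ∀ {k S κ c σ D} {M : Match c} → Sub S σ D → GoodM k S κ M → GoodM (suc k) D κ M
    GoodM-weaken p g = good (¬Emb-below (¬emb g) p) (Nat.≤-trans (short g) (Nat.n≤1+n _)) (apart g) (GoodEs-weaken p (entries g))

    GoodEs-weaken : ∀ {k S κ c σ D} {M : Match c} → Sub S σ D → All (GoodE k S κ) M → All (GoodE (suc k) D κ) M
    GoodEs-weaken p []       = []
    GoodEs-weaken p (g ∷ gs) = GoodE-weaken p g ∷ GoodEs-weaken p gs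

    GoodE-weaken : ∀ {k S κ c σ D} {x : Entry c} → Sub S σ D → GoodE k S κ x → GoodE (suc k) D κ x
    GoodE-weaken p (gex q)   = gex q
    GoodE-weaken p (gdv g)   = gdv (GoodMode-weaken p g)

    GoodMode-weaken : ∀ {k S l ts σ D} {m : Mode ts} → Sub S σ D → GoodMode k S l m → GoodMode (suc k) D l m
    GoodMode-weaken p (gat g) = gat (GoodM-weaken p g)
    GoodMode-weaken p (gsk g) = gsk (GoodMode-weaken p g)

  apart⇒≡ : ∀ {c σ x y} {M : Match c} → AllPairs Apart M → x ∈ M → y ∈ M → instE σ x ≡ instE σ y → x ≡ y
  apart⇒≡ _ (here refl) (here refl) p = refl
  apart⇒≡ {σ = σ} (a ∷ _) (here refl) (there q) p = ⊥-elim (All.lookup a q σ p)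
  apart⇒≡ {σ = σ} (a ∷ _) (there q) (here refl) p = ⊥-elim (All.lookup a q σ (sym p))
  apart⇒≡ (_ ∷ as) (there q) (there r) p = apart⇒≡ as q r p

  okI-deviant : ∀ {ts} κ (τ : Dv ts) i → isFull τ ≡ false → okI κ τ i ≡ true
  okI-deviant all-units  τ i       p = refl
  okI-deviant deviants   τ i       p = cong not p
  okI-deviant deviants+1 τ zero    p = refl
  okI-deviant deviants+1 τ (suc i) p = cong not p

  okE : ∀ {k S κ c} σ {x : Entry c} → GoodE k S κ x →
        okI (sideKind σ c κ) (proj₁ (instE σ x)) (proj₂ (instE σ x)) ≡ true
  okE ∃ₗ (gex {∃ₗ} p) = refl
  okE ∃ₗ (gex {∀ₗ} p) = p
  okE ∀ₗ (gex {∃ₗ} p) = p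
  okE ∀ₗ (gex {∀ₗ} p) = refl
  okE ∃ₗ (gdv {∃ₗ} _) = refl
  okE {κ = κ} ∃ₗ (gdv {∀ₗ} {m = m} _) = okI-deviant κ (single m) _ (single-deviant m)
  okE {κ = κ} ∀ₗ (gdv {∃ₗ} {m = m} _) = okI-deviant κ (single m) _ (single-deviant m)
  okE ∀ₗ (gdv {∀ₗ} _) = refl

  bit : Γ → Γ → Bool
  bit σ l = not (same σ l)

  state-at : ∀ {d ds} σ l (M : Match d) → state {d ∷ ds} σ l (at M) ≡ bit σ l ∷ full ds
  state-at ∃ₗ ∃ₗ M = refl
  state-at ∃ₗ ∀ₗ M = refl
  state-at ∀ₗ ∃ₗ M = refl
  state-at ∀ₗ ∀ₗ M = refl

  state-skip : ∀ {d ds} σ l (m : Mode ds) → state {d ∷ ds} σ l (skip m) ≡ false ∷ state σ l m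
  state-skip ∃ₗ ∃ₗ m = refl
  state-skip ∃ₗ ∀ₗ m = refl
  state-skip ∀ₗ ∃ₗ m = refl
  state-skip ∀ₗ ∀ₗ m = refl

  -- The two rules in `kind` are made for this: whichever label the parent has, the pool that
  -- contains all units lies on the side of the child's own label. So the invariant has the same
  -- form at every depth.
  kind-bit : ∀ σ l d → kind l (lab d) (bit σ l) ≡ sideKind σ d (smallKind l (lab d))
  kind-bit ∃ₗ ∃ₗ (node ∃ₗ _) = refl
  kind-bit ∃ₗ ∃ₗ (node ∀ₗ _) = refl
  kind-bit ∃ₗ ∀ₗ (node ∃ₗ _) = refl
  kind-bit ∃ₗ ∀ₗ (node ∀ₗ _) = refl
  kind-bit ∀ₗ ∃ₗ (node ∃ₗ _) = refl
  kind-bit ∀ₗ ∃ₗ (node ∀ₗ _) = refl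
  kind-bit ∀ₗ ∀ₗ (node ∃ₗ _) = refl
  kind-bit ∀ₗ ∀ₗ (node ∀ₗ _) = refl

  -- Answers are legal and preserve sorts, equality and edges

  mutual
    RV-ok : ∀ {k S κ c σ v w} {M : Match c} → GoodM k S κ M → RV σ M v w →
            ok (sideKind σ c κ) v ≡ true → ok (sideKind (fl σ) c κ) w ≡ true
    RV-ok {κ = κ} {σ = σ} {v = mk τ i p} g (rv {l} {ts} {x = x} m e₁ e₂ r) o =
      &-intro (trans (cong (λ I → okI (sideKind (fl σ) (node l ts) κ) (proj₁ I) (proj₂ I)) e₂) (okE (fl σ) (All.lookup (entries g) m)))
              (RM-ok (All.lookup (entries g) m) (cong proj₁ e₁) (cong proj₁ e₂) r (proj₂ (&-true {okI (sideKind σ (node l ts) κ) τ i} o)))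

    RM-ok : ∀ {k S κ l ts σ p q τ τ′} {x : Entry (node l ts)} → GoodE k S κ x →
            τ ≡ proj₁ (instE σ x) → τ′ ≡ proj₁ (instE (fl σ) x) → RM σ x p q →
            okL l τ p ≡ true → okL l τ′ q ≡ true
    RM-ok _ refl refl rex o = o
    RM-ok (gdv g) e₁ e₂ (rsf r) o = RX-ok g r e₁ e₂ o
    RM-ok (gdv g) e₁ e₂ (rbl r) o = RC-ok g r e₁ e₂ o

    RX-ok : ∀ {k S l ts σ x y τ τ′} {m : Mode ts} → GoodMode k S l m → RX σ l m x y →
            τ ≡ state σ l m → τ′ ≡ state (fl σ) l m → okD l τ x ≡ true → okD l τ′ y ≡ true
    RX-ok {l = l} {σ = σ} (gat {d} {M = M} g) (atS {I = I} l≡ m p q) e₁ e₂ o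
      with trans e₁ (state-at σ l M) | trans e₂ (state-at (fl σ) l M)
    ... | refl | refl =
      &-intro (trans (if-same l≡) (trans (cong₂ (λ κ J → okI κ (proj₁ J) (proj₂ J)) (kind-bit (fl σ) l d) q)
                     (okE (fl σ) (All.lookup (entries g) m))))
              (proj₂ (&-true {if same l (lab d) then okI (kind l (lab d) (bit σ l)) (proj₁ I) (proj₂ I) else true} o))
    RX-ok {l = l} {σ = σ} (gat {d} {M = M} g) (atO {I = I} l≢) e₁ e₂ o
      with trans e₁ (state-at σ l M) | trans e₂ (state-at (fl σ) l M)
    ... | refl | refl =
      &-intro (if-other l≢)
              (proj₂ (&-true {if same l (lab d) then okI (kind l (lab d) (bit σ l)) (proj₁ I) (proj₂ I) else true} o))
    RX-ok {l = l} {σ = σ} (gsk {d} g) (skX {I = I} {m = m} r) e₁ e₂ o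
      with trans e₁ (state-skip {d} σ l m) | trans e₂ (state-skip {d} (fl σ) l m)
    ... | refl | refl =
      let a , b = &-true {if same l (lab d) then okI (kind l (lab d) false) (proj₁ I) (proj₂ I) else true} o in
      &-intro a (RX-ok g r refl refl b)

    RC-ok : ∀ {k S l ts σ u w τ τ′} {m : Mode ts} → GoodMode k S l m → RC σ m u w →
            τ ≡ state σ l m → τ′ ≡ state (fl σ) l m → okC l τ u ≡ true → okC l τ′ w ≡ true
    RC-ok {l = l} {σ = σ} (gat {d} {M = M} g) (atH {v = v} {w = w} r) e₁ e₂ o
      with trans e₁ (state-at σ l M) | trans e₂ (state-at (fl σ) l M)
    ... | refl | refl = trans (cong (λ κ → ok κ w) (kind-bit (fl σ) l d))
            (RV-ok g r (trans (cong (λ κ → ok κ v) (sym (kind-bit σ l d))) o))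
    RC-ok {l = l} {σ = σ} (gat {d} {M = M} g) atT e₁ e₂ o
      with trans e₁ (state-at σ l M) | trans e₂ (state-at (fl σ) l M)
    ... | refl | refl = o
    RC-ok {l = l} {σ = σ} (gsk {d} {m = m} g) skH e₁ e₂ o
      with trans e₁ (state-skip {d} σ l m) | trans e₂ (state-skip {d} (fl σ) l m)
    ... | refl | refl = o
    RC-ok {l = l} {σ = σ} (gsk {d} {m = m} g) (skT r) e₁ e₂ o
      with trans e₁ (state-skip {d} σ l m) | trans e₂ (state-skip {d} (fl σ) l m)
    ... | refl | refl = RC-ok g r refl refl o

  mutual
    -- A label sees of a unit only its sort and whether it is a root unit. As both are preserved,
    -- labels may be answered by themselves.
    RV-sort : ∀ {σ c v w} {M : Match c} → RV σ M v w → sort v ≡ sort w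
    RV-sort (rv {p = self _}  _ _ _ rex)     = refl
    RV-sort (rv {p = below _} _ _ _ rex)     = refl
    RV-sort (rv _ _ _ (rsf _)) = refl
    RV-sort (rv _ _ _ (rbl r)) = RC-sort r

    RC-sort : ∀ {σ ts u w} {m : Mode ts} → RC σ m u w → sortC u ≡ sortC w
    RC-sort (atH r) = RV-sort r
    RC-sort atT     = refl
    RC-sort skH     = refl
    RC-sort (skT r) = RC-sort r

  RV-self : ∀ {σ c v w} {M : Match c} → RV σ M v w → isSelf v ≡ isSelf w
  RV-self (rv {p = self _}  _ _ _ rex)     = refl
  RV-self (rv {p = below _} _ _ _ rex)     = refl
  RV-self (rv _ _ _ (rsf _)) = refl
  RV-self (rv _ _ _ (rbl _)) = refl

  mutual
    -- By `apart` the instance on either side determines the entry. Together with `RV-sym` this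
    -- makes the relation injective as well.
    RV-fun : ∀ {k S κ c σ v w w′} {M : Match c} → GoodM k S κ M → RV σ M v w → RV σ M v w′ → w ≡ w′
    RV-fun g (rv m₁ p₁ q₁ r₁) (rv m₂ p₂ q₂ r₂) with apart⇒≡ (apart g) m₁ m₂ (trans (sym p₁) p₂)
    ... | refl with trans q₁ (sym q₂) | RM-fun (All.lookup (entries g) m₁) r₁ r₂
    ...   | refl | refl = refl

    RM-fun : ∀ {k S κ l ts σ p q q′} {x : Entry (node l ts)} → GoodE k S κ x → RM σ x p q → RM σ x p q′ → q ≡ q′
    RM-fun _         rex      rex       = refl
    RM-fun (gdv g) (rsf r₁) (rsf r₂) = cong self (RX-fun g r₁ r₂)
    RM-fun (gdv g) (rbl r₁) (rbl r₂) = cong below (RC-fun g r₁ r₂)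

    RX-fun : ∀ {k S l ts σ x y y′} {m : Mode ts} → GoodMode k S l m → RX σ l m x y → RX σ l m x y′ → y ≡ y′
    RX-fun (gat g) (atS _ m₁ p₁ q₁) (atS _ m₂ p₂ q₂) with apart⇒≡ (apart g) m₁ m₂ (trans (sym p₁) p₂)
    ... | refl = cong (_∷ _) (trans q₁ (sym q₂))
    RX-fun _ (atS l≡ _ _ _) (atO l≢)       = ⊥-elim (l≢ l≡)
    RX-fun _ (atO l≢)       (atS l≡ _ _ _) = ⊥-elim (l≢ l≡)
    RX-fun _ (atO _)        (atO _)        = refl
    RX-fun (gsk g) (skX r₁) (skX r₂)       = cong (_ ∷_) (RX-fun g r₁ r₂)

    RC-fun : ∀ {k S l ts σ u w w′} {m : Mode ts} → GoodMode k S l m → RC σ m u w → RC σ m u w′ → w ≡ w′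
    RC-fun (gat g) (atH r₁) (atH r₂) = cong hd (RV-fun g r₁ r₂)
    RC-fun _       atT      atT      = refl
    RC-fun _       skH      skH      = refl
    RC-fun (gsk g) (skT r₁) (skT r₂) = cong tl (RC-fun g r₁ r₂)

  does-⇔ : ∀ {P Q : Set} (p : Dec P) (q : Dec Q) → (P → Q) → (Q → P) → does p ≡ does q
  does-⇔ (yes p) (yes q) f g = refl
  does-⇔ (yes p) (no ¬q) f g = ⊥-elim (¬q (f p))
  does-⇔ (no ¬p) (yes q) f g = ⊥-elim (¬p (g q))
  does-⇔ (no ¬p) (no ¬q) f g = refl

  entries-⇔ : ∀ {k S κ c σ x y I I′ J J′} {M : Match c} → GoodM k S κ M → x ∈ M → y ∈ M →
              I ≡ instE σ x → I′ ≡ instE (fl σ) x → J ≡ instE σ y → J′ ≡ instE (fl σ) y →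
              does (I ≟I J) ≡ does (I′ ≟I J′)
  entries-⇔ {σ = σ} {x} {y} {I} {I′} {J} {J′} g m₁ m₂ refl refl refl refl =
    does-⇔ (I ≟I J) (I′ ≟I J′)
      (λ p → cong (instE (fl σ)) (apart⇒≡ (apart g) m₁ m₂ p))
      (λ p → cong (instE σ) (apart⇒≡ (apart g) m₁ m₂ p))

  RC-pc : ∀ {σ l ts u w} {m : Mode ts} → RC σ m u w → pc l u ≡ pc l w
  RC-pc {l = l} (atH {d} r) = cong (_& same l (lab d)) (RV-self r)
  RC-pc atT     = refl
  RC-pc skH     = refl
  RC-pc (skT r) = RC-pc r

  RC-cp : ∀ {k S σ l ts u w x y} {m : Mode ts} → GoodMode k S l m → RX σ l m x y → RC σ m u w → cp l u x ≡ cp l w y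
  RC-cp (gat {d} g) (atS l≡ m₂ p₂ q₂) (atH r@(rv m₁ p₁ q₁ _)) =
    cong₂ _&_ (RV-self r) (trans (if-same l≡) (trans (entries-⇔ g m₁ m₂ p₁ q₁ p₂ q₂) (sym (if-same l≡))))
  RC-cp (gat {d} g) (atO l≢) (atH r) = cong₂ _&_ (RV-self r) (trans (if-other l≢) (sym (if-other l≢)))
  RC-cp _ (atS _ _ _ _) atT = refl
  RC-cp _ (atO _) atT = refl
  RC-cp _ (skX _) skH = refl
  RC-cp (gsk g) (skX r) (skT q) = RC-cp g r q

  mutual
    RV-e : ∀ {k S κ c σ v v′ w w′} {M : Match c} → GoodM k S κ M → RV σ M v w → RV σ M v′ w′ → eV v v′ ≡ eV w w′
    RV-e {σ = σ} {v = mk τ i _} {mk τ′ i′ _} {mk ρ j _} {mk ρ′ j′ _} g (rv m₁ p₁ q₁ r₁) (rv m₂ p₂ q₂ r₂)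
      with (τ , i) ≟I (τ′ , i′) | (ρ , j) ≟I (ρ′ , j′) | entries-⇔ {σ = σ} g m₁ m₂ p₁ q₁ p₂ q₂
    ... | no _  | no _  | _ = refl
    ... | yes a | yes b | _ with apart⇒≡ (apart g) m₁ m₂ (trans (sym p₁) (trans a p₂))
    ...   | refl = RM-e (All.lookup (entries g) m₁) r₁ r₂

    RM-e : ∀ {k S κ l ts σ p p′ q q′} {x : Entry (node l ts)} → GoodE k S κ x → RM σ x p q → RM σ x p′ q′ →
           eL l p p′ ≡ eL l q q′
    RM-e _ rex rex = refl
    RM-e (gdv g) (rsf {x = x} {y} r) (rsf {x = x′} {y′} r′) = cong not (does-⇔ (x ≟X x′) (y ≟X y′)
      (λ { refl → RX-fun g r r′ }) (λ { refl → RX-fun g (RX-sym r) (RX-sym r′) }))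
    RM-e (gdv g) (rsf r) (rbl r′) = RC-pc r′
    RM-e (gdv g) (rbl r) (rsf r′) = RC-cp g r′ r
    RM-e (gdv g) (rbl r) (rbl r′) = RC-e g r r′

    RC-e : ∀ {k S l ts σ u u′ w w′} {m : Mode ts} → GoodMode k S l m → RC σ m u w → RC σ m u′ w′ → eC u u′ ≡ eC w w′
    RC-e (gat g) (atH r) (atH r′) = RV-e g r r′
    RC-e _ (atH _) atT = refl
    RC-e _ atT (atH _) = refl
    RC-e _ atT atT = refl
    RC-e _ skH skH = refl
    RC-e _ skH (skT _) = refl
    RC-e _ (skT _) skH = refl
    RC-e (gsk g) (skT r) (skT r′) = RC-e g r r′

  -- Growth of matches

  mutual
    -- An entry grows only inside its mode and keeps the child at which it deviates. The matched
    -- instances stay the same, and vertices related once remain related.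
    data _⊑E_ : ∀ {c} → Entry c → Entry c → Set where
      keep : ∀ {c} {x : Entry c} → x ⊑E x
      grow : ∀ {l ts i j} {m m′ : Mode ts} → m ⊑M m′ → dv {l} i j m ⊑E dv i j m′

    data _⊑M_ : ∀ {ts} → Mode ts → Mode ts → Set where
      at   : ∀ {d ds} {M M′ : Match d} → M ⊑ M′ → _⊑M_ {d ∷ ds} (at M) (at M′)
      skip : ∀ {d ds m m′} → m ⊑M m′ → _⊑M_ {d ∷ ds} (skip m) (skip m′)

    data _⊑_ {c} (M M′ : Match c) : Set where
      sub : (∀ {x} → x ∈ M → Σ (Entry c) λ y → y ∈ M′ × x ⊑E y) → M ⊑ M′

  ⊑-refl : ∀ {c} {M : Match c} → M ⊑ M
  ⊑-refl = sub λ m → _ , m , keep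

  single-⊑ : ∀ {ts} {m m′ : Mode ts} → m ⊑M m′ → single m ≡ single m′
  single-⊑ (at _)   = refl
  single-⊑ (skip p) = cong (false ∷_) (single-⊑ p)

  instE-⊑ : ∀ {c σ} {x y : Entry c} → x ⊑E y → instE σ x ≡ instE σ y
  instE-⊑ keep = refl
  instE-⊑ {σ = σ} (grow {l} {i = i} {j} p) = cong (λ τ → (if same σ l then full _ else τ) , ix σ i j) (single-⊑ p)

  mutual
    RV-mono : ∀ {c σ v w} {M M′ : Match c} → M ⊑ M′ → RV σ M v w → RV σ M′ v w
    RV-mono (sub f) (rv m p q r) with f m
    ... | y , m′ , x⊑y = rv m′ (trans p (instE-⊑ x⊑y)) (trans q (instE-⊑ x⊑y)) (RM-mono x⊑y r)

    RM-mono : ∀ {l ts σ p q} {x y : Entry (node l ts)} → x ⊑E y → RM σ x p q → RM σ y p q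
    RM-mono keep     r       = r
    RM-mono (grow g) (rsf r) = rsf (RX-mono g r)
    RM-mono (grow g) (rbl r) = rbl (RC-mono g r)

    RX-mono : ∀ {l ts σ x y} {m m′ : Mode ts} → m ⊑M m′ → RX σ l m x y → RX σ l m′ x y
    RX-mono (at (sub f)) (atS l≡ m p q) with f m
    ... | y , m′ , x⊑y = atS l≡ m′ (trans p (instE-⊑ x⊑y)) (trans q (instE-⊑ x⊑y))
    RX-mono (at _) (atO l≢)  = atO l≢
    RX-mono (skip g) (skX r) = skX (RX-mono g r)

    RC-mono : ∀ {ts σ u w} {m m′ : Mode ts} → m ⊑M m′ → RC σ m u w → RC σ m′ u w
    RC-mono (at g) (atH r)   = atH (RV-mono g r)
    RC-mono (at g) atT       = atT
    RC-mono (skip g) skH     = skH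
    RC-mono (skip g) (skT r) = skT (RC-mono g r)

-- Extending a match by one move

module Strategy (n : ℕ) where
  open Units n
  open Duplicator n
  open GoodM

  okD-head : ∀ {l d I b ds} {τ : Dv ds} {xs : All Inst ds} → okD {d ∷ ds} l (b ∷ τ) (I ∷ xs) ≡ true → l ≡ lab d →
             okI (kind l (lab d) b) (proj₁ I) (proj₂ I) ≡ true
  okD-head {l} {d} {I} {b} o l≡ = trans (sym (if-same l≡))
    (proj₁ (&-true {if same l (lab d) then okI (kind l (lab d) b) (proj₁ I) (proj₂ I) else true} o))

  upd : ∀ {c} {M : Match c} {x} → x ∈ M → Entry c → Match c
  upd {M = _ ∷ M} (here _)  y = y ∷ M
  upd {M = a ∷ _} (there p) y = a ∷ upd p y

  upd-∈ : ∀ {c} {M : Match c} {x} (p : x ∈ M) y → y ∈ upd p y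
  upd-∈ (here _)  y = here refl
  upd-∈ (there p) y = there (upd-∈ p y)

  upd-length : ∀ {c} {M : Match c} {x} (p : x ∈ M) y → length (upd p y) ≡ length M
  upd-length (here _)  y = refl
  upd-length (there p) y = cong suc (upd-length p y)

  upd-All : ∀ {c} {M : Match c} {x y} {P : Entry c → Set} (p : x ∈ M) → P y → All P M → All P (upd p y)
  upd-All (here _)  q (_ ∷ r) = q ∷ r
  upd-All (there p) q (a ∷ r) = a ∷ upd-All p q r

  upd-⊑ : ∀ {c} {M : Match c} {x y} (p : x ∈ M) → x ⊑E y → M ⊑ upd p y
  upd-⊑ {c} {M} {x} {y} p x⊑y = sub (go p)
    where
    go : ∀ {M} (p : x ∈ M) {a} → a ∈ M → Σ (Entry c) λ b → b ∈ upd p y × a ⊑E b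
    go (here refl) (here refl) = y , here refl , x⊑y
    go (here _)    (there q)   = _ , there q , keep
    go (there p)   (here refl) = _ , here refl , keep
    go (there p)   (there q)   = let b , m , r = go p q in b , there m , r

  upd-apart : ∀ {c} {M : Match c} {x y} (p : x ∈ M) → x ⊑E y → AllPairs Apart M → AllPairs Apart (upd p y)
  upd-apart (here refl) x⊑y (a ∷ as) = All.map (λ f σ e → f σ (trans (instE-⊑ x⊑y) e)) a ∷ as
  upd-apart {x = x} (there p) x⊑y (a ∷ as) =
    upd-All p (λ σ e → All.lookup a p σ (trans e (sym (instE-⊑ x⊑y)))) a ∷ upd-apart p x⊑y as

  exσ : ∀ {l ts} → Γ → Dv ts → K → K → Entry (node l ts)
  exσ ∃ₗ τ i j = ex τ i j
  exσ ∀ₗ τ i j = ex τ j i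

  exσ-near : ∀ {l ts} σ (τ : Dv ts) i j → instE σ (exσ {l} σ τ i j) ≡ (τ , i)
  exσ-near ∃ₗ τ i j = refl
  exσ-near ∀ₗ τ i j = refl

  exσ-far : ∀ {l ts} σ (τ : Dv ts) i j → instE (fl σ) (exσ {l} σ τ i j) ≡ (τ , j)
  exσ-far ∃ₗ τ i j = refl
  exσ-far ∀ₗ τ i j = refl

  exσ-RM : ∀ {l ts} σ (τ : Dv ts) i j p → RM σ (exσ {l} σ τ i j) p p
  exσ-RM ∃ₗ τ i j p = rex
  exσ-RM ∀ₗ τ i j p = rex

  exσ-big : ∀ {k S κ ts} l (τ : Dv ts) i j → okI κ τ j ≡ true → GoodE k S κ (exσ {l} l τ i j)
  exσ-big ∃ₗ τ i j o = gex o
  exσ-big ∀ₗ τ i j o = gex o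

  exσ-small : ∀ {k S κ ts} l (τ : Dv ts) i j → okI κ τ i ≡ true → GoodE k S κ (exσ {l} (fl l) τ i j)
  exσ-small ∃ₗ τ i j o = gex o
  exσ-small ∀ₗ τ i j o = gex o

  -- Copy zero is a legal answer for every legal pick below a full unit: with equal labels
  -- `deviants+1` admits all vectors there; with different labels the pick is a deviant and the
  -- answering pool holds all units.
  exσ-child : ∀ {k S ts} l m (τ : Dv ts) i → okI (kind l m false) τ i ≡ true →
              GoodE k S (smallKind l m) (exσ {m} l τ i zero)
  exσ-child ∃ₗ ∃ₗ τ i o = gex refl
  exσ-child ∃ₗ ∀ₗ τ i o = gex o
  exσ-child ∀ₗ ∃ₗ τ i o = gex o
  exσ-child ∀ₗ ∀ₗ τ i o = gex refl

  exσ-same : ∀ {k S ts} l (τ : Dv ts) i → GoodE k S (smallKind l l) (exσ {l} l τ i zero)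
  exσ-same ∃ₗ τ i = gex refl
  exσ-same ∀ₗ τ i = gex refl

  dvσ : ∀ {l ts} → Γ → K → K → Mode ts → Entry (node l ts)
  dvσ ∃ₗ i j m = dv i j m
  dvσ ∀ₗ i j m = dv j i m

  dvσ-near : ∀ {ts} l i j (m : Mode ts) → instE l (dvσ {l} l i j m) ≡ (full ts , i)
  dvσ-near ∃ₗ i j m = refl
  dvσ-near ∀ₗ i j m = refl

  dvσ-far : ∀ {ts} l i j (m : Mode ts) → instE (fl l) (dvσ {l} l i j m) ≡ (single m , j)
  dvσ-far ∃ₗ i j m = refl
  dvσ-far ∀ₗ i j m = refl

  dvσ-good : ∀ {k S κ ts l i j} σ {m : Mode ts} → GoodMode k S l m → GoodE k S κ (dvσ {l} σ i j m)
  dvσ-good ∃ₗ g = gdv g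
  dvσ-good ∀ₗ g = gdv g

  dvσ-RM : ∀ {σ l ts i j p q} ς {m : Mode ts} → (∀ {i j} → RM σ {l} (dv i j m) p q) → RM σ {l} (dvσ ς i j m) p q
  dvσ-RM ∃ₗ r = r
  dvσ-RM ∀ₗ r = r

  lookup? : ∀ {c} σ (M : Match c) (I : Inst c) →
            (Σ (Entry c) λ x → x ∈ M × I ≡ instE σ x) ⊎ (∀ {x} → x ∈ M → instE σ x ≢ I)
  lookup? σ M I with any? (λ x → I ≟I instE σ x) M
  ... | yes p = inj₁ (find p)
  ... | no ¬p = inj₂ λ m e → ¬p (lose m (sym e))

  freshE : ∀ {k c} σ (M : Match c) (τ : Dv (kids c)) → length M ≤ k → k ≤ suc n →
           Σ K λ j → ∀ {x} → x ∈ M → instE σ x ≢ (τ , j)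
  freshE σ M τ l k≤ with fresh (lmap (λ x → proj₂ (instE σ x)) M)
                         (s≤s (Nat.≤-trans (Nat.≤-reflexive (length-map _ M)) (Nat.≤-trans l k≤)))
  ... | j , j∉ = j , λ {x} m e → j∉ (subst (_∈ _) (cong proj₂ e) (∈-map⁺ (λ x → proj₂ (instE σ x)) m))

  Apart-sides : ∀ {c} σ {x y : Entry c} → instE σ x ≢ instE σ y → instE (fl σ) x ≢ instE (fl σ) y → Apart x y
  Apart-sides ∃ₗ a b ∃ₗ = a
  Apart-sides ∃ₗ a b ∀ₗ = b
  Apart-sides ∀ₗ a b ∀ₗ = a
  Apart-sides ∀ₗ a b ∃ₗ = b

  cons-good : ∀ {k S κ c σ D I J} {M : Match c} {x : Entry c} τ → Sub S σ D → GoodM k S κ M →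
              instE τ x ≡ I → instE (fl τ) x ≡ J →
              (∀ {y} → y ∈ M → instE τ y ≢ I) → (∀ {y} → y ∈ M → instE (fl τ) y ≢ J) →
              GoodE (suc k) D κ x → GoodM (suc k) D κ (x ∷ M)
  cons-good τ p g refl refl a b gx =
    good (¬Emb-below (¬emb g) p) (s≤s (short g))
         (All.tabulate (λ m → Apart-sides τ (λ e → a m (sym e)) (λ e → b m (sym e))) ∷ apart g)
         (gx ∷ entries (GoodM-weaken p g))

  cons-⊑ : ∀ {c} {M : Match c} {x} → M ⊑ (x ∷ M)
  cons-⊑ = sub λ m → _ , there m , keep

  upd-good : ∀ {k S κ c σ D} {M : Match c} {x y} (m : x ∈ M) → Sub S σ D → GoodM k S κ M → x ⊑E y →
             GoodE (suc k) D κ y → GoodM (suc k) D κ (upd m y)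
  upd-good {k = k} m p g x⊑y gy =
    good (¬emb g′) (subst (_≤ suc k) (sym (upd-length m _)) (short g′))
         (upd-apart m x⊑y (apart g)) (upd-All m gy (entries g′))
    where g′ = GoodM-weaken p g

  module _ {k : ℕ} {D : Forest} {l : Γ} where

    modeAt : ∀ {ts d} → ts ∋ d → ¬ Emb (d ∷ []) D → Σ (Mode ts) λ m → GoodMode (suc k) D l m
    modeAt z ¬e = at [] , gat (good ¬e z≤n [] [])
    modeAt (s x) ¬e = let m , g = modeAt x ¬e in skip m , gsk g

    -- Picking a full unit exposes its designations at once. At the deviating child the designated
    -- instance, full or not, is matched with the same vector at copy zero.
    initX : ∀ {ts d} → ts ∋ d → ¬ Emb (d ∷ []) D → (x : All Inst ts) →
            Σ (Mode ts) λ m → Σ (All Inst ts) λ y → GoodMode (suc k) D l m × RX l l m x y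
    initX (z {d@(node m us)}) ¬e ((τ , i) ∷ xs) with l ≟Γ m
    ... | no l≢ = at [] , _ , gat (good ¬e z≤n [] []) , atO l≢
    ... | yes refl = at (exσ l τ i zero ∷ []) , (τ , zero) ∷ xs
      , gat (good ¬e (s≤s z≤n) ([] ∷ []) (exσ-same l τ i ∷ []))
      , atS refl (here refl) (sym (exσ-near l τ i zero)) (sym (exσ-far l τ i zero))
    initX (s x) ¬e (I ∷ xs) = let m , y , g , r = initX x ¬e xs in skip m , I ∷ y , gsk g , skX r

    -- The pick lies below a full unit that was not matched before. The outer unit deviates; at the
    -- deviating child the inner instance keeps its vector and moves to copy zero.
    initC : ∀ {ts d} → ts ∋ d → ¬ Emb (d ∷ []) D → (u : Ch ts) → okC l (full ts) u ≡ true →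
            Σ (Mode ts) λ m → Σ (Ch ts) λ w → GoodMode (suc k) D l m × RC l m u w
    initC (z {node m us}) ¬e (hd (mk τ i p)) o = at (exσ l τ i zero ∷ []) , hd (mk τ zero p)
      , gat (good ¬e (s≤s z≤n) ([] ∷ []) (exσ-child l m τ i (proj₁ (&-true o)) ∷ []))
      , atH (rv (here refl) (sym (exσ-near l τ i zero)) (sym (exσ-far l τ i zero)) (exσ-RM l τ i zero p))
    initC z ¬e (tl u) o = at [] , tl u , gat (good ¬e z≤n [] []) , atT
    initC (s x) ¬e (hd v) o = let m , g = modeAt x ¬e in skip m , hd v , gsk g , skH
    initC (s x) ¬e (tl u) o = let m , w , g , r = initC x ¬e u o in skip m , tl w , gsk g , skT r

  module _ {k S σ D} (k≤ : k ≤ suc n) (p : Sub S σ D) where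

    -- On the side of the label the pick is a deviant, which every pool admits; on the opposite side
    -- it comes from the smaller pool, and the larger one contains every vector.
    newEx : ∀ {κ l ts} {M : Match (node l ts)} → GoodM k S κ M → ∀ τ i →
            okI (sideKind σ (node l ts) κ) τ i ≡ true → ¬ (σ ≡ l × isFull τ ≡ true) →
            (∀ {x} → x ∈ M → instE σ x ≢ (τ , i)) →
            Σ (Entry (node l ts)) λ x → Σ K λ j → GoodM (suc k) D κ (x ∷ M) ×
              (τ , i) ≡ instE σ x × (τ , j) ≡ instE (fl σ) x × (∀ q → RM σ x q q)
    newEx {κ} {l} {M = M} g τ i o ¬f ∉ with freshE (fl σ) M τ (short g) k≤
    ... | j , j∉ = exσ σ τ i j , j ,
      cons-good σ p g (exσ-near σ τ i j) (exσ-far σ τ i j) ∉ j∉ goodE ,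
      sym (exσ-near σ τ i j) , sym (exσ-far σ τ i j) , exσ-RM σ τ i j
      where
      goodE : GoodE (suc k) D κ (exσ {l} σ τ i j)
      goodE with σ ≟Γ l
      ... | yes refl = exσ-big σ τ i j (okI-deviant κ τ j (notFull (isFull τ) refl))
        where notFull : ∀ b → isFull τ ≡ b → isFull τ ≡ false
              notFull false q = q
              notFull true  q = ⊥-elim (¬f (refl , q))
      ... | no σ≢ = subst (λ ς → GoodE (suc k) D κ (exσ {l} ς τ i j)) (sym (≢⇒fl σ≢))
                      (exσ-small l τ i j o)

    newDv : ∀ {κ l ts} {M : Match (node l ts)} → GoodM k S κ M → σ ≡ l → ∀ i {m} → GoodMode (suc k) D l m →
            (∀ {x} → x ∈ M → instE σ x ≢ (full ts , i)) →
            Σ K λ j → GoodM (suc k) D κ (dvσ σ i j m ∷ M)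
    newDv {M = M} g refl i {m} gm ∉ with freshE (fl σ) M (single m) (short g) k≤
    ... | j , j∉ = j , cons-good σ p g (dvσ-near σ i j m) (dvσ-far σ i j m) ∉ j∉ (dvσ-good σ gm)

    bigFull? : ∀ {ts} l (τ : Dv ts) → Dec (σ ≡ l × isFull τ ≡ true)
    bigFull? l τ with σ ≟Γ l | isFull τ Bool.≟ true
    ... | yes a | yes b = yes (a , b)
    ... | no ¬a | _     = no λ (a , _) → ¬a a
    ... | _     | no ¬b = no λ (_ , b) → ¬b b

    deviation : ∀ {κ l ts} {M : Match (node l ts)} → GoodM k S κ M → σ ≡ l → Σ Tree λ d → ts ∋ d × ¬ Emb (d ∷ []) D
    deviation {l = l} {ts} g refl = ¬Emb-witness ts (¬Emb-kids (¬emb g) p)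

    extI : ∀ {κ c} {M : Match c} → GoodM k S κ M → (I : Inst c) →
           okI (sideKind σ c κ) (proj₁ I) (proj₂ I) ≡ true →
           Σ (Match c) λ M′ → M ⊑ M′ × GoodM (suc k) D κ M′ × Σ (Entry c) λ x → x ∈ M′ × I ≡ instE σ x
    extI {c = node l ts} {M} g (τ , i) o with lookup? σ M (τ , i)
    ... | inj₁ (x , m , e) = M , ⊑-refl , GoodM-weaken p g , x , m , e
    ... | inj₂ ∉ with bigFull? l τ
    ...   | no ¬f = let x , j , g′ , e , _ = newEx g τ i o ¬f ∉ in x ∷ M , cons-⊑ , g′ , x , here refl , e
    ...   | yes (refl , f) with isFull⇒full τ f | deviation g refl
    ...     | refl | d , x , ¬e =
      let m , gm = modeAt x ¬e ; j , g′ = newDv g refl i gm ∉ in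
      dvσ σ i j m ∷ M , cons-⊑ , g′ , _ , here refl , sym (dvσ-near σ i j m)

    extX-at : ∀ {l d ds} {M : Match d} → GoodM k S (smallKind l (lab d)) M → (I : Inst d) (xs : All Inst ds) →
              okD {d ∷ ds} l (bit σ l ∷ full ds) (I ∷ xs) ≡ true → Dec (l ≡ lab d) →
              Σ (Mode (d ∷ ds)) λ m → Σ (All Inst (d ∷ ds)) λ y →
                at M ⊑M m × GoodMode (suc k) D l m × RX σ l m (I ∷ xs) y
    extX-at {M = M} g I xs o (no l≢) = at M , I ∷ xs , at ⊑-refl , gat (GoodM-weaken p g) , atO l≢
    extX-at {l} {d} g I xs o (yes l≡) =
      let M′ , M⊑ , g′ , x , m , e = extI g I (trans (cong (λ κ → okI κ (proj₁ I) (proj₂ I)) (sym (kind-bit σ l d)))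
                                                     (okD-head {l} {d} {I} {bit σ l} {xs = xs} o l≡)) in
      at M′ , instE (fl σ) x ∷ xs , at M⊑ , gat g′ , atS l≡ m e refl

    mutual
      extV : ∀ {κ c} {M : Match c} → GoodM k S κ M → (v : Vtx c) → ok (sideKind σ c κ) v ≡ true →
             Σ (Match c) λ M′ → Σ (Vtx c) λ w → M ⊑ M′ × GoodM (suc k) D κ M′ × RV σ M′ v w
      extV {κ} {node l ts} {M} g (mk τ i q) o with lookup? σ M (τ , i)
      ... | inj₁ (x , m , e) =
        extE g m e q (proj₂ (&-true {okI (sideKind σ (node l ts) κ) τ i} o))
      ... | inj₂ ∉ with bigFull? l τ
      ...   | no ¬f = let x , j , g′ , e₁ , e₂ , r = newEx g τ i (proj₁ (&-true o)) ¬f ∉ in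
                      x ∷ M , mk τ j q , cons-⊑ , g′ , rv (here refl) e₁ e₂ (r q)
      ...   | yes (refl , f) with isFull⇒full τ f | deviation g refl
      ...     | refl | d , x , ¬e = fullV g i q (proj₂ (&-true {okI (sideKind σ (node l ts) κ) τ i} o)) ∉ x ¬e

      fullV : ∀ {κ ts d} {M : Match (node σ ts)} → GoodM k S κ M → ∀ i q → okL σ (full ts) q ≡ true →
              (∀ {x} → x ∈ M → instE σ x ≢ (full ts , i)) → ts ∋ d → ¬ Emb (d ∷ []) D →
              Σ (Match (node σ ts)) λ M′ → Σ (Vtx (node σ ts)) λ w →
                M ⊑ M′ × GoodM (suc k) D κ M′ × RV σ M′ (mk (full ts) i q) w
      fullV {M = M} g i (self xs) o ∉ x ¬e =
        let m , ys , gm , r = initX x ¬e xs ; j , g′ = newDv g refl i gm ∉ in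
        dvσ σ i j m ∷ M , mk (single m) j (self ys) , cons-⊑ , g′ ,
        rv (here refl) (sym (dvσ-near σ i j m)) (sym (dvσ-far σ i j m)) (dvσ-RM σ (rsf r))
      fullV {M = M} g i (below u) o ∉ x ¬e =
        let m , w , gm , r = initC x ¬e u o ; j , g′ = newDv g refl i gm ∉ in
        dvσ σ i j m ∷ M , mk (single m) j (below w) , cons-⊑ , g′ ,
        rv (here refl) (sym (dvσ-near σ i j m)) (sym (dvσ-far σ i j m)) (dvσ-RM σ (rbl r))

      -- For an instance already matched, the answer is forced down to the mode of its entry;
      -- whatever the mode needs is added there, and the grown entry replaces the old one in place.
      extE : ∀ {κ l ts τ i x} {M : Match (node l ts)} → GoodM k S κ M → (m : x ∈ M) → (τ , i) ≡ instE σ x →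
             ∀ q → okL l τ q ≡ true →
             Σ (Match (node l ts)) λ M′ → Σ (Vtx (node l ts)) λ w →
               M ⊑ M′ × GoodM (suc k) D κ M′ × RV σ M′ (mk τ i q) w
      extE {x = ex τ i j} {M} g m refl q o =
        M , mk τ (ix (fl σ) i j) q , ⊑-refl , GoodM-weaken p g , rv m refl refl rex
      extE {l = l} {x = dv i j m₀} g m e (self xs) o with All.lookup (entries g) m
      ... | gdv gm =
        let m₁ , ys , m⊑ , gm′ , r = extX gm xs (cong proj₁ e) o in
        upd m (dv i j m₁) , mk _ _ (self ys) , upd-⊑ m (grow m⊑) , upd-good m p g (grow m⊑) (gdv gm′) ,
        rv (upd-∈ m _) (trans e (instE-⊑ {σ = σ} (grow {l} {i = i} {j} m⊑))) refl (rsf r)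
      extE {l = l} {x = dv i j m₀} g m e (below u) o with All.lookup (entries g) m
      ... | gdv gm =
        let m₁ , w , m⊑ , gm′ , r = extC gm u (cong proj₁ e) o in
        upd m (dv i j m₁) , mk _ _ (below w) , upd-⊑ m (grow m⊑) , upd-good m p g (grow m⊑) (gdv gm′) ,
        rv (upd-∈ m _) (trans e (instE-⊑ {σ = σ} (grow {l} {i = i} {j} m⊑))) refl (rbl r)

      extX : ∀ {l ts τ} {m : Mode ts} → GoodMode k S l m → (x : All Inst ts) → τ ≡ state σ l m → okD l τ x ≡ true →
             Σ (Mode ts) λ m′ → Σ (All Inst ts) λ y → m ⊑M m′ × GoodMode (suc k) D l m′ × RX σ l m′ x y
      extX {l} (gat {d} {M = M} g) (I ∷ xs) e o with trans e (state-at σ l M)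
      ... | refl = extX-at g I xs o (l ≟Γ lab d)
      extX {l} (gsk {d} {m = m} g) (I ∷ xs) e o with trans e (state-skip {d} σ l m)
      ... | refl =
        let m′ , ys , m⊑ , g′ , r = extX g xs refl (proj₂ (&-true {if same l (lab d) then okI (kind l (lab d) false) (proj₁ I) (proj₂ I) else true} o)) in
        skip m′ , I ∷ ys , skip m⊑ , gsk g′ , skX r

      extC : ∀ {l ts τ} {m : Mode ts} → GoodMode k S l m → (u : Ch ts) → τ ≡ state σ l m → okC l τ u ≡ true →
             Σ (Mode ts) λ m′ → Σ (Ch ts) λ w → m ⊑M m′ × GoodMode (suc k) D l m′ × RC σ m′ u w
      extC {l} (gat {d} {M = M} g) (hd v) e o with trans e (state-at σ l M)
      ... | refl =
        let M′ , w , M⊑ , g′ , r = extV g v (trans (cong (λ κ → ok κ v) (sym (kind-bit σ l d))) o) in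
        at M′ , hd w , at M⊑ , gat g′ , atH r
      extC {l} (gat {M = M} g) (tl u) e o = at M , tl u , at ⊑-refl , gat (GoodM-weaken p g) , atT
      extC {l} (gsk {m = m} g) (hd v) e o = skip m , hd v , skip ⊑M-refl , gsk (GoodMode-weaken p g) , skH
        where
        ⊑M-refl : ∀ {ts} {m : Mode ts} → m ⊑M m
        ⊑M-refl {m = at _}   = at ⊑-refl
        ⊑M-refl {m = skip _} = skip ⊑M-refl
      extC {l} (gsk {d} {m = m} g) (tl u) e o with trans e (state-skip {d} σ l m)
      ... | refl =
        let m′ , w , m⊑ , g′ , r = extC g u refl o in
        skip m′ , tl w , skip m⊑ , gsk g′ , skT r

-- Transfer of sentences along Duplicator's strategy

Emb-++⁻ : ∀ F {F′ S} → Emb (F ++ F′) S → Emb F S × Emb F′ S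
Emb-++⁻ []             e           = [] , e
Emb-++⁻ (node _ _ ∷ F) (emb p e q) = let a , b = Emb-++⁻ F q in emb p e a , b

module Preservation (n : ℕ) (t : Tree) where
  open Units n
  open Structure t
  open Duplicator n
  open Strategy n

  data RW (σ : Γ) (M : Match t) : W → W → Set where
    rj : RW σ M junk junk
    rl : ∀ {x} → RW σ M (lbl x) (lbl x)
    ru : ∀ {v w} → RV σ M v w → RW σ M (unit v) (unit w)

  RW-sym : ∀ {σ M a b} → RW σ M a b → RW (fl σ) M b a
  RW-sym rj     = rj
  RW-sym rl     = rl
  RW-sym (ru r) = ru (RV-sym r)

  RW-mono : ∀ {σ M M′ a b} → M ⊑ M′ → RW σ M a b → RW σ M′ a b
  RW-mono g rj     = rj
  RW-mono g rl     = rl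
  RW-mono g (ru r) = ru (RV-mono g r)

  RW-e : ∀ {k S κ σ M a b a′ b′} → GoodM k S κ M → RW σ M a b → RW σ M a′ b′ → e a a′ ≡ e b b′
  RW-e g rj _  = refl
  RW-e g rl rj = refl
  RW-e g rl rl = refl
  RW-e g (rl {base _ d p}) (ru r) = cong (λ b → if b then false else is∀ (bl d p)) (RV-self r)
  RW-e g (ru r) rj = refl
  RW-e g (ru r) (rl {base _ d p}) =
    cong₂ (λ b u → if b then isHere p else sgn (kids u) d p) (RV-self r) (RV-sort r)
  RW-e g (ru {v} {w} r) (ru {v′} {w′} r′) =
    trans (cong (λ b → if b then (if isSelf v′ then true else eV v v′) else eV v v′) (RV-self r))
          (cong₂ (λ b c → if isSelf w then (if b then true else c) else c) (RV-self r′) (RV-e g r r′))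

  RW-fun : ∀ {k S κ σ M a b b′} → GoodM k S κ M → RW σ M a b → RW σ M a b′ → b ≡ b′
  RW-fun g rj     rj      = refl
  RW-fun g rl     rl      = refl
  RW-fun g (ru r) (ru r′) = cong unit (RV-fun g r r′)

  RW-≡ : ∀ {k S κ σ M a b a′ b′} → GoodM k S κ M → RW σ M a b → RW σ M a′ b′ → a ≡ a′ → b ≡ b′
  RW-≡ g r r′ refl = RW-fun g r r′

  answer : ∀ {k S σ D M} → GoodM k S deviants M → k ≤ suc n → Sub S σ D → (a : Dom (G σ)) →
           Σ (Match t) λ M′ → M ⊑ M′ × GoodM (suc k) D deviants M′ ×
           Σ (Dom (G (fl σ))) λ b → RW σ M′ (view σ a) (view (fl σ) b)
  answer {σ = σ} {M = M} g k≤ p a with view σ a | view-valid σ a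
  ... | junk | _ = M , ⊑-refl , GoodM-weaken p g , zero , rj
  ... | lbl x | _ with view-onto (fl σ) (lbl x) refl
  ...   | b , q = M , ⊑-refl , GoodM-weaken p g , b , subst (RW σ M (lbl x)) (sym q) rl
  answer {σ = σ} {M = M} g k≤ p a | unit v | o with extV k≤ p g v o
  ... | M′ , w , M⊑ , g′ , r with view-onto (fl σ) (unit w) (RV-ok g′ r o)
  ...   | b , q = M′ , M⊑ , g′ , b , subst (RW σ M′ (unit v)) (sym q) (ru r)

  -- The formula steers the game: each quantifier is a move at the node of `S` to which it is
  -- embedded. A universal quantifier is a pick on the side `∀ₗ`, so its pair is turned round by
  -- `RW-sym`.
  preserve : ∀ {m k S M} (φ : Formula m) {ρ : Fin m → Dom (G ∃ₗ)} {ρ′ : Fin m → Dom (G ∀ₗ)} →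
             GoodM k S deviants M → k + heightF S ≤ suc n → Emb (qs φ) S →
             (∀ i → RW ∃ₗ M (view ∃ₗ (ρ i)) (view ∀ₗ (ρ′ i))) → Sat (G ∃ₗ) ρ φ → Sat (G ∀ₗ) ρ′ φ
  preserve (E≈ x y)  g _ _ r h = trans (sym (RW-e g (r x) (r y))) h
  preserve (¬E≈ x y) g _ _ r h = λ q → h (trans (RW-e g (r x) (r y)) q)
  preserve (eq x y)  g _ _ r h = view-injective ∀ₗ (RW-≡ g (r x) (r y) (cong (view ∃ₗ) h))
  preserve (¬eq x y) g _ _ r h =
    λ q → h (view-injective ∃ₗ (RW-≡ g (RW-sym (r x)) (RW-sym (r y)) (cong (view ∀ₗ) q)))
  preserve tt g _ _ r h = h
  preserve (φ ∧ ψ) g k≤ em r (h , h′) =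
    let a , b = Emb-++⁻ (qs φ) em in preserve φ g k≤ a r h , preserve ψ g k≤ b r h′
  preserve (φ ∨ ψ) g k≤ em r (inj₁ h) = inj₁ (preserve φ g k≤ (proj₁ (Emb-++⁻ (qs φ) em)) r h)
  preserve (φ ∨ ψ) g k≤ em r (inj₂ h) = inj₂ (preserve ψ g k≤ (proj₂ (Emb-++⁻ (qs φ) em)) r h)
  preserve {k = k} {S} (∃′ φ) {ρ} {ρ′} g k≤ (emb {D = D} p em []) r (a , h)
    with answer g (Nat.≤-trans (Nat.m≤m+n k _) k≤) p a
  ... | M′ , M⊑ , g′ , b , rab = b , preserve φ g′ (Nat.≤-trans (Sub-rounds k p) k≤) em
          (λ { zero → rab ; (suc i) → RW-mono M⊑ (r i) }) h
  preserve {k = k} {S} (∀′ φ) {ρ} {ρ′} g k≤ (emb {D = D} p em []) r h b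
    with answer g (Nat.≤-trans (Nat.m≤m+n k _) k≤) p b
  ... | M′ , M⊑ , g′ , a , rba = preserve φ g′ (Nat.≤-trans (Sub-rounds k p) k≤) em
          (λ { zero → RW-sym rba ; (suc i) → RW-mono M⊑ (r i) }) (h a)

  preserve₀ : ∀ {S} → ¬ Emb (t ∷ []) S → heightF S ≤ suc n → (θ : Sentence) → Emb (qs θ) S → G ∃ₗ ⊨ θ → G ∀ₗ ⊨ θ
  preserve₀ ¬e h≤ θ em = preserve {k = 0} {M = []} θ (good ¬e z≤n [] []) h≤ em λ ()

-- Spoiler's strategy

does-true : ∀ {P : Set} (p : Dec P) → does p ≡ true → P
does-true (yes x) _ = x

same⇒≡ : ∀ {l m} → same l m ≡ true → l ≡ m
same⇒≡ {∃ₗ} {∃ₗ} _ = refl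
same⇒≡ {∀ₗ} {∀ₗ} _ = refl

is∀-injective : ∀ {l m} → is∀ l ≡ is∀ m → l ≡ m
is∀-injective {∃ₗ} {∃ₗ} _ = refl
is∀-injective {∀ₗ} {∀ₗ} _ = refl

any⁻ : ∀ f F → any f F ≡ true → Σ Tree λ d → F ∋ d × f d ≡ true
any⁻ f (d ∷ F) p with f d in q
... | true = d , z , q
... | false with any⁻ f F p
...   | d′ , x , q′ = d′ , s x , q′

any⁺ : ∀ f {F d} → F ∋ d → f d ≡ true → any f F ≡ true
any⁺ f z q rewrite q = refl
any⁺ f (s {e = c} x) q with f c
... | true  = refl
... | false = any⁺ f x q

all⁻ : ∀ f {F d} → all f F ≡ true → F ∋ d → f d ≡ true
all⁻ f p z     = proj₁ (&-true p)
all⁻ f p (s x) = all⁻ f (proj₂ (&-true p)) x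

all⁺ : ∀ f F → (∀ {d} → F ∋ d → f d ≡ true) → all f F ≡ true
all⁺ f []      p = refl
all⁺ f (d ∷ F) p = &-intro (p z) (all⁺ f F (λ x → p (s x)))

all-false : ∀ f F → all f F ≡ false → Σ Tree λ d → F ∋ d × f d ≡ false
all-false f (d ∷ F) p with f d in q
... | false = d , z , q
... | true with all-false f F p
...   | d′ , x , q′ = d′ , s x , q′

-- Equality of trees up to a given depth

eqT-lab : ∀ n {t u} → eqT n t u ≡ true → lab t ≡ lab u
eqT-lab zero    p = same⇒≡ p
eqT-lab (suc n) p = same⇒≡ (proj₁ (&-true p))

eqT-refl : ∀ n t → eqT n t t ≡ true
eqT-refl zero    t = same-refl (lab t)
eqT-refl (suc n) t = &-intro (same-refl (lab t)) (&-intro sub sub)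
  where
  sub : all (λ d → any (eqT n d) (kids t)) (kids t) ≡ true
  sub = all⁺ _ (kids t) λ {d} x → any⁺ (eqT n d) x (eqT-refl n d)

eqT-sym⇒ : ∀ n {t u} → eqT n t u ≡ true → eqT n u t ≡ true
eqT-sym⇒ zero    {t} {u} p = trans (cong (λ l → same l (lab t)) (sym (same⇒≡ {lab t} p))) (same-refl (lab t))
eqT-sym⇒ (suc n) {t} {u} p with &-true p
... | q , r with &-true {all (λ d → any (eqT n d) (kids u)) (kids t)} r
...   | a , b = &-intro (trans (cong (λ l → same l (lab t)) (sym (same⇒≡ {lab t} q))) (same-refl (lab t))) (&-intro b a)

eqT-trans : ∀ n {t u v} → eqT n t u ≡ true → eqT n u v ≡ true → eqT n t v ≡ true
eqT-trans zero {t} {u} p q = trans (cong (λ l → same l _) (same⇒≡ {lab t} p)) q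
eqT-trans (suc n) {t} {u} {v} p q with &-true p | &-true q
... | p₀ , p′ | q₀ , q′ with &-true p′ | &-true q′
...   | p₁ , p₂ | q₁ , q₂ = &-intro (trans (cong (λ l → same l _) (same⇒≡ {lab t} p₀)) q₀)
        (&-intro (sub {t} {u} {v} p₁ q₁) (sub {v} {u} {t} q₂ p₂))
  where
  sub : ∀ {t u v} → all (λ d → any (eqT n d) (kids u)) (kids t) ≡ true →
        all (λ d → any (eqT n d) (kids v)) (kids u) ≡ true → all (λ d → any (eqT n d) (kids v)) (kids t) ≡ true
  sub {t} {u} {v} a b = all⁺ _ (kids t) λ {d} x →
    let d′ , x′ , p = any⁻ (eqT n d) (kids u) (all⁻ _ a x)
        d″ , x″ , q = any⁻ (eqT n d′) (kids v) (all⁻ _ b x′)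
    in any⁺ (eqT n d) x″ (eqT-trans n p q)

eqT-sym : ∀ n t u → eqT n t u ≡ eqT n u t
eqT-sym n t u = Bool.⇔→≡ {z = true} (mk⇔ (eqT-sym⇒ n) (eqT-sym⇒ n))

mem-cong : ∀ n {g g′} C → eqT n g g′ ≡ true → mem n g C ≡ mem n g′ C
mem-cong n C p = Bool.⇔→≡ {z = true} (mk⇔ (move p) (move (eqT-sym⇒ n p)))
  where
  move : ∀ {g g′} → eqT n g g′ ≡ true → mem n g C ≡ true → mem n g′ C ≡ true
  move {g} {g′} p q = let c , x , r = any⁻ (eqT n g) C q in any⁺ (eqT n g′) x (eqT-trans n (eqT-sym⇒ n p) r)

mem-∋ : ∀ n {C d} → C ∋ d → mem n d C ≡ true
mem-∋ n {d = d} x = any⁺ (eqT n d) x (eqT-refl n d)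

∋-Sub : ∀ {F d} → F ∋ d → Sub F (lab d) (kids d)
∋-Sub {node _ _ ∷ _} z     = top
∋-Sub (s x) = nxt (∋-Sub x)

∋-height : ∀ {F d} → F ∋ d → suc (heightF (kids d)) ≤ heightF F
∋-height x = Sub-height (∋-Sub x)

Emb-tree : ∀ {d c} → lab d ≡ lab c → Emb (kids d) (kids c) → Emb (d ∷ []) (c ∷ [])
Emb-tree {node _ _} {node _ _} refl e = emb top e []

-- Depth `n` exhausts `d`, while `c` may be higher. Reading children as sets is harmless because
-- embeddings may identify siblings.
eqT⇒Emb : ∀ n {d c} → heightF (kids d) ≤ n → eqT n d c ≡ true → Emb (d ∷ []) (c ∷ [])
eqT⇒Emb zero    {node l []} {c} _ p = Emb-tree {node l []} {c} (same⇒≡ p) []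
eqT⇒Emb zero    {node l (node _ _ ∷ F)} q p with Nat.≤-trans (Nat.m≤m⊔n _ (heightF F)) q
... | ()
eqT⇒Emb (suc n) {d} {c} q p with &-true {same (lab d) (lab c)} p
... | p₀ , p′ = Emb-tree {d} {c} (same⇒≡ p₀) (∀Emb λ {b} x →
  let b′ , x′ , r = any⁻ (eqT n b) (kids c) (all⁻ _ (proj₁ (&-true p′)) x)
  in Emb-trans (eqT⇒Emb n (Nat.≤-pred (Nat.≤-trans (∋-height x) q)) r) (∋-Emb x′))

mem⇒Emb : ∀ n {d C} → heightF (kids d) ≤ n → mem n d C ≡ true → Emb (d ∷ []) C
mem⇒Emb n {d} {C} q p = let c , x , r = any⁻ (eqT n d) C p in Emb-trans (eqT⇒Emb n q r) (∋-Emb x)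

tallest : ∀ F {k} → suc k ≤ heightF F → Σ Tree λ d → F ∋ d × k ≤ heightF (kids d)
tallest (node l D ∷ F) {k} p with Nat.≤-total (suc (heightF D)) (heightF F)
... | inj₂ q = node l D , z , Nat.≤-pred (subst (suc k ≤_) (Nat.m≥n⇒m⊔n≡m q) p)
... | inj₁ q = let d , x , r = tallest F (subst (suc k ≤_) (Nat.m≤n⇒m⊔n≡n q) p) in d , s x , r

eqT-differ : ∀ n {g g′} → lab g ≡ lab g′ → eqT (suc n) g g′ ≡ false →
             Σ Tree λ c → (kids g ∋ c ⊎ kids g′ ∋ c) × mem n c (kids g) ≢ mem n c (kids g′)
eqT-differ n {g} {g′} l≡ p with same (lab g) (lab g′) in q
... | false = ⊥-elim (true≢false (trans (sym (same-refl (lab g′))) (trans (cong (λ l → same l (lab g′)) (sym l≡)) q)))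
... | true with all (λ d → any (eqT n d) (kids g′)) (kids g) in a
...   | false = let d , x , r = all-false _ (kids g) a in
                d , inj₁ x , λ m → true≢false (trans (sym (mem-∋ n x)) (trans m r))
...   | true  = let d , x , r = all-false _ (kids g′) p in
                d , inj₂ x , λ m → true≢false (trans (sym (mem-∋ n x)) (trans (sym m) r))

mutual
  subtrees-kids : ∀ t {u c} → u ∈ subtrees t → kids u ∋ c → c ∈ subtrees t
  subtrees-kids (node l ts) (here refl) x = there (∋-subtrees x)
  subtrees-kids (node l ts) (there m)   x = there (subtreesF-kids ts m x)

  subtreesF-kids : ∀ F {u c} → u ∈ subtreesF F → kids u ∋ c → c ∈ subtreesF F
  subtreesF-kids (t ∷ F) m x with ∈-++⁻ (subtrees t) m
  ... | inj₁ m′ = ∈-++⁺ˡ (subtrees-kids t m′ x)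
  ... | inj₂ m′ = ∈-++⁺ʳ (subtrees t) (subtreesF-kids F m′ x)

  ∋-subtrees : ∀ {F c} → F ∋ c → c ∈ subtreesF F
  ∋-subtrees {node l ts ∷ F} z     = here refl
  ∋-subtrees {t ∷ F}         (s x) = ∈-++⁺ʳ (subtrees t) (∋-subtrees x)

-- Positions won by Duplicator, used from Spoiler's side

module Plays (n : ℕ) (t : Tree) where
  open Units n
  open Structure t
  open Game e G view (λ _ _ _ → refl) view-injective public

  ext-pick : ∀ {m} l (ρ : Env m) a b → ext l ρ a b l ≡ extend (ρ l) a
  ext-pick ∃ₗ ρ a b = refl
  ext-pick ∀ₗ ρ a b = refl

  ext-reply : ∀ {m} l (ρ : Env m) a b → ext l ρ a b (fl l) ≡ extend (ρ (fl l)) b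
  ext-reply ∃ₗ ρ a b = refl
  ext-reply ∀ₗ ρ a b = refl

  ext-old : ∀ {m} l (ρ : Env m) a b σ i → ext l ρ a b σ (suc i) ≡ ρ σ i
  ext-old ∃ₗ ρ a b ∃ₗ i = refl
  ext-old ∃ₗ ρ a b ∀ₗ i = refl
  ext-old ∀ₗ ρ a b ∃ₗ i = refl
  ext-old ∀ₗ ρ a b ∀ₗ i = refl

  data Pair {m} (ρ : Env m) (σ : Γ) (a b : W) : Set where
    pair : ∀ i → ρ σ i ≡ a → ρ (fl σ) i ≡ b → Pair ρ σ a b

  Pair-swap : ∀ {m σ a b} {ρ : Env m} → Pair ρ σ a b → Pair ρ (fl σ) b a
  Pair-swap {σ = ∃ₗ} (pair i p q) = pair i q p
  Pair-swap {σ = ∀ₗ} (pair i p q) = pair i q p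

  Pair-e : ∀ {m C σ a b a′ b′} {ρ : Env m} → Dup C ρ → Pair ρ σ a b → Pair ρ σ a′ b′ → e b b′ ≡ e a a′
  Pair-e {C = C} D (pair i refl refl) (pair j refl refl) = sym (proj₁ (Dup-atoms C D) _ i j)

  Pair-≡ : ∀ {m C σ a a′ b} {ρ : Env m} → Dup C ρ → Pair ρ σ a b → Pair ρ σ a′ b → a ≡ a′
  Pair-≡ {C = C} {∃ₗ} D (pair i refl refl) (pair j refl q) = proj₂ (Dup-atoms C D) ∀ₗ i j (sym q)
  Pair-≡ {C = C} {∀ₗ} D (pair i refl refl) (pair j refl q) = proj₂ (Dup-atoms C D) ∃ₗ i j (sym q)

  record Reply {m} (ρ : Env m) (d : Tree) (a : W) : Set where
    constructor answer
    field
      reply : W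
      env   : Env (suc m)
      isOk  : valid (fl (lab d)) reply ≡ true
      play  : Dup (kids d) env
      new   : Pair env (lab d) a reply
      old   : ∀ {σ x y} → Pair ρ σ x y → Pair env σ x y

  pick : ∀ {m C d} {ρ : Env m} → Dup C ρ → C ∋ d → ∀ a → valid (lab d) a ≡ true → Reply ρ d a
  pick {d = d} {ρ} D x a v with view-onto (lab d) a v
  ... | i , refl with Dup-∋ D x i
  ...   | j , D′ = record
    { reply = view (fl (lab d)) j
    ; env   = ext (lab d) ρ (view _ i) (view _ j)
    ; isOk  = view-valid (fl (lab d)) j
    ; play  = D′
    ; new   = pair zero (cong (λ f → f zero) (ext-pick (lab d) ρ _ _)) (cong (λ f → f zero) (ext-reply (lab d) ρ _ _))
    ; old   = λ { (pair k refl refl) → pair (suc k) (ext-old (lab d) ρ _ _ _ k) (ext-old (lab d) ρ _ _ _ k) }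
    }

-- Refuting an answer of the wrong sort

module Reading (n : ℕ) (t : Tree) where
  open Units n
  open Structure t
  open Plays n t public

  -- A name with a hole: the part read so far, its latest tree outermost, with `a` levels still to
  -- come.
  data Trail (k : ℕ) : ℕ → Set where
    nil  : Trail k k
    snoc : ∀ {a} → Trail k (suc a) → Ix → Trail k a

  plugL : ∀ {k a} → Trail k a → Lb a → Lb k
  plugL nil        p = p
  plugL (snoc π g) p = plugL π (nt g p)

  last : ∀ {k a} → Ix → Trail k a → Ix
  last d nil        = d
  last d (snoc π g) = g

  ctx : ∀ {k a} → Forest → Ix → Trail k a → Forest
  ctx C d nil        = C
  ctx C d (snoc π g) = kids (tr (last d π))

  sgn-plug : ∀ {k a} C d (π : Trail k a) p → sgn C d (plugL π p) ≡ sgn (ctx C d π) (last d π) p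
  sgn-plug C d nil        p = refl
  sgn-plug C d (snoc π g) p = sgn-plug C d π (nt g p)

  bl-plug : ∀ {k a} d (π : Trail k a) p → bl d (plugL π p) ≡ bl (last d π) p
  bl-plug d nil        p = refl
  bl-plug d (snoc π g) p = bl-plug d π (nt g p)

  does-refl : ∀ {m} (i : Fin m) → does (i Fin.≟ i) ≡ true
  does-refl i = dec-true (i Fin.≟ i) refl

  does⇒≡ : ∀ {m} {i j : Fin m} → does (i Fin.≟ j) ≡ true → i ≡ j
  does⇒≡ = does-true (_ Fin.≟ _)

  bE-plug : ∀ {k a} (π : Trail k a) p q → bE (plugL π p) (plugL π q) ≡ bE p q
  bE-plug nil        p q = refl
  bE-plug (snoc π g) p q = trans (bE-plug π (nt g p) (nt g q)) (cong (_& bE p q) (does-refl g))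

  bE-out : ∀ {k a} (π : Trail k a) p q → bE (plugL π p) q ≡ true → Σ (Lb a) λ r → q ≡ plugL π r × bE p r ≡ true
  bE-out nil p q r = q , refl , r
  bE-out (snoc π g) p q r with bE-out π (nt g p) q r
  ... | nt g′ q′ , refl , x with &-true {does (g Fin.≟ g′)} x
  ...   | y , w with does⇒≡ {i = g} {g′} y
  ...     | refl = q′ , refl , w

  data IsParent {k} : ∀ {a} → Lb k → Trail k a → Lb a → Set where
    parent : ∀ {a} {π : Trail k (suc a)} {g} → IsParent (plugL π here) (snoc π g) here

  bE-in : ∀ {k a} (π : Trail k a) p q → bE q (plugL π p) ≡ true →
          (Σ (Lb a) λ r → q ≡ plugL π r × bE r p ≡ true) ⊎ IsParent q π p
  bE-in nil p q r = inj₁ (q , refl , r)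
  bE-in (snoc π g) p q r with bE-in π (nt g p) q r
  bE-in (snoc π g) here q r | inj₁ (here , refl , x) = inj₂ parent
  ... | inj₁ (nt g′ q′ , refl , x) with &-true {does (g′ Fin.≟ g)} x
  ...   | y , w with does⇒≡ {i = g′} {g} y
  ...     | refl = inj₁ (q′ , refl , w)

  bE-refl : ∀ {a} (p : Lb a) → bE p p ≡ true
  bE-refl here     = refl
  bE-refl (tm b i) = &-intro (same-refl b) (cong (_∥ does (next i Fin.≟ i)) (does-refl i))
  bE-refl (nt g p) = &-intro (does-refl g) (bE-refl p)

  lE-same : ∀ r d (p q : Lb (toℕ r)) → lE (base r d p) (base r d q) ≡ bE p q
  lE-same r d p q with r Fin.≟ r
  ... | yes refl = cong (_& bE p q) (does-refl d)
  ... | no ¬p = ⊥-elim (¬p refl)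

  lE-inv : ∀ r d p {x} → lE (base r d p) x ≡ true → Σ (Lb (toℕ r)) λ q → x ≡ base r d q × bE p q ≡ true
  lE-inv r d p {base r′ d′ q} y with r Fin.≟ r′
  ... | yes refl with &-true {does (d Fin.≟ d′)} y
  ...   | a , b with does⇒≡ {i = d} {d′} a
  ...     | refl = q , refl , b

  lE-inv′ : ∀ r d p {x} → lE x (base r d p) ≡ true → Σ (Lb (toℕ r)) λ q → x ≡ base r d q × bE q p ≡ true
  lE-inv′ r d p {base r′ d′ q} y with r′ Fin.≟ r
  ... | yes refl with &-true {does (d′ Fin.≟ d)} y
  ...   | a , b with does⇒≡ {i = d′} {d} a
  ...     | refl = q , refl , b

  vtx : ∀ (r : Fin h) (d : Ix) {a} → Trail (toℕ r) a → Lb a → W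
  vtx r d π p = lbl (base r d (plugL π p))

  e-vtx : ∀ r d {a} (π : Trail (toℕ r) a) p q → e (vtx r d π p) (vtx r d π q) ≡ bE p q
  e-vtx r d π p q = trans (lE-same r d _ _) (bE-plug π p q)

  eV-irrefl : ∀ {c} (v : Vtx c) → eV v v ≡ false
  eV-irrefl (mk {l} τ i p) = trans (cong (does ((τ , i) ≟I (τ , i)) &_) (eL-irrefl l p)) (Bool.∧-zeroʳ _)
    where
    mutual
      eC-irrefl : ∀ {ts} (u : Ch ts) → eC u u ≡ false
      eC-irrefl (hd v) = eV-irrefl v
      eC-irrefl (tl u) = eC-irrefl u

      eL-irrefl : ∀ {ts} l (p : Loc ts) → eL l p p ≡ false
      eL-irrefl l (self x) with x ≟X x
      ... | yes _ = refl
      ... | no ¬p = ⊥-elim (¬p refl)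
      eL-irrefl l (below u) = eC-irrefl u

  data IsRootUnit : W → Set where
    root : ∀ {v} → isSelf v ≡ true → IsRootUnit (unit v)

  loop : ∀ w → e w w ≡ true → IsRootUnit w ⊎ Σ Lab λ x → w ≡ lbl x
  loop (lbl x) p = inj₂ (x , refl)
  loop (unit v) p with isSelf v in q
  ... | true  = inj₁ (root q)
  ... | false = ⊥-elim (true≢false (trans (sym p) (eV-irrefl v)))

  root-root : ∀ {w w′} → IsRootUnit w → IsRootUnit w′ → e w w′ ≡ true
  root-root (root p) (root q) rewrite p | q = refl

  label-root : ∀ {w} x → IsRootUnit w → e (lbl x) w ≡ false
  label-root (base _ _ _) (root p) rewrite p = refl

  root-label : ∀ {w} r d p → IsRootUnit w → e w (lbl (base r d p)) ≡ isHere p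
  root-label r d p (root q) rewrite q = refl

  isHere-plug : ∀ {k a} (π : Trail k (suc a)) g p → isHere (plugL π (nt g p)) ≡ false
  isHere-plug nil        g p = refl
  isHere-plug (snoc π _) g p = isHere-plug π _ _

  -- The vertex from which the current label was reached, kept to recognise end marks: among the
  -- looped vertices with an edge to the current label, those that are not end marks receive an edge
  -- from `w`, the end marks do not.
  data Above (r : Fin h) (d : Ix) : ∀ {a} → W → Trail (toℕ r) a → Set where
    root  : ∀ {w} → IsRootUnit w → Above r d w nil
    label : ∀ {a} {π : Trail (toℕ r) (suc a)} {g} → Above r d (vtx r d π here) (snoc π g)

  bE-child : ∀ {a} g (q : Lb a) → bE here (nt g q) ≡ isHere q
  bE-child g here     = refl
  bE-child g (tm b i) = refl
  bE-child g (nt _ q) = refl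

  above-e : ∀ {r d w a} {π : Trail (toℕ r) a} q → Above r d w π → e w (vtx r d π q) ≡ isHere q
  above-e {r} {d} q (root x) = root-label r d q x
  above-e {r} {d} q (label {π = π} {g}) = trans (e-vtx r d π here (nt g q)) (bE-child g q)

  above-in : ∀ {r d w a} {π : Trail (toℕ r) a} y → Above r d w π → e y y ≡ true → e y (vtx r d π here) ≡ true →
             e w y ≡ true ⊎ Σ (Lb a) λ q → y ≡ vtx r d π q × bE q here ≡ true
  above-in {r} {d} {π = π} y A l p with loop y l
  above-in y (root x) l p | inj₁ q = inj₁ (root-root x q)
  above-in {r} {d} y (label {π = π} {g}) l p | inj₁ q =
    ⊥-elim (true≢false (trans (sym p) (trans (root-label r d _ q) (isHere-plug π g here))))
  above-in {r} {d} {π = π} y A l p | inj₂ (x , refl) with lE-inv′ r d _ {x} p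
  ... | q , refl , a with bE-in π here q a
  ...   | inj₁ (q′ , refl , b) = inj₂ (q′ , refl , b)
  above-in {r} {d} y (label {π = π}) l p | inj₂ (x , refl) | q , refl , a | inj₂ parent = inj₁ (e-vtx r d π here here)

  above-out : ∀ {r d a} {π : Trail (toℕ r) a} y → e y y ≡ true → e (vtx r d π here) y ≡ true →
              Σ (Lb a) λ q → y ≡ vtx r d π q × bE here q ≡ true
  above-out {r} {d} {π = π} y l p with loop y l
  ... | inj₁ q = ⊥-elim (true≢false (trans (sym p) (label-root _ q)))
  ... | inj₂ (x , refl) with lE-inv r d _ {x} p
  ...   | q , refl , a with bE-out π here q a
  ...     | q′ , refl , b = q′ , refl , b

  data IsInner : W → Set where
    inner : ∀ {v} → isSelf v ≡ false → IsInner (unit v)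

  kidsW : W → Forest
  kidsW (unit v) = kids (sort v)
  kidsW _        = []

  inner-sgn : ∀ {w} r d p → IsInner w → e w (lbl (base r d p)) ≡ sgn (kidsW w) d p
  inner-sgn r d p (inner q) rewrite q = refl

  inner-bl : ∀ {w} r d p → IsInner w → e (lbl (base r d p)) w ≡ is∀ (bl d p)
  inner-bl r d p (inner q) rewrite q = refl

  vtx-sgn : ∀ {w} r d {a} (π : Trail (toℕ r) a) q → IsInner w →
            e w (vtx r d π q) ≡ sgn (ctx (kidsW w) d π) (last d π) q
  vtx-sgn {w} r d π q u = trans (inner-sgn r d _ u) (sgn-plug (kidsW w) d π q)

  vtx-bl : ∀ {w} r d {a} (π : Trail (toℕ r) a) q → IsInner w → e (vtx r d π q) w ≡ is∀ (bl (last d π) q)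
  vtx-bl r d π q u = trans (inner-bl r d _ u) (cong is∀ (bl-plug d π q))

  tree : ∀ {r : Fin h} {a} → Ix → Trail (toℕ r) a → Tree
  tree d π = tr (last d π)

  -- Two names are read in parallel, as seen from the inner units `y` and `y′`. With equally many
  -- levels left, their current trees must differ within the remaining depth; a difference in length
  -- is an advantage in itself.
  record State {m} (ρ : Env m) (σ : Γ) (a a′ : ℕ) : Set where
    field
      {r r′} : Fin h
      {d d′} : Ix
      π  : Trail (toℕ r) a
      π′ : Trail (toℕ r′) a′
      {y y′ w w′} : W
      y-inner  : IsInner y
      y′-inner : IsInner y′
      y-pair  : Pair ρ σ y y′
      x-pair  : Pair ρ σ (vtx r d π here) (vtx r′ d′ π′ here)
      w-pair  : Pair ρ σ w w′
      w-above  : Above r d w π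
      w′-above : Above r′ d′ w′ π′
      lab≡ : lab (tree {r} d π) ≡ lab (tree {r′} d′ π′)
      differ : a ≡ a′ → eqT (suc a) (tree {r} d π) (tree {r′} d′ π′) ≡ false

  State-swap : ∀ {m σ a a′} {ρ : Env m} → State ρ σ a a′ → State ρ (fl σ) a′ a
  State-swap {a = a} S = record
    { π = π′ ; π′ = π ; y-inner = y′-inner ; y′-inner = y-inner
    ; y-pair = Pair-swap y-pair ; x-pair = Pair-swap x-pair ; w-pair = Pair-swap w-pair
    ; w-above = w′-above ; w′-above = w-above ; lab≡ = sym lab≡
    ; differ = λ { refl → trans (eqT-sym (suc a) (tr (last d′ π′)) (tr (last d π))) (differ refl) } }
    where
    open State S

  subtree-index : ∀ {u} → u ∈ subtrees t → Σ Ix λ i → tr i ≡ u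
  subtree-index m = index m , sym (lookup-index m)

  kid-index : ∀ g {c} → kids (tr g) ∋ c → Σ Ix λ i → tr i ≡ c
  kid-index g x = subtree-index (subtrees-kids t (∈-lookup g) x)

  eqT-differ-index : ∀ k g g′ → lab (tr g) ≡ lab (tr g′) → eqT (suc k) (tr g) (tr g′) ≡ false →
                     Σ Ix λ c → mem k (tr c) (kids (tr g)) ≢ mem k (tr c) (kids (tr g′))
  eqT-differ-index k g g′ p q with eqT-differ k {tr g} {tr g′} p q
  ... | c , inj₁ x , ne with kid-index g x
  ...   | i , refl = i , ne
  eqT-differ-index k g g′ p q | c , inj₂ x , ne with kid-index g′ x
  ...   | i , refl = i , ne

  module _ {m σ a a′} {ρ : Env m} (S : State ρ σ a a′) where
    open State S

    Kept : Env (suc m) → Set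
    Kept ρ′ = ∀ {τ u v} → Pair ρ τ u v → Pair ρ′ τ u v

    reply-in : ∀ {M} {ρ′ : Env (suc m)} {q b} → Dup M ρ′ → Pair ρ′ σ (vtx r d π q) b → Kept ρ′ →
               bE q here ≡ true → bE here q ≡ false → isHere q ≡ false →
               Σ (Lb a′) λ q′ → b ≡ vtx r′ d′ π′ q′ × bE q′ here ≡ true × e (vtx r′ d′ π′ here) b ≡ false
    reply-in {q = q} {b} D new old to from nh
      with above-in b w′-above (trans (Pair-e D new new) (trans (e-vtx r d π q q) (bE-refl q)))
                               (trans (Pair-e D new (old x-pair)) (trans (e-vtx r d π q here) to))
    ... | inj₁ p = ⊥-elim (true≢false (trans (sym p) (trans (Pair-e D (old w-pair) new) (trans (above-e q w-above) nh))))
    ... | inj₂ (q′ , p , to′) = q′ , p , to′ , trans (Pair-e D (old x-pair) new) (trans (e-vtx r d π here q) from)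

    reply-out : ∀ {M} {ρ′ : Env (suc m)} {q b} → Dup M ρ′ → Pair ρ′ σ (vtx r d π q) b → Kept ρ′ →
                bE here q ≡ true → bE q here ≡ false →
                Σ (Lb a′) λ q′ → b ≡ vtx r′ d′ π′ q′ × bE here q′ ≡ true × e b (vtx r′ d′ π′ here) ≡ false
    reply-out {q = q} {b} D new old from to
      with above-out {r′} {d′} {π = π′} b (trans (Pair-e D new new) (trans (e-vtx r d π q q) (bE-refl q)))
                        (trans (Pair-e D (old x-pair) new) (trans (e-vtx r d π here q) from))
    ... | q′ , p , from′ = q′ , p , from′ , trans (Pair-e D new (old x-pair)) (trans (e-vtx r d π q here) to)

    seen-bl : ∀ {M} {ρ′ : Env (suc m)} {q q′} → Dup M ρ′ → Pair ρ′ σ (vtx r d π q) (vtx r′ d′ π′ q′) → Kept ρ′ →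
              bl (last d π) q ≡ bl (last d′ π′) q′
    seen-bl {q = q} {q′} D new old = is∀-injective (trans (sym (vtx-bl r d π q y-inner))
      (trans (sym (Pair-e D new (old y-pair))) (vtx-bl r′ d′ π′ q′ y′-inner)))

    seen-sgn : ∀ {M} {ρ′ : Env (suc m)} {q q′} → Dup M ρ′ → Pair ρ′ σ (vtx r d π q) (vtx r′ d′ π′ q′) → Kept ρ′ →
               sgn (ctx (kidsW y) d π) (last d π) q ≡ sgn (ctx (kidsW y′) d′ π′) (last d′ π′) q′
    seen-sgn {q = q} {q′} D new old = trans (sym (vtx-sgn r d π q y-inner))
      (trans (sym (Pair-e D (old y-pair) new)) (vtx-sgn r′ d′ π′ q′ y′-inner))

    focus-loop : e (vtx r′ d′ π′ here) (vtx r′ d′ π′ here) ≢ false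
    focus-loop p = true≢false (trans (sym (e-vtx r′ d′ π′ here here)) p)

  mutual
    -- One move per level and one at the end of the shorter name suffice. The label of a tallest
    -- tree dictates the side of the next move, so the state must allow either side.
    read : ∀ {m} a a′ {σ M} {ρ : Env m} → State ρ σ a a′ → suc (a ⊓ a′) ≤ heightF M → Dup M ρ → ⊥
    read a a′ {σ} {M} S tall D with tallest M tall
    ... | c , x , q with lab c ≟Γ σ
    ...   | yes refl = readσ a a′ S q x D
    ...   | no ne = readσ a′ a (subst (λ l → State _ l a′ a) (sym (≢⇒fl ne)) (State-swap S))
                          (subst (_≤ heightF (kids c)) (Nat.⊓-comm a a′) q) x D

    readσ : ∀ {m} a a′ {M c} {ρ : Env m} → State ρ (lab c) a a′ → a ⊓ a′ ≤ heightF (kids c) → M ∋ c → Dup M ρ → ⊥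
    readσ zero zero S tall x D = bottom (eqT-differ-index 0 (last d π) (last d′ π′) lab≡ (differ refl))
      where
      open State S
      bottom : (Σ Ix λ c → mem 0 (tr c) (kids (tree {r} d π)) ≢ mem 0 (tr c) (kids (tree {r′} d′ π′))) → ⊥
      -- `mem 0` compares labels only and thus is the `hasRoot` bit that an end mark shows.
      bottom (g , ne) with pick D x (vtx r d π (tm (lab (tr g)) zero)) refl
      ... | answer b _ _ D′ new old with reply-in S D′ new old refl refl refl
      ...   | here , refl , _ , out = focus-loop S out
      ...   | tm l i , refl , _ , _ with seen-bl S D′ new old
      ...     | refl = ne (seen-sgn S D′ new old)
    -- Any end mark will do: a name that goes on has none at this point.
    readσ zero (suc a′) S tall x D with pick D x (vtx (State.r S) (State.d S) (State.π S) (tm ∃ₗ zero)) refl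
    ... | answer b _ _ D′ new old with reply-in S D′ new old refl refl refl
    ...   | here , refl , _ , out = focus-loop S out
    -- Any continuation will do, as a name that ends here has none; the index is arbitrary.
    readσ (suc a) zero S tall x D with pick D x (vtx (State.r S) (State.d S) (State.π S) (nt (State.d S) here)) refl
    ... | answer b _ _ D′ new old with reply-out S D′ new old refl refl
    ...   | here , refl , _ , into = focus-loop S into
    readσ (suc a) (suc a′) S tall x D = descend choose
      where
      open State S
      Choice : Set
      Choice = Σ Ix λ g → a ≡ a′ → mem (suc a) (tr g) (kids (tree {r} d π)) ≢ mem (suc a) (tr g) (kids (tree {r′} d′ π′))

      choose : Choice
      choose with a Nat.≟ a′
      -- With different lengths every continuation is as good as another, so `d` is a default.
      ... | no ne = d , λ p → ⊥-elim (ne p)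
      ... | yes p with eqT-differ-index (suc a) (last d π) (last d′ π′) lab≡ (differ (cong suc p))
      ...   | g , ne = g , λ _ → ne

      descend : Choice → ⊥
      descend (g , ne) with pick D x (vtx r d π (nt g here)) refl
      ... | answer b _ _ D′ new old with reply-out S D′ new old refl refl
      ...   | here , refl , _ , into = focus-loop S into
      ...   | nt g′ here , refl , _ , _ = read a a′ (record
        { π = snoc π g ; π′ = snoc π′ g′ ; y-inner = y-inner ; y′-inner = y′-inner
        ; y-pair = old y-pair ; x-pair = new ; w-pair = old x-pair ; w-above = label ; w′-above = label
        ; lab≡ = seen-bl S D′ new old
        ; differ = λ { refl → Bool.¬-not λ p → ne refl
            (trans (seen-sgn S D′ new old) (sym (mem-cong (suc a) {tr g} {tr g′} (kids (tr (last d′ π′))) p))) } }) tall D′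

  record Sorts {m} (ρ : Env m) (σ : Γ) (C C′ : Forest) : Set where
    field
      {y y′ x x′} : W
      y-inner  : IsInner y
      y′-inner : IsInner y′
      x-root   : IsRootUnit x
      x′-root  : IsRootUnit x′
      y-pair : Pair ρ σ y y′
      x-pair : Pair ρ σ x x′
      kids≡  : kidsW y ≡ C
      kids′≡ : kidsW y′ ≡ C′

  Sorts-swap : ∀ {m σ C C′} {ρ : Env m} → Sorts ρ σ C C′ → Sorts ρ (fl σ) C′ C
  Sorts-swap S = record
    { y-inner = y′-inner ; y′-inner = y-inner ; x-root = x′-root ; x′-root = x-root
    ; y-pair = Pair-swap y-pair ; x-pair = Pair-swap x-pair ; kids≡ = kids′≡ ; kids′≡ = kids≡ }
    where
    open Sorts S

  isHere⇒ : ∀ {a} (p : Lb a) → isHere p ≡ true → p ≡ here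
  isHere⇒ here _ = refl

  reply-base : ∀ {m M C C′ σ r g b} {ρ : Env m} {ρ′ : Env (suc m)} → Sorts ρ σ C C′ →
               Dup M ρ′ → Pair ρ′ σ (lbl (base r g here)) b → (∀ {τ u v} → Pair ρ τ u v → Pair ρ′ τ u v) →
               Σ (Fin h) λ r′ → Σ Ix λ g′ → b ≡ lbl (base r′ g′ here) × lab (tr g) ≡ lab (tr g′) ×
               mem (suc (toℕ r)) (tr g) C ≡ mem (suc (toℕ r′)) (tr g′) C′
  reply-base {r = r} {g} {b} S D new old with loop b (trans (Pair-e D new new) (lE-same r g here here))
  ... | inj₁ u = ⊥-elim (true≢false (trans (sym (root-root u x′-root))
                   (trans (Pair-e D new (old x-pair)) (label-root _ x-root))))
    where
    open Sorts S
  ... | inj₂ (base r′ g′ p , refl) with isHere⇒ p (trans (sym (root-label r′ g′ p (Sorts.x′-root S)))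
          (trans (Pair-e D (old (Sorts.x-pair S)) new) (root-label r g here (Sorts.x-root S))))
  ...   | refl = r′ , g′ , refl ,
          is∀-injective (trans (sym (inner-bl r g here y-inner))
            (trans (sym (Pair-e D new (old y-pair))) (inner-bl r′ g′ here y′-inner))) ,
          trans (cong (mem (suc (toℕ r)) (tr g)) (sym kids≡)) (trans (sym (inner-sgn r g here y-inner))
            (trans (sym (Pair-e D (old y-pair) new)) (trans (inner-sgn r′ g′ here y′-inner)
              (cong (mem (suc (toℕ r′)) (tr g′)) kids′≡))))
    where
    open Sorts S

  name-deep : ∀ {m M C C′ c} {ρ : Env m} (r : Fin h) g → Sorts ρ (lab c) C C′ → M ∋ c → Dup M ρ →
              suc (toℕ r) ≤ heightF (kids c) →
              mem (suc (toℕ r)) (tr g) C ≢ mem (suc (toℕ r)) (tr g) C′ → ⊥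
  name-deep {C′ = C′} r g S x D tall ne with pick D x (lbl (base r g here)) refl
  ... | answer b _ _ D′ new old with reply-base S D′ new old
  ...   | r′ , g′ , refl , l≡ , m≡ = read (toℕ r) (toℕ r′) (record
      { π = nil ; π′ = nil ; y-inner = y-inner ; y′-inner = y′-inner
      ; y-pair = old y-pair ; x-pair = new ; w-pair = old x-pair
      ; w-above = root x-root ; w′-above = root x′-root ; lab≡ = l≡
      ; differ = λ p → Bool.¬-not λ q → ne (trans m≡ (trans (cong (λ k → mem (suc k) (tr g′) C′) (sym p))
                   (sym (mem-cong (suc (toℕ r)) {tr g} {tr g′} C′ q)))) })
      (Nat.≤-trans (s≤s (Nat.m⊓n≤m (toℕ r) (toℕ r′))) tall) D′
    where
    open Sorts S

  -- For the case that no move remains to read a name. The answer names some tree with the right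
  -- label that is a child on its side, and this already fails.
  name-shallow : ∀ {m M C C′ c g} {ρ : Env m} → Fin h → Sorts ρ (lab c) C C′ → M ∋ c → Dup M ρ →
                 C ∋ tr g → (∀ {d} → C′ ∋ d → lab (tr g) ≢ lab d) → ⊥
  name-shallow {C = C} {C′} {g = g} r S x D u ne with pick D x (lbl (base r g here)) refl
  ... | answer b _ _ D′ new old with reply-base S D′ new old
  ...   | r′ , g′ , refl , l≡ , m≡ with any⁻ (eqT (suc (toℕ r′)) (tr g′)) C′ (trans (sym m≡) (mem-∋ (suc (toℕ r)) u))
  ...     | d , v , q = ne v (trans l≡ (eqT-lab (suc (toℕ r′)) {tr g′} {d} q))

  Indexed : Forest → Set
  Indexed C = ∀ {c} → C ∋ c → Σ Ix λ i → tr i ≡ c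

  level : ∀ {k} → k < h → Σ (Fin h) λ r → toℕ r ≡ k
  level p = fromℕ< p , Fin.toℕ-fromℕ< p

  leaf-Emb : ∀ {d C c} → heightF (kids d) ≤ 0 → C ∋ c → lab d ≡ lab c → Emb (d ∷ []) C
  leaf-Emb {d} {c = c} p x q = Emb-trans (eqT⇒Emb 0 p (trans (cong (λ l → same l (lab c)) q) (same-refl (lab c)))) (∋-Emb x)

  -- If `C` has height `r + 2`, a name of depth `r + 1` describes its trees completely, and takes
  -- one move to pick and `r + 1` to read. Height one leaves a single move, whose side may be
  -- forced; that is why both directions of incomparability enter.
  tell-apart : ∀ {m σ C C′} {ρ : Env m} → Sorts ρ σ C C′ → Indexed C → Indexed C′ → heightF C < h →
               ¬ Emb C C′ → ¬ Emb C′ C → Dup C ρ → ⊥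
  tell-apart {σ = σ} {C} {C′} S ix ix′ low ¬e ¬e′ D with ¬Emb-witness C ¬e | heightF C in hC
  ... | d , x , ¬d | zero with subst (suc (heightF (kids d)) ≤_) hC (∋-height x)
  ...   | ()
  tell-apart {σ = σ} {C} {C′} S ix ix′ low ¬e ¬e′ D | d , x , ¬d | suc zero with ix x | hasRoot σ C in hr
  ... | g , refl | true with any⁻ (λ d → same σ (lab d)) C hr
  ...   | c , u , q with same⇒≡ {σ} q
  ...     | refl = name-shallow {g = g} (fromℕ< low) S u D x
                     (λ v l≡ → ¬d (leaf-Emb (Nat.≤-pred (subst (_ ≤_) hC (∋-height x))) v l≡))
  -- No root of `C` is labelled `σ`, so the only move is on the side of `C′`. It needs a tree of
  -- `C′` that `C` lacks; such a tree must carry the label `σ`, since otherwise `d` would embed.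
  tell-apart {σ = σ} {C} {C′} S ix ix′ low ¬e ¬e′ D | d , x , ¬d | suc zero | g , refl | false with ¬Emb-witness C′ ¬e′
  ... | d′ , x′ , _ with ix′ x′
  ...   | g′ , refl = name-shallow {g = g′} (fromℕ< low) (subst (λ l → Sorts _ l C′ C) (sym lab-d) (Sorts-swap S)) x D x′
                        (λ v l≡ → no-σ v (trans (sym l≡) lab-d′))
    where
    no-σ : ∀ {c} → C ∋ c → lab c ≢ σ
    no-σ {c} v refl = true≢false (trans (sym (any⁺ _ v (same-refl (lab c)))) hr)
    lab-d : lab (tr g) ≡ fl σ
    lab-d = ≢⇒fl (no-σ x)
    lab-d′ : lab (tr g′) ≡ σ
    lab-d′ with lab (tr g′) ≟Γ σ
    ... | yes p = p
    ... | no ne = ⊥-elim (¬d (leaf-Emb (Nat.≤-pred (subst (_ ≤_) hC (∋-height x))) x′ (trans lab-d (sym (≢⇒fl ne)))))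
  tell-apart {σ = σ} {C} {C′} S ix ix′ low ¬e ¬e′ D | d , x , ¬d | suc (suc k)
    with tallest C {suc k} (Nat.≤-reflexive (sym hC)) | level (Nat.<-trans (Nat.n<1+n k) (Nat.<-trans (Nat.n<1+n (suc k)) low)) | ix x
  ... | c , u , tall | r , refl | g , refl with lab c ≟Γ σ
  ...   | yes refl = name-deep r g S u D tall differs
    where
    differs : mem (suc (toℕ r)) (tr g) C ≢ mem (suc (toℕ r)) (tr g) C′
    differs p = ¬d (mem⇒Emb (suc (toℕ r)) (Nat.≤-pred (subst (_ ≤_) hC (∋-height x))) (trans (sym p) (mem-∋ (suc (toℕ r)) x)))
  ...   | no ne = name-deep r g (subst (λ l → Sorts _ l C′ C) (sym (≢⇒fl ne)) (Sorts-swap S)) u D tall λ p → differs (sym p)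
    where
    differs : mem (suc (toℕ r)) (tr g) C ≢ mem (suc (toℕ r)) (tr g) C′
    differs p = ¬d (mem⇒Emb (suc (toℕ r)) (Nat.≤-pred (subst (_ ≤_) hC (∋-height x))) (trans (sym p) (mem-∋ (suc (toℕ r)) x)))

mutual
  Tree-rec : ∀ {P : Tree → Set} → (∀ {l ts} → (∀ {d} → ts ∋ d → P d) → P (node l ts)) → ∀ c → P c
  Tree-rec f (node l ts) = f (Forest-rec f ts)

  Forest-rec : ∀ {P : Tree → Set} → (∀ {l ts} → (∀ {d} → ts ∋ d → P d) → P (node l ts)) → ∀ F {d} → F ∋ d → P d
  Forest-rec f (t ∷ F) z     = Tree-rec f t
  Forest-rec f (t ∷ F) (s x) = Forest-rec f F x

data Compare {F} : ∀ {d e} → F ∋ d → F ∋ e → Set where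
  equal  : ∀ {d} {x : F ∋ d} → Compare x x
  differ : ∀ {d e} {x : F ∋ d} {y : F ∋ e} → x ≢∋ y → Compare x y

compare : ∀ {F d e} (x : F ∋ d) (y : F ∋ e) → Compare x y
compare z     z     = equal
compare z     (s y) = differ zs
compare (s x) z     = differ sz
compare (s x) (s y) with compare x y
... | equal    = equal
... | differ p = differ (ss p)

deviant-position : ∀ {ts} (τ : Dv ts) → isFull τ ≡ false → Σ Tree λ d → Σ (ts ∋ d) λ p → All-∋ τ p ≡ true
deviant-position {d ∷ _} (true ∷ τ)  q = d , z , refl
deviant-position (false ∷ τ) q = let d , p , r = deviant-position τ q in d , s p , r

full-∋ : ∀ {ts d} (p : ts ∋ d) → All-∋ (full ts) p ≡ false
full-∋ z     = refl
full-∋ (s p) = full-∋ p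

same-injective : ∀ l {m m′} → same l m ≡ same l m′ → m ≡ m′
same-injective ∃ₗ {∃ₗ} {∃ₗ} _ = refl
same-injective ∃ₗ {∀ₗ} {∀ₗ} _ = refl
same-injective ∀ₗ {∃ₗ} {∃ₗ} _ = refl
same-injective ∀ₗ {∀ₗ} {∀ₗ} _ = refl

-- Addresses of units in nested pools

module Paths (n : ℕ) where
  open Units n

  data Path (r : Tree) : Tree → Set where
    nil  : Path r r
    snoc : ∀ {l ts d} → Path r (node l ts) → Dv ts → K → ts ∋ d → Path r d

  put : ∀ {ts d} → ts ∋ d → Vtx d → Ch ts
  put z     v = hd v
  put (s x) v = tl (put x v)

  plug : ∀ {r c} → Path r c → Vtx c → Vtx r
  plug nil            v = v
  plug (snoc π τ i p) v = plug π (mk τ i (below (put p v)))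

  data Put {ts} : Ch ts → Set where
    at : ∀ {d} (p : ts ∋ d) v → Put (put p v)

  unput : ∀ {ts} (u : Ch ts) → Put u
  unput (hd v) = at z v
  unput (tl u) with unput u
  ... | at p v = at (s p) v

  put-injective : ∀ {ts d} (p : ts ∋ d) {v w} → put p v ≡ put p w → v ≡ w
  put-injective z     refl = refl
  put-injective (s p) e = put-injective p (tl-injective e)
    where
    tl-injective : ∀ {d ds} {u w : Ch ds} → tl {d} u ≡ tl w → u ≡ w
    tl-injective refl = refl

  plug-injective : ∀ {r c} (π : Path r c) {v w} → plug π v ≡ plug π w → v ≡ w
  plug-injective nil            e = e
  plug-injective (snoc π τ i p) e = put-injective p (below-injective (plug-injective π e))
    where
    below-injective : ∀ {l ts τ i} {u w : Ch ts} → mk {l} τ i (below u) ≡ mk τ i (below w) → u ≡ w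
    below-injective refl = refl

  pc-put : ∀ {ts d} l (p : ts ∋ d) v → pc l (put p v) ≡ isSelf v & same l (lab d)
  pc-put l z     v = refl
  pc-put l (s p) v = pc-put l p v

  cp-put : ∀ {ts d} l (p : ts ∋ d) v x →
           cp l (put p v) x ≡ isSelf v & (if same l (lab d) then does (inst v ≟I All-∋ x p) else true)
  cp-put l z     v (_ ∷ x) = refl
  cp-put l (s p) v (_ ∷ x) = cp-put l p v x

  eC-put : ∀ {ts d} (p : ts ∋ d) v w → eC (put p v) (put p w) ≡ eV v w
  eC-put z     v w = refl
  eC-put (s p) v w = eC-put p v w

  eV-mk : ∀ {l ts} (τ : Dv ts) i p q → eV (mk {l} τ i p) (mk τ i q) ≡ eL l p q
  eV-mk {l} τ i p q = cong (_& eL l p q) (dec-true ((τ , i) ≟I (τ , i)) refl)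

  eV-plug : ∀ {r c} (π : Path r c) v w → eV (plug π v) (plug π w) ≡ eV v w
  eV-plug nil            v w = refl
  eV-plug (snoc {l} π τ i p) v w = trans (eV-plug π _ _) (trans (eV-mk {l} τ i (below (put p v)) (below (put p w))) (eC-put p v w))

  isSelf-plug : ∀ {r l ts} (π : Path r (node l ts)) τ i u → isSelf (plug π (mk τ i (below u))) ≡ false
  isSelf-plug nil            τ i u = refl
  isSelf-plug (snoc π τ′ i′ p) τ i u = isSelf-plug π τ′ i′ _

  sort-plug : ∀ {r c} (π : Path r c) v → sort (plug π v) ≡ sort v
  sort-plug nil            v = refl
  sort-plug (snoc π τ i p) v = trans (sort-plug π _) (sortC-put p)
    where
    sortC-put : ∀ {ts d} (p : ts ∋ d) {v} → sortC (put p v) ≡ sort v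
    sortC-put z     = refl
    sortC-put (s p) = sortC-put p

  Adj : ∀ {c} → Vtx c → Vtx c → Set
  Adj v w = eV v w ≡ true ⊎ eV w v ≡ true

  data AdjL {ts} (l : Γ) (p : Loc ts) (τ : Dv ts) (i : K) : Vtx (node l ts) → Set where
    adj : ∀ {q} → eL l p q ≡ true ⊎ eL l q p ≡ true → AdjL l p τ i (mk τ i q)

  Adj-mk : ∀ {l ts τ i p} (w : Vtx (node l ts)) → Adj (mk τ i p) w → AdjL l p τ i w
  Adj-mk {τ = τ} {i} (mk τ′ i′ q) (inj₁ a) with &-true {does ((τ , i) ≟I (τ′ , i′))} a
  ... | a₁ , a₂ with does-true ((τ , i) ≟I (τ′ , i′)) a₁
  ...   | refl = adj (inj₁ a₂)
  Adj-mk {τ = τ} {i} (mk τ′ i′ q) (inj₂ a) with &-true {does ((τ′ , i′) ≟I (τ , i))} a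
  ... | a₁ , a₂ with does-true ((τ′ , i′) ≟I (τ , i)) a₁
  ...   | refl = adj (inj₂ a₂)

  Adj-put : ∀ {ts d} (p : ts ∋ d) {v} u → eC (put p v) u ≡ true ⊎ eC u (put p v) ≡ true → Σ (Vtx d) λ w → u ≡ put p w × Adj v w
  Adj-put z (hd w) a = w , refl , a
  Adj-put z (tl u) (inj₁ ())
  Adj-put z (tl u) (inj₂ ())
  Adj-put (s p) (hd w) (inj₁ ())
  Adj-put (s p) (hd w) (inj₂ ())
  Adj-put (s p) (tl u) a with Adj-put p u a
  ... | w , refl , b = w , refl , b

  data Up {r} : ∀ {c} → Path r c → Vtx r → Set where
    up : ∀ {l ts d} {π : Path r (node l ts)} {τ i} {p : ts ∋ d} x → Up (snoc π τ i p) (plug π (mk τ i (self x)))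

  -- Every edge of `eV` stays within one instance, and the only edges leaving a pool join its own
  -- units to the units of the instance that owns it.
  Adj-plug : ∀ {r c} (π : Path r c) v w → Adj (plug π v) w → (Σ (Vtx c) λ v′ → w ≡ plug π v′ × Adj v v′) ⊎ (isSelf v ≡ true × Up π w)
  Adj-plug nil v w a = inj₁ (w , refl , a)
  Adj-plug (snoc {l} π τ i p) v w a with Adj-plug π (mk τ i (below (put p v))) w a
  ... | inj₁ (v′ , refl , b) with Adj-mk v′ b
  ...   | adj {self x} c = inj₂ (selfish c , up x)
    where
    selfish : cp l (put p v) x ≡ true ⊎ pc l (put p v) ≡ true → isSelf v ≡ true
    selfish (inj₁ y) = proj₁ (&-true (trans (sym (cp-put l p v x)) y))
    selfish (inj₂ y) = proj₁ (&-true (trans (sym (pc-put l p v)) y))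
  ...   | adj {below u} c with Adj-put p u c
  ...     | v″ , refl , d = inj₁ (v″ , refl , d)

  okC-put : ∀ {ts d} l (τ : Dv ts) (p : ts ∋ d) v → okC l τ (put p v) ≡ ok (kind l (lab d) (All-∋ τ p)) v
  okC-put l (b ∷ τ) z     v = refl
  okC-put l (b ∷ τ) (s p) v = okC-put l τ p v

  kindAt : ∀ {r c} → Kind → Path r c → Kind
  kindAt κ nil                        = κ
  kindAt κ (snoc {l} {d = d} π τ i p) = kind l (lab d) (All-∋ τ p)

  OkPath : ∀ {r c} → Kind → Path r c → Set
  OkPath κ nil            = ⊤
  OkPath κ (snoc π τ i p) = OkPath κ π × okI (kindAt κ π) τ i ≡ true

  ok⁻ : ∀ {r c} κ (π : Path r c) v → ok κ (plug π v) ≡ true → OkPath κ π × ok (kindAt κ π) v ≡ true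
  ok⁻ κ nil v q = tt , q
  ok⁻ κ (snoc {l} π τ i p) v q with ok⁻ κ π (mk τ i (below (put p v))) q
  ... | a , b with &-true b
  ...   | c , d = (a , c) , trans (sym (okC-put l τ p v)) d

  ok⁺ : ∀ {r c} κ (π : Path r c) v → OkPath κ π → ok (kindAt κ π) v ≡ true → ok κ (plug π v) ≡ true
  ok⁺ κ nil v _ q = q
  ok⁺ κ (snoc {l} π τ i p) v (a , c) q = ok⁺ κ π _ a (&-intro c (trans (okC-put l τ p v) q))

  -- Copy zero of the full vector lies in every pool of the same label, altered or not, so this
  -- designation is legal for every unit.
  fulls : ∀ ts → All Inst ts
  fulls []       = []
  fulls (d ∷ ts) = (full (kids d) , zero) ∷ fulls ts

  fulls-∋ : ∀ {ts d} (p : ts ∋ d) → All-∋ (fulls ts) p ≡ (full (kids d) , zero)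
  fulls-∋ z     = refl
  fulls-∋ (s p) = fulls-∋ p

  okI-zero : ∀ {ts} l m b (τ : Dv ts) → (if same l m then okI (kind l m b) τ zero else true) ≡ true
  okI-zero ∃ₗ ∃ₗ true  τ = refl
  okI-zero ∃ₗ ∃ₗ false τ = refl
  okI-zero ∃ₗ ∀ₗ b     τ = refl
  okI-zero ∀ₗ ∃ₗ b     τ = refl
  okI-zero ∀ₗ ∀ₗ true  τ = refl
  okI-zero ∀ₗ ∀ₗ false τ = refl

  okD-fulls : ∀ {ts} l (τ : Dv ts) → okD l τ (fulls ts) ≡ true
  okD-fulls l [] = refl
  okD-fulls {d ∷ _} l (b ∷ τ) = &-intro (okI-zero l (lab d) b (full (kids d))) (okD-fulls l τ)

  okD-∋ : ∀ {ts d} l (τ : Dv ts) x (p : ts ∋ d) → okD l τ x ≡ true →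
          (if same l (lab d) then okI (kind l (lab d) (All-∋ τ p)) (proj₁ (All-∋ x p)) (proj₂ (All-∋ x p)) else true) ≡ true
  okD-∋ l (b ∷ τ) (_ ∷ x) z     q = proj₁ (&-true q)
  okD-∋ {d ∷ _} l (b ∷ τ) (I ∷ x) (s p) q =
    okD-∋ l τ x p (proj₂ (&-true {if same l (lab d) then okI (kind l (lab d) b) (proj₁ I) (proj₂ I) else true} q))

  path-subtree : ∀ {r c} → Path r c → c ∈ subtrees r
  path-subtree {node _ _} nil  = here refl
  path-subtree {r} (snoc π _ _ p) = subtrees-kids r (path-subtree π) p

  path-height : ∀ {r c} → Path r c → heightF (kids c) ≤ heightF (kids r)
  path-height nil            = Nat.≤-refl
  path-height (snoc π _ _ p) = Nat.≤-trans (Nat.n≤1+n _) (Nat.≤-trans (∋-height p) (path-height π))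

&-identity : ∀ {a b} → a ≡ true → a & b ≡ b
&-identity refl = refl

&-false : ∀ {a b} → a ≡ false → a & b ≡ false
&-false refl = refl

&-if : ∀ {a b c} → a ≡ true → b ≡ false → a & (if b then c else true) ≡ true
&-if refl refl = refl

-- Spoiler wins the game of `t`

module Spoiler (n : ℕ) (t : Tree) where
  open Units n
  open Structure t
  open Paths n
  open Reading n t

  data Aligned {m} (ρ : Env m) (σ : Γ) : ∀ {c} → Path t c → Path t c → Set where
    nil  : Aligned ρ σ nil nil
    snoc : ∀ {l ts l′ ts′ d} {π : Path t (node l ts)} {π′ : Path t (node l′ ts′)} {τ i τ′ i′ x x′} {p : ts ∋ d} {p′ : ts′ ∋ d} →
           Pair ρ σ (unit (plug π (mk τ i (self x)))) (unit (plug π′ (mk τ′ i′ (self x′)))) →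
           Aligned ρ σ (snoc π τ i p) (snoc π′ τ′ i′ p′)

  Aligned-swap : ∀ {m σ c} {ρ : Env m} {π π′ : Path t c} → Aligned ρ σ π π′ → Aligned ρ (fl σ) π′ π
  Aligned-swap nil      = nil
  Aligned-swap (snoc p) = snoc (Pair-swap p)

  Aligned-old : ∀ {m m′ σ c} {ρ : Env m} {ρ′ : Env m′} {π π′ : Path t c} → (∀ {τ u v} → Pair ρ τ u v → Pair ρ′ τ u v) →
                Aligned ρ σ π π′ → Aligned ρ′ σ π π′
  Aligned-old old nil      = nil
  Aligned-old old (snoc p) = snoc (old p)

  Pair-side : ∀ {m σ σ′ a b} {ρ : Env m} → σ ≡ σ′ → Pair ρ σ a b → Pair ρ σ′ a b
  Pair-side refl p = p

  e-to : ∀ v w → isSelf w ≡ false → e (unit v) (unit w) ≡ eV v w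
  e-to v w q rewrite q with isSelf v
  ... | true  = refl
  ... | false = refl

  e-from : ∀ v w → isSelf v ≡ false → e (unit v) (unit w) ≡ eV v w
  e-from v w q rewrite q = refl

  no-loop : ∀ w → e w w ≡ false → w ≡ junk ⊎ Σ (Vtx t) λ v → w ≡ unit v × isSelf v ≡ false
  no-loop junk p = inj₁ refl
  no-loop (unit v) p with isSelf v in q
  ... | true  = ⊥-elim (true≢false p)
  ... | false = inj₂ (v , refl , q)
  no-loop (lbl (base r d q)) p = ⊥-elim (true≢false (trans (sym (trans (lE-same r d q q) (bE-refl q))) p))

  parent-child : ∀ {l ts d} (π : Path t (node l ts)) τ i x (p : ts ∋ d) v →
                 e (unit (plug π (mk τ i (self x)))) (unit (plug (snoc π τ i p) v)) ≡ isSelf v & same l (lab d)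
  parent-child {l} π τ i x p v = trans (e-to (plug π (mk τ i (self x))) _ (isSelf-plug π τ i (put p v)))
    (trans (eV-plug π (mk τ i (self x)) (mk τ i (below (put p v)))) (trans (eV-mk {l} τ i (self x) (below (put p v))) (pc-put l p v)))

  child-parent : ∀ {l ts d} (π : Path t (node l ts)) τ i x (p : ts ∋ d) v →
                 e (unit (plug (snoc π τ i p) v)) (unit (plug π (mk τ i (self x)))) ≡
                 isSelf v & (if same l (lab d) then does (inst v ≟I All-∋ x p) else true)
  child-parent {l} π τ i x p v = trans (e-from _ (plug π (mk τ i (self x))) (isSelf-plug π τ i (put p v)))
    (trans (eV-plug π (mk τ i (below (put p v))) (mk τ i (self x))) (trans (eV-mk {l} τ i (below (put p v)) (self x)) (cp-put l p v x)))

  -- A grandchild of the parent has no edge with it, whereas a twin of a child has one.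
  no-twin : ∀ {m M σ c} {ρ : Env m} {π π′ : Path t c} {v v′} → Dup M ρ → Aligned ρ σ π π′ →
            Pair ρ σ (unit (plug π v)) (unit (plug π′ v′)) → isSelf v ≡ false → isSelf v′ ≡ true →
            isSelf (plug π′ v′) ≡ false → ⊥
  no-twin D nil new a b c = true≢false (trans (sym b) c)
  no-twin {v = v} {v′} D (snoc {l′ = l′} {d = d} {π} {π′} {τ} {i} {τ′} {i′} {x} {x′} {p} {p′} q) new a b c
    with same l′ (lab d) | parent-child π′ τ′ i′ x′ p′ v′ | child-parent π′ τ′ i′ x′ p′ v′
  ... | true  | f | g = true≢false (trans (sym (trans f (&-identity b)))
                          (trans (Pair-e D q new) (trans (parent-child π τ i x p v) (&-false a))))
  ... | false | f | g = true≢false (trans (sym (trans g (&-identity b)))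
                          (trans (Pair-e D new q) (trans (child-parent π τ i x p v)
                            (&-false a))))

  unit-injective : ∀ {v w} → unit v ≡ unit w → v ≡ w
  unit-injective refl = refl

  -- If `w` is the remembered parent itself, the play would identify a parent with a child of its
  -- child; any other unit `w` of that instance is a twin of the parent and has an edge with it.
  no-up : ∀ {m M σ c} {ρ : Env m} {π π′ : Path t c} {v w} → Dup M ρ → Aligned ρ σ π π′ →
          Pair ρ σ (unit (plug π v)) (unit w) → isSelf v ≡ false → Up π′ w → isSelf w ≡ false → ⊥
  no-up {v = v} D (snoc {l′ = l′} {π = π} {π′} {τ} {i} {τ′} {i′} {x} {x′} {p} q) new a (up y) c with x′ ≟X y
  ... | no ne = true≢false (trans (sym (trans (e-to (plug π′ (mk τ′ i′ (self x′))) _ c) (trans (eV-plug π′ (mk τ′ i′ (self x′)) (mk τ′ i′ (self y)))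
                  (trans (eV-mk {l′} τ′ i′ (self x′) (self y)) (cong not (dec-false (x′ ≟X y) ne))))))
                  (trans (Pair-e D q new) (trans (parent-child π τ i x p v) (&-false a))))
  ... | yes refl with plug-injective π (unit-injective (Pair-≡ D q new))
  ...   | ()

  record ChildReply {m} (ρ : Env m) {l ts} (π : Path t (node l ts)) (τ : Dv ts) (i : K) (x : All Inst ts) (b : W)
                    (α β : Bool) : Set where
    constructor child
    field
      {d} : Tree
      p : ts ∋ d
      v : Vtx d
      b≡ : b ≡ unit (plug (snoc π τ i p) v)
      v-self : isSelf v ≡ true
      pc≡ : same l (lab d) ≡ α
      cp≡ : (if same l (lab d) then does (inst v ≟I All-∋ x p) else true) ≡ β

  -- The missing loop excludes root units and labels, the edge with the unit above excludes `junk`.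
  -- Among the neighbours of that unit, twins and its own parent fall to `no-twin` and `no-up`, and
  -- children remain.
  child-reply : ∀ {m M σ l ts d b} {ρ : Env m} {π π′ : Path t (node l ts)} {τ i x τ′ i′ x′} {p : ts ∋ d} {v} →
    Dup M ρ → Aligned ρ σ π π′ →
    Pair ρ σ (unit (plug π (mk τ i (self x)))) (unit (plug π′ (mk τ′ i′ (self x′)))) →
    Pair ρ σ (unit (plug (snoc π τ i p) v)) b → isSelf v ≡ true →
    ChildReply ρ π′ τ′ i′ x′ b (same l (lab d)) (if same l (lab d) then does (inst v ≟I All-∋ x p) else true)
  child-reply {l = l} {ts} {d} {b} {ρ} {π} {π′} {τ} {i} {x} {τ′} {i′} {x′} {p} {v} D al rr new sv
    with no-loop b (trans (Pair-e D new new) (trans (e-from v₀ v₀ (isSelf-plug π τ i (put p v))) (eV-irrefl v₀)))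
    where
    v₀ : Vtx t
    v₀ = plug (snoc π τ i p) v
  ... | inj₁ refl = ⊥-elim (isolated (same l (lab d)) refl)
    where
    isolated : ∀ α → same l (lab d) ≡ α → ⊥
    isolated true  q = true≢false (trans (sym (trans (parent-child π τ i x p v) (&-intro sv q))) (sym (Pair-e D rr new)))
    isolated false q = true≢false (trans (sym (trans (child-parent π τ i x p v)
      (&-if sv q))) (sym (Pair-e D new rr)))
  ... | inj₂ (w , refl , w-inner) = found (Adj-plug π′ _ w (adjacent (same l (lab d)) refl))
    where
    r′ : Vtx t
    r′ = plug π′ (mk τ′ i′ (self x′))

    adjacent : ∀ α → same l (lab d) ≡ α → Adj r′ w
    adjacent true  q = inj₁ (trans (sym (e-to r′ w w-inner)) (trans (Pair-e D rr new)
      (trans (parent-child π τ i x p v) (&-intro sv q))))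
    adjacent false q = inj₂ (trans (sym (e-from w r′ w-inner)) (trans (Pair-e D new rr)
      (trans (child-parent π τ i x p v) (&-if sv q))))

    Result : Set
    Result = ChildReply ρ π′ τ′ i′ x′ (unit w) (same l (lab d)) (if same l (lab d) then does (inst v ≟I All-∋ x p) else true)

    at-child : ∀ {d′} (p′ : ts ∋ d′) v′ → w ≡ plug (snoc π′ τ′ i′ p′) v′ → isSelf v′ ≡ true → Result
    at-child p′ v′ refl sv′ = child p′ v′ refl sv′
      (trans (sym (trans (parent-child π′ τ′ i′ x′ p′ v′) (&-identity sv′)))
        (trans (Pair-e D rr new) (trans (parent-child π τ i x p v) (&-identity sv))))
      (trans (sym (trans (child-parent π′ τ′ i′ x′ p′ v′) (&-identity sv′)))
        (trans (Pair-e D new rr) (trans (child-parent π τ i x p v) (&-identity sv))))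

    at-put : ∀ {u} → w ≡ plug π′ (mk τ′ i′ (below u)) → pc l u ≡ true ⊎ cp l u x′ ≡ true → Put u → Result
    at-put q (inj₁ a) (at p′ v′) = at-child p′ v′ q (proj₁ (&-true (trans (sym (pc-put l p′ v′)) a)))
    at-put q (inj₂ a) (at p′ v′) = at-child p′ v′ q (proj₁ (&-true (trans (sym (cp-put l p′ v′ x′)) a)))

    found : (Σ (Vtx (node l ts)) λ v′ → w ≡ plug π′ v′ × Adj (mk τ′ i′ (self x′)) v′) ⊎
            (true ≡ true × Up π′ w) → Result
    found (inj₂ (_ , u)) = ⊥-elim (no-up D al new refl u w-inner)
    found (inj₁ (v′ , q , a)) with Adj-mk v′ a
    ... | adj {below u} c = at-put q c (unput u)
    found (inj₁ (v′ , refl , a)) | adj {self y} c = ⊥-elim (no-twin D al new refl refl w-inner)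

  fullUnit : ∀ c → K → Vtx c
  fullUnit (node l ts) j = mk (full ts) j (self (fulls ts))

  fullUnit-self : ∀ c j → isSelf (fullUnit c j) ≡ true
  fullUnit-self (node l ts) j = refl

  fullUnit-inst : ∀ c j → inst (fullUnit c j) ≡ (full (kids c) , j)
  fullUnit-inst (node l ts) j = refl

  fullUnit-ok : ∀ κ c j → okI κ (full (kids c)) j ≡ true → ok κ (fullUnit c j) ≡ true
  fullUnit-ok κ (node l ts) j q = &-intro q (okD-fulls l (full ts))

  self-sort : ∀ {c} (v : Vtx c) → isSelf v ≡ true → sort v ≡ c
  self-sort (mk _ _ (self _)) _ = refl

  -- The full unit at `π` was answered by the deviating `v′`. The root units `x` and `x′` are
  -- carried along because labels are recognised through them in `tell-apart`.
  record Line {m} (ρ : Env m) (c : Tree) : Set where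
    field
      π π′ : Path t c
      j  : K
      v′ : Vtx c
      v′-self  : isSelf v′ ≡ true
      deviates : isFull (proj₁ (inst v′)) ≡ false
      {x x′} : W
      x-root  : IsRootUnit x
      x′-root : IsRootUnit x′
      x-pair  : Pair ρ (lab c) x x′
      v-pair  : Pair ρ (lab c) (unit (plug π (fullUnit c j))) (unit (plug π′ v′))
      aligned : Aligned ρ (lab c) π π′
      v-ok    : valid (lab c) (unit (plug π (fullUnit c j))) ≡ true
      v′-ok   : valid (fl (lab c)) (unit (plug π′ v′)) ≡ true

  Lost : Tree → Set
  Lost c = ∀ {m} {ρ : Env m} → Reduced c → Line ρ c → Dup (kids c) ρ → ⊥

  -- The edges with the parent force the answer into the pool of a child with the label of `d`.
  -- Another child of that label is incomparable with `d` and loses by `tell-apart`; in the pool of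
  -- `d` itself, the last hypothesis makes the answer deviate.
  advance : ∀ {m l ts d x₀ x₀′} {ρ : Env m} {π π′ : Path t (node l ts)} {τ i x τ′ i′ x′} (p : ts ∋ d) → Lost d →
    Reduced (node l ts) → IsRootUnit x₀ → IsRootUnit x₀′ → Pair ρ (lab d) x₀ x₀′ → Aligned ρ (lab d) π π′ →
    Pair ρ (lab d) (unit (plug π (mk τ i (self x)))) (unit (plug π′ (mk τ′ i′ (self x′)))) →
    valid (lab d) (unit (plug π (mk τ i (self x)))) ≡ true →
    ∀ j → okI (kind l (lab d) (All-∋ τ p)) (full (kids d)) j ≡ true →
    (∀ τ″ i″ → okI (kind l (lab d) (All-∋ τ′ p)) τ″ i″ ≡ true →
       (if same l (lab d) then does ((τ″ , i″) ≟I All-∋ x′ p) else true) ≡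
       (if same l (lab d) then does ((full (kids d) , j) ≟I All-∋ x p) else true) → isFull τ″ ≡ false) →
    Dup ts ρ → ⊥
  advance {l = l} {ts} {d} {π = π} {π′} {τ} {i} {x} {τ′} {i′} {x′} p lost red rt rt′ roots al vv v-ok j ok-j small D =
    go (pick D p (unit v₁) v₁-ok)
    where
    v₁ : Vtx t
    v₁ = plug (snoc π τ i p) (fullUnit d j)

    v₁-ok : ok (rootKind (lab d)) v₁ ≡ true
    v₁-ok with ok⁻ (rootKind (lab d)) π _ v-ok
    ... | a , b = ok⁺ (rootKind (lab d)) (snoc π τ i p) (fullUnit d j) (a , proj₁ (&-true b)) (fullUnit-ok _ d j ok-j)

    inner-plug : ∀ {d} (π : Path t (node l ts)) τ i (p : ts ∋ d) v → IsInner (unit (plug (snoc π τ i p) v))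
    inner-plug π τ i p v = inner (isSelf-plug π τ i (put p v))

    kids-plug : ∀ {d} (π : Path t (node l ts)) τ i (p : ts ∋ d) v → isSelf v ≡ true → kidsW (unit (plug (snoc π τ i p) v)) ≡ kids d
    kids-plug π τ i p v q = cong kids (trans (sort-plug (snoc π τ i p) v) (self-sort v q))

    indexed : ∀ {d} → ts ∋ d → Indexed (kids d)
    indexed p x = subtree-index (subtrees-kids t (path-subtree (snoc π τ i p)) x)

    siblings : ∀ {d′ : Tree} {p′ : ts ∋ d′} → p ≢∋ p′ → lab d ≡ lab d′ → ¬ Emb (kids d) (kids d′) × ¬ Emb (kids d′) (kids d)
    siblings ne l≡ with Reduced-siblings red ne
    ... | a , b = (λ q → a (Emb-tree l≡ q)) , (λ q → b (Emb-tree (sym l≡) q))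

    settle : ∀ {m} {ρ′ : Env m} {d′} {p′ : ts ∋ d′} {v} → Compare p p′ → Dup (kids d) ρ′ →
      Pair ρ′ (lab d) (unit v₁) (unit (plug (snoc π′ τ′ i′ p′) v)) →
      Pair ρ′ (lab d) _ _ → Pair ρ′ (lab d) (unit (plug π (mk τ i (self x)))) (unit (plug π′ (mk τ′ i′ (self x′)))) →
      ok (rootKind (fl (lab d))) (plug (snoc π′ τ′ i′ p′) v) ≡ true → isSelf v ≡ true → same l (lab d′) ≡ same l (lab d) →
      (if same l (lab d′) then does (inst v ≟I All-∋ x′ p′) else true) ≡
      (if same l (lab d) then does (inst (fullUnit d j) ≟I All-∋ x p) else true) → ⊥
    settle {v = v} equal D′ new roots′ old-v ok′ v-self pc≡ cp≡ = lost (Reduced-kids red p) (record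
      { π = snoc π τ i p ; π′ = snoc π′ τ′ i′ p ; j = j ; v′ = v ; v′-self = v-self
      ; deviates = small _ _ (inst-ok v (proj₂ (ok⁻ (rootKind (fl (lab d))) (snoc π′ τ′ i′ p) v ok′)))
          (trans cp≡ (cong (λ I → if same l (lab d) then does (I ≟I All-∋ x p) else true) (fullUnit-inst d j)))
      ; x-root = rt ; x′-root = rt′ ; x-pair = roots′ ; v-pair = new ; aligned = snoc old-v
      ; v-ok = v₁-ok ; v′-ok = ok′ }) D′
      where
      inst-ok : ∀ {κ c} (v : Vtx c) → ok κ v ≡ true → okI κ (proj₁ (inst v)) (proj₂ (inst v)) ≡ true
      inst-ok (mk τ i q) a = proj₁ (&-true a)
    settle {p′ = p′} {v} (differ ne) D′ new roots′ old-v ok′ v-self pc≡ cp≡ with siblings ne (same-injective l (sym pc≡))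
    ... | ¬e , ¬e′ = tell-apart (record
      { y-inner = inner-plug π τ i p (fullUnit d j) ; y′-inner = inner-plug π′ τ′ i′ p′ v
      ; x-root = rt ; x′-root = rt′ ; y-pair = new ; x-pair = roots′
      ; kids≡ = kids-plug π τ i p (fullUnit d j) (fullUnit-self d j) ; kids′≡ = kids-plug π′ τ′ i′ p′ v v-self })
      (indexed p) (indexed p′) (Nat.≤-trans (∋-height p) (path-height π)) ¬e ¬e′ D′

    go : Reply _ d (unit v₁) → ⊥
    go (answer b ρ′ b-ok D′ new old) with child-reply {p = p} {fullUnit d j} D′ (Aligned-old old al) (old vv) new (fullUnit-self d j)
    ... | child p′ v refl v-self pc≡ cp≡ = settle (compare p p′) D′ new (old roots) (old vv) b-ok v-self pc≡ cp≡

  deviants+1-full : ∀ {ts} (τ : Dv ts) i → okI deviants+1 τ i ≡ true → isFull τ ≡ true → (τ , i) ≡ (full ts , zero)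
  deviants+1-full τ zero    a q = cong (_, zero) (isFull⇒full τ q)
  deviants+1-full τ (suc i) a q with isFull τ
  deviants+1-full τ (suc i) () refl | .true

  not⇒false : ∀ {a} → not a ≡ true → a ≡ false
  not⇒false {false} _ = refl

  -- If the answer designates a deviant for `d`, Spoiler picks his designated instance, copy zero.
  -- If it designates a full instance, this is the only one in its pool, and the undesignated copy
  -- one must be answered by a deviant.
  spoil-same : ∀ {m ts d x₀ x₀′} {ρ : Env m} {π π′ : Path t (node (lab d) ts)} {j τ′ i′ x′} (p : ts ∋ d) → Lost d →
    Reduced (node (lab d) ts) → IsRootUnit x₀ → IsRootUnit x₀′ → Pair ρ (lab d) x₀ x₀′ → Aligned ρ (lab d) π π′ →
    Pair ρ (lab d) (unit (plug π (mk (full ts) j (self (fulls ts))))) (unit (plug π′ (mk τ′ i′ (self x′)))) →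
    valid (lab d) (unit (plug π (mk (full ts) j (self (fulls ts))))) ≡ true → All-∋ τ′ p ≡ true → okD (lab d) τ′ x′ ≡ true →
    Dup ts ρ → ⊥
  spoil-same {ts = ts} {d} {τ′ = τ′} {x′ = x′} p lost red rt rt′ roots al vv v-ok dev ok′ D = go _ refl
    where
    l : Γ
    l = lab d

    kind-same : ∀ {b} → kind l l b ≡ (if b then deviants+1 else all-units)
    kind-same {b} = if-same {l = l} refl

    ok-j : ∀ j → okI (kind l l (All-∋ (full ts) p)) (full (kids d)) j ≡ true
    ok-j j = cong (λ κ → okI κ (full (kids d)) j) (trans (cong (kind l l) (full-∋ p)) kind-same)

    small-kind : kind l l (All-∋ τ′ p) ≡ deviants+1
    small-kind = trans (cong (kind l l) dev) kind-same

    designated : ∀ {a b} → (if same l l then a else true) ≡ (if same l l then b else true) → a ≡ b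
    designated q = trans (sym (if-same {l = l} refl)) (trans q (if-same {l = l} refl))

    go : ∀ b → isFull (proj₁ (All-∋ x′ p)) ≡ b → ⊥
    go false q = advance p lost red rt rt′ roots al vv v-ok zero (ok-j zero) small D
      where
      small : ∀ τ″ i″ → okI (kind l l (All-∋ τ′ p)) τ″ i″ ≡ true →
        (if same l l then does ((τ″ , i″) ≟I All-∋ x′ p) else true) ≡
        (if same l l then does ((full (kids d) , zero) ≟I All-∋ (fulls ts) p) else true) → isFull τ″ ≡ false
      small τ″ i″ _ r = trans (cong (λ I → isFull (proj₁ I)) (does-true ((τ″ , i″) ≟I All-∋ x′ p)
        (trans (designated r) (dec-true (_ ≟I _) (sym (fulls-∋ p)))))) q
    go true q = advance p lost red rt rt′ roots al vv v-ok (suc zero) (ok-j (suc zero)) small D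
      where
      x′≡ : All-∋ x′ p ≡ (full (kids d) , zero)
      x′≡ = deviants+1-full _ _ (trans (cong (λ κ → okI κ (proj₁ (All-∋ x′ p)) (proj₂ (All-∋ x′ p))) (sym small-kind))
        (trans (sym (if-same {l = l} refl)) (okD-∋ l τ′ x′ p ok′))) q

      other : (full (kids d) , suc zero) ≢ All-∋ (fulls ts) p
      other e with trans e (fulls-∋ p)
      ... | ()

      small : ∀ τ″ i″ → okI (kind l l (All-∋ τ′ p)) τ″ i″ ≡ true →
        (if same l l then does ((τ″ , i″) ≟I All-∋ x′ p) else true) ≡
        (if same l l then does ((full (kids d) , suc zero) ≟I All-∋ (fulls ts) p) else true) → isFull τ″ ≡ false
      small τ″ i″ a r = Bool.¬-not λ f → true≢false (trans
        (sym (dec-true ((τ″ , i″) ≟I All-∋ x′ p)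
          (trans (deviants+1-full τ″ i″ (trans (cong (λ κ → okI κ τ″ i″) (sym small-kind)) a) f) (sym x′≡))))
        (trans (designated r) (dec-false (_ ≟I _) other)))

  -- The change of label makes Spoiler move on the side of the deviating unit. Its altered pool
  -- offers full units, whereas the full unit opposite has only deviants there.
  spoil-other : ∀ {m l ts d x₀ x₀′} {ρ : Env m} {π π′ : Path t (node l ts)} {j τ′ i′ x′} (p : ts ∋ d) → l ≢ lab d → Lost d →
    Reduced (node l ts) → IsRootUnit x₀ → IsRootUnit x₀′ → Pair ρ (lab d) x₀ x₀′ → Aligned ρ (lab d) π′ π →
    Pair ρ (lab d) (unit (plug π′ (mk τ′ i′ (self x′)))) (unit (plug π (mk (full ts) j (self (fulls ts))))) →
    valid (lab d) (unit (plug π′ (mk τ′ i′ (self x′)))) ≡ true → All-∋ τ′ p ≡ true → Dup ts ρ → ⊥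
  spoil-other {l = l} {ts} {d} p ne lost red rt rt′ roots al vv v-ok dev D =
    advance p lost red rt rt′ roots al vv v-ok zero
      (cong (λ κ → okI κ (full (kids d)) zero) (trans (cong (kind l (lab d)) dev) (if-other ne)))
      (λ τ″ i″ a _ → not⇒false (trans (cong (λ κ → okI κ τ″ i″)
         (sym (trans (cong (kind l (lab d)) (full-∋ p)) (if-other ne)))) a)) D

  spoil : ∀ c → Lost c
  spoil = Tree-rec step
    where
    step : ∀ {l ts} → (∀ {d} → ts ∋ d → Lost d) → Lost (node l ts)
    step {l} {ts} lost {ρ = ρ} red L D = go v′ v′-self deviates v-pair v′-ok
      where
      open Line L
      r : W
      r = unit (plug π (fullUnit (node l ts) j))

      turn : ∀ {v d} → isSelf v ≡ true → Pair ρ l r (unit (plug π′ v)) → valid (fl l) (unit (plug π′ v)) ≡ true →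
             (p : ts ∋ d) → All-∋ (proj₁ (inst v)) p ≡ true → Dec (lab d ≡ l) → ⊥
      turn {v@(mk τ′ i′ (self x′))} _ vv ok′ p dev (yes refl) = spoil-same p (lost p) red x-root x′-root x-pair aligned vv v-ok dev
        (proj₂ (&-true (proj₂ (ok⁻ (rootKind (fl l)) π′ v ok′)))) D
      turn {mk τ′ i′ (self x′)} {d} _ vv ok′ p dev (no ne) = spoil-other p (λ q → ne (sym q)) (lost p) red x′-root x-root
        (Pair-side σ≡ (Pair-swap x-pair)) (subst (λ σ → Aligned ρ σ _ _) σ≡ (Aligned-swap aligned))
        (Pair-side σ≡ (Pair-swap vv)) (subst (λ σ → valid σ (unit (plug π′ (mk τ′ i′ (self x′)))) ≡ true) σ≡ ok′) dev D
        where
        σ≡ : fl l ≡ lab d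
        σ≡ = sym (≢⇒fl ne)

      go : ∀ v → isSelf v ≡ true → isFull (proj₁ (inst v)) ≡ false → Pair ρ l r (unit (plug π′ v)) →
           valid (fl l) (unit (plug π′ v)) ≡ true → ⊥
      go v sf dev vv ok′ with deviant-position (proj₁ (inst v)) dev
      ... | d , p , q = turn sf vv ok′ p q (lab d ≟Γ l)

  predecessor : ∀ {a} (p : Lb a) → p ≡ here ⊎ Σ (Lb a) λ q → bE q p ≡ true × bE p q ≡ false
  predecessor here = inj₁ refl
  predecessor (tm b zero)             = inj₂ (tm b (suc (suc zero)) , cong (_& true) (same-refl b) , cong (_& false) (same-refl b))
  predecessor (tm b (suc zero))       = inj₂ (tm b zero , cong (_& true) (same-refl b) , cong (_& false) (same-refl b))
  predecessor (tm b (suc (suc zero))) = inj₂ (tm b (suc zero) , cong (_& true) (same-refl b) , cong (_& false) (same-refl b))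
  predecessor (nt g p) with predecessor p
  ... | inj₁ refl        = inj₂ (here , refl , refl)
  ... | inj₂ (q , a , b) = inj₂ (nt g q , &-intro (does-refl g) a , trans (cong (_& bE p q) (does-refl g)) b)

  bE-antisym : ∀ {a} (p q : Lb a) → bE p q ≡ true → bE q p ≡ true → p ≡ q
  bE-antisym here here _ _ = refl
  bE-antisym here (nt g here) _ ()
  bE-antisym here (tm b i) () _
  bE-antisym (tm b i) here _ ()
  bE-antisym (tm b i) (tm b′ i′) x y with &-true {same b b′} x
  ... | x₁ , x₂ with same⇒≡ {b} {b′} x₁
  ...   | refl = cong (tm b) (cycle i i′ x₂ (proj₂ (&-true {same b b} y)))
    where
    cycle : ∀ i i′ → (does (i Fin.≟ i′) ∥ does (next i Fin.≟ i′)) ≡ true →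
            (does (i′ Fin.≟ i) ∥ does (next i′ Fin.≟ i)) ≡ true → i ≡ i′
    cycle zero zero _ _ = refl
    cycle zero (suc zero) _ ()
    cycle zero (suc (suc zero)) () _
    cycle (suc zero) zero () _
    cycle (suc zero) (suc zero) _ _ = refl
    cycle (suc zero) (suc (suc zero)) _ ()
    cycle (suc (suc zero)) zero _ ()
    cycle (suc (suc zero)) (suc zero) () _
    cycle (suc (suc zero)) (suc (suc zero)) _ _ = refl
  bE-antisym (nt g p) (nt g′ q) x y with &-true {does (g Fin.≟ g′)} x
  ... | x₁ , x₂ with does⇒≡ {i = g} {g′} x₁
  ...   | refl = cong (nt g) (bE-antisym p q x₂ (proj₂ (&-true {does (g Fin.≟ g)} y)))

  lE-antisym : ∀ x y → lE x y ≡ true → lE y x ≡ true → x ≡ y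
  lE-antisym (base r d p) y a b with lE-inv r d p {y} a
  ... | q , refl , c = cong (base r d) (bE-antisym p q c (trans (sym (lE-same r d q p)) b))

  first-kid : ∀ {F} → Fin (heightF F) → Σ Tree (F ∋_)
  first-kid {d ∷ F} _ = d , z

  deviantRoot : ∀ c {d} → kids c ∋ d → Σ (Vtx c) λ v → isSelf v ≡ true × ok deviants v ≡ true
  deviantRoot (node l (d ∷ ds)) _ = mk (true ∷ full ds) zero (self (fulls (d ∷ ds))) , refl , okD-fulls {d ∷ ds} l (true ∷ full ds)

  big-root : rootKind (lab t) ≡ all-units
  big-root = if-same {l = lab t} refl

  small-root : rootKind (fl (lab t)) ≡ deviants
  small-root = if-other (fl≢ (lab t))
    where
    fl≢ : ∀ l → fl l ≢ l
    fl≢ ∃ₗ ()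
    fl≢ ∀ₗ ()

  root-ok : ∀ j → valid (lab t) (unit (fullUnit t j)) ≡ true
  root-ok j = fullUnit-ok (rootKind (lab t)) t j (cong (λ κ → okI κ (full (kids t)) j) big-root)

  fullRoot : ∀ j → IsRootUnit (unit (fullUnit t j))
  fullRoot j = root (fullUnit-self t j)

  -- Two root units are joined both ways, two distinct labels never are. On the other side Spoiler
  -- picks a looped vertex with a one-way edge to the label, but no looped vertex has a one-way edge
  -- to a root unit.
  not-label : ∀ {m} {ρ : Env m} {x} → Dup (kids t) ρ → Pair ρ (lab t) (unit (fullUnit t zero)) (lbl x) → ⊥
  not-label {ρ = ρ} {x₀@(base r d p)} D q with first-kid {kids t} r
  ... | c , u = go (lab c ≟Γ lab t)
    where
    second-root : lab c ≡ lab t → Reply ρ c (unit (fullUnit t (suc zero))) → ⊥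
    second-root l≡ (answer b _ _ D′ new old) with loop b (trans (Pair-e D′ new new) (root-root (fullRoot (suc zero)) (fullRoot (suc zero))))
    ... | inj₁ b-root = true≢false (trans (sym (root-root (fullRoot zero) (fullRoot (suc zero))))
            (trans (sym (Pair-e D′ q′ new)) (label-root _ b-root)))
      where
      q′ = old (Pair-side (sym l≡) q)
    ... | inj₂ (y , refl) with lE-antisym x₀ y (trans (Pair-e D′ q′ new) (root-root (fullRoot zero) (fullRoot (suc zero))))
                                             (trans (Pair-e D′ new q′) (root-root (fullRoot (suc zero)) (fullRoot zero)))
      where
      q′ = old (Pair-side (sym l≡) q)
    ...   | refl = distinct (trans (sym (fullUnit-inst t zero)) (trans (cong inst (unit-injective (Pair-≡ D′ (old (Pair-side (sym l≡) q)) new))) (fullUnit-inst t (suc zero))))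
      where
      distinct : ¬ (_≡_ {A = Inst t} (full (kids t) , zero) (full (kids t) , suc zero))
      distinct ()

    below-label : ∀ {μ} → lab c ≡ fl (lab t) → e μ μ ≡ true → e μ (lbl x₀) ≡ true → e (lbl x₀) μ ≡ false → Reply ρ c μ → ⊥
    below-label l≡ loop-μ to from (answer b _ _ D′ new old)
      with loop b (trans (Pair-e D′ new new) loop-μ) | old (Pair-side (sym l≡) (Pair-swap q))
    ... | inj₁ b-root | q′ = true≢false (trans (sym (root-root (fullRoot zero) b-root)) (trans (Pair-e D′ q′ new) from))
    ... | inj₂ (y , refl) | q′ = true≢false (trans (sym to) (trans (sym (Pair-e D′ new q′)) (label-root y (fullRoot zero))))

    go : Dec (lab c ≡ lab t) → ⊥
    go (yes l≡) = second-root l≡ (pick D u _ (trans (cong (λ σ → valid σ (unit (fullUnit t (suc zero)))) l≡) (root-ok (suc zero))))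
    go (no ne) with predecessor p
    ... | inj₂ (w , to , from) = below-label (≢⇒fl ne) (trans (lE-same r d w w) (bE-refl w))
            (trans (lE-same r d w p) to) (trans (lE-same r d p w) from) (pick D u (lbl (base r d w)) refl)
    -- The beginning of a name has no predecessor among the labels, but root units point to it. On
    -- this side only deviant ones exist, and `u` provides a child to deviate at.
    ... | inj₁ refl with deviantRoot t u
    ...   | v , sf , v-ok = below-label (≢⇒fl ne) (root-root (root sf) (root sf)) (root-label r d here (root sf))
            (label-root x₀ (root sf)) (pick D u (unit v) (trans (cong (λ σ → ok (rootKind σ) v) (≢⇒fl ne))
              (trans (cong (λ κ → ok κ v) small-root) v-ok)))

  Spoiler-wins : Reduced t → ∀ {m} (ρ : Env m) → ¬ Dup (t ∷ []) ρ
  Spoiler-wins red ρ D with pick D z (unit (fullUnit t zero)) (root-ok zero)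
  ... | answer b _ b-ok D′ new _ with loop b (trans (Pair-e D′ new new) (root-root (fullRoot zero) (fullRoot zero)))
  ...   | inj₂ (x , refl) = not-label D′ new
  ...   | inj₁ (root {v} sf) = spoil t red (record
    { π = nil ; π′ = nil ; j = zero ; v′ = v ; v′-self = sf
    ; deviates = not-full v (trans (cong (λ κ → ok κ v) (sym small-root)) b-ok)
    ; x-root = fullRoot zero ; x′-root = root sf ; x-pair = new ; v-pair = new ; aligned = nil
    ; v-ok = root-ok zero ; v′-ok = b-ok }) D′
    where
    not-full : ∀ {c} (v : Vtx c) → ok deviants v ≡ true → isFull (proj₁ (inst v)) ≡ false
    not-full (mk τ i _) a = not⇒false (proj₁ (&-true a))

theorem5p1 : (S₁ S₂ : Forest) → ¬ (S₁ ⪯e S₂) →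
  Σ Sentence λ θ → (qs θ ⪯e S₁) ×
    ((θ' : Sentence) → qs θ' ⪯e S₂ → ¬ SameProperty θ θ')
theorem5p1 S₁ S₂ S₁⋠S₂ with ¬Emb-witness S₁ (λ ε → S₁⋠S₂ (Emb⇒⪯e ε))
... | t₁ , t₁∈S₁ , t₁⋠S₂ = θ , Emb⇒⪯e (Emb-trans (χ-qs (G ∃ₗ) (t ∷ []) noVars) (Emb-trans (prune⊑ t₁) (∋-Emb t₁∈S₁))) , separates
  where
  t : Tree
  t = prune t₁

  -- A play of the game of `S₂` has at most this many moves, so the copies never run out.
  open Units (heightF S₂)
  open Structure t
  open Spoiler (heightF S₂) t
  open Plays (heightF S₂) t
  open Preservation (heightF S₂) t

  θ : Sentence
  θ = χ (G ∃ₗ) (t ∷ []) noVars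

  separates : (θ' : Sentence) → qs θ' ⪯e S₂ → ¬ SameProperty θ θ'
  separates θ' q same = Spoiler-wins (prune-Reduced t₁) (λ _ → noVars)
    (χ⇒Dup (t ∷ []) noVars noVars (λ _ → noVars) (λ ()) (λ ()) (proj₂ (same (G ∀ₗ))
      (preserve₀ (λ ε → t₁⋠S₂ (Emb-trans (prune⊒ t₁) ε)) (Nat.n≤1+n _) θ' (⪯e⇒Emb _ q)
        (proj₁ (same (G ∃ₗ)) (χ-holds (G ∃ₗ) (t ∷ []) noVars)))))
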